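{- Let $n\ge 1$ and $0\le d\le n/2$ be integers and let $B=b_1,\dots,b_d\in\mathcal{B}_{n,d}$. With respect to any exchangeable measure, the squared norm of $\chi_B$ is $\|\chi_B\|^2=c_B\|\chi_d\|^2$, where $$c_B=\prod_{i=1}^d\frac{(b_i-2(i-1))(b_i-2(i-1)-1)}{2}$$ and $\chi_d=\prod_{i=1}^d(x_{2i-1}-x_{2i})$.
   Context: A polynomial $P\in\mathbb{R}[x_1,\dots,x_n]$ is multilinear if all its monomials are squarefree. A multilinear polynomial $P$ is harmonic if $\sum_{i=1}^n \partial P/\partial x_i=0$. $\mathcal{H}_n$ is the real vector space of harmonic multilinear polynomials in $x_1,\dots,x_n$. Write $[n]=\{1,\dots,n\}$. For an integer $0\le d\le n/2$, $\mathcal{S}_{n,d}$ is the set of sequences $S=s_1,\dots,s_d$ of distinct elements of $[n]$. For disjoint $A,B\in\mathcal{S}_{n,d}$ (no common elements), let $\chi_{A,B}=\prod_{i=1}^d (x_{a_i}-x_{b_i})$, and write $A<B$ if $a_i<b_i$ for all $i\in[d]$ ($A$ need not be increasing). A top set of length $d$ is an increasing sequence $B\in\mathcal{S}_{n,d}$ for which there exists a sequence $A\in\mathcal{S}_{n,d}$ disjoint from $B$ with $A<B$. $\mathcal{B}_{n,d}$ is the set of top sets of length $d$. For $B\in\mathcal{B}_{n,d}$, define $$\chi_B=\sum_{A\in\mathcal{S}_{n,d}:\ A\cap B=\emptyset,\ A<B}\chi_{A,B}$$ (so $\chi_\emptyset=1$, and $\chi_d=\chi_{2,4,\dots,2d}$).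 An exchangeable measure is a probability distribution $\mu$ of $(x_1,\dots,x_n)\in\mathbb{R}^n$ that is invariant under permutations of the indices; it is assumed that $\mathbb{E}_\mu|fg|<\infty$ for all $f,g\in\mathcal{H}_n$, and one puts $\langle f,g\rangle=\mathbb{E}_\mu[fg]$, $\|f\|=\sqrt{\langle f,f\rangle}$. -}

module Defs where

open import Data.Bool.Base using (if_then_else_)
open import Data.Empty using (⊥)
open import Data.Fin.Base as Fin using (Fin; toℕ; inject≤; combine)
open import Data.Fin.Patterns using (0F; 1F)
open import Data.Fin.Permutation using (Permutation′; _⟨$⟩ʳ_)
import Data.Fin.Properties as Fin
open import Data.Fin.Subset using (Subset; inside; outside; ⁅_⁆; _∪_) renaming (_∈_ to _∈ˢ_)
open import Data.Fin.Subset.Properties using () renaming (_∈?_ to _∈ˢ?_)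
open import Data.Integer.Base as ℤ using (+_)
open import Data.List.Base as List using (List)
open import Data.Nat.Base as ℕ using (ℕ; zero; suc)
import Data.Nat.Properties as ℕ
open import Data.Product.Base using (_×_; _,_; ∃-syntax)
open import Data.Rational.Base as ℚ using (ℚ; 0ℚ; 1ℚ; ½)
import Data.Rational.Properties as ℚ
open import Data.Rational.Solver using (module +-*-Solver)
open import Data.Sum.Base using (inj₁; inj₂)
open import Data.Vec.Base as Vec using (Vec; []; _∷_; lookup)
import Data.Vec.Functional as Vector
open import Data.Vec.Membership.DecPropositional using (_∉_; _∈?_)
open import Data.Vec.Relation.Binary.Pointwise.Inductive using (Pointwise) renaming (decidable to pointwise?)
open import Data.Vec.Relation.Unary.All using (All; all?)
open import Data.Vec.Relation.Unary.AllPairs using (AllPairs; allPairs?)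
open import Data.Vec.Relation.Unary.Unique.Propositional using (Unique)
open import Function.Base using (_∘_)
open import Function.Bundles using (_⇔_)
open import Relation.Binary.PropositionalEquality using (_≡_; _≢_; refl; sym; trans; cong; cong₂; subst)
open import Relation.Nullary using (¬_; does; ¬?)
open import Relation.Nullary.Decidable using (_×-dec_)
open import Relation.Unary using (Decidable)

Cauchy : (ℕ → ℚ) → Set
Cauchy s = ∀ ε → 0ℚ ℚ.< ε → ∃[ N ] ∀ m n → N ℕ.≤ m → N ℕ.≤ n → ℚ.∣ s m ℚ.- s n ∣ ℚ.≤ ε

record ℝ : Set where
  constructor mkℝ
  field
    seq    : ℕ → ℚ
    cauchy : Cauchy seq

open ℝ public

private
  open +-*-Solver using (solve; _:=_; _:+_; _:*_; _:-_; :-_)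

  EventuallyBounded : (ℕ → ℚ) → Set
  EventuallyBounded s = ∃[ K ] ℚ.Positive K × ∃[ N ] (∀ n → N ℕ.≤ n → ℚ.∣ s n ∣ ℚ.≤ K)

  abstract
    +-sub-+ : ∀ a b c d → (a ℚ.+ b) ℚ.- (c ℚ.+ d) ≡ (a ℚ.- c) ℚ.+ (b ℚ.- d)
    +-sub-+ = solve 4 (λ a b c d → (a :+ b) :- (c :+ d) := (a :- c) :+ (b :- d)) refl

    *-sub-* : ∀ a b c d → a ℚ.* b ℚ.- c ℚ.* d ≡ a ℚ.* (b ℚ.- d) ℚ.+ d ℚ.* (a ℚ.- c)
    *-sub-* = solve 4 (λ a b c d → a :* b :- c :* d := a :* (b :- d) :+ d :* (a :- c)) refl

    neg-sub-neg : ∀ a b → (ℚ.- a) ℚ.- (ℚ.- b) ≡ ℚ.- (a ℚ.- b)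
    neg-sub-neg = solve 2 (λ a b → (:- a) :- (:- b) := :- (a :- b)) refl

    neg-sub : ∀ a b → ℚ.- (a ℚ.- b) ≡ b ℚ.- a
    neg-sub = solve 2 (λ a b → :- (a :- b) := b :- a) refl

    sub-add : ∀ a b → (a ℚ.- b) ℚ.+ b ≡ a
    sub-add = solve 2 (λ a b → (a :- b) :+ b := a) refl

    add-sub : ∀ a b → (a ℚ.+ b) ℚ.- b ≡ a
    add-sub = solve 2 (λ a b → a :+ b :- b := a) refl

    halve : ∀ ε → 0ℚ ℚ.< ε → 0ℚ ℚ.< ½ ℚ.* ε
    halve ε 0<ε = subst (ℚ._< ½ ℚ.* ε) (ℚ.*-zeroʳ ½) (ℚ.*-monoʳ-<-pos ½ 0<ε)

    halves : ∀ ε → ½ ℚ.* ε ℚ.+ ½ ℚ.* ε ≡ ε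
    halves ε = trans (sym (ℚ.*-distribʳ-+ ε ½ ½)) (ℚ.*-identityˡ ε)

    cauchy-const : ∀ q → Cauchy (λ _ → q)
    cauchy-const q ε 0<ε = 0 , λ _ _ _ _ →
      subst (ℚ._≤ ε) (sym (cong ℚ.∣_∣ (ℚ.+-inverseʳ q))) (ℚ.<⇒≤ 0<ε)

    cauchy-+ : ∀ s t → Cauchy s → Cauchy t → Cauchy (λ n → s n ℚ.+ t n)
    cauchy-+ s t cs ct ε 0<ε with cs (½ ℚ.* ε) (halve ε 0<ε) | ct (½ ℚ.* ε) (halve ε 0<ε)
    ... | M , hs | N , ht = M ℕ.⊔ N , λ m n p q → begin
      ℚ.∣ (s m ℚ.+ t m) ℚ.- (s n ℚ.+ t n) ∣
        ≡⟨ cong ℚ.∣_∣ (+-sub-+ (s m) (t m) (s n) (t n)) ⟩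
      ℚ.∣ (s m ℚ.- s n) ℚ.+ (t m ℚ.- t n) ∣
        ≤⟨ ℚ.∣p+q∣≤∣p∣+∣q∣ (s m ℚ.- s n) (t m ℚ.- t n) ⟩
      ℚ.∣ s m ℚ.- s n ∣ ℚ.+ ℚ.∣ t m ℚ.- t n ∣
        ≤⟨ ℚ.+-mono-≤ (hs m n (ℕ.m⊔n≤o⇒m≤o M N p) (ℕ.m⊔n≤o⇒m≤o M N q))
                      (ht m n (ℕ.m⊔n≤o⇒n≤o M N p) (ℕ.m⊔n≤o⇒n≤o M N q)) ⟩
      ½ ℚ.* ε ℚ.+ ½ ℚ.* ε
        ≡⟨ halves ε ⟩
      ε ∎
      where open ℚ.≤-Reasoning

    cauchy-neg : ∀ s → Cauchy s → Cauchy (λ n → ℚ.- s n)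
    cauchy-neg s cs ε 0<ε with cs ε 0<ε
    ... | N , h = N , λ m n p q → begin
      ℚ.∣ (ℚ.- s m) ℚ.- (ℚ.- s n) ∣
        ≡⟨ cong ℚ.∣_∣ (neg-sub-neg (s m) (s n)) ⟩
      ℚ.∣ ℚ.- (s m ℚ.- s n) ∣
        ≡⟨ ℚ.∣-p∣≡∣p∣ (s m ℚ.- s n) ⟩
      ℚ.∣ s m ℚ.- s n ∣
        ≤⟨ h m n p q ⟩
      ε ∎
      where open ℚ.≤-Reasoning

    ∣p∣≤∣p-q∣+∣q∣ : ∀ p q → ℚ.∣ p ∣ ℚ.≤ ℚ.∣ p ℚ.- q ∣ ℚ.+ ℚ.∣ q ∣
    ∣p∣≤∣p-q∣+∣q∣ p q = subst (λ r → ℚ.∣ r ∣ ℚ.≤ ℚ.∣ p ℚ.- q ∣ ℚ.+ ℚ.∣ q ∣)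
      (sub-add p q) (ℚ.∣p+q∣≤∣p∣+∣q∣ (p ℚ.- q) q)

    ∣∣p∣-∣q∣∣≤∣p-q∣ : ∀ p q → ℚ.∣ ℚ.∣ p ∣ ℚ.- ℚ.∣ q ∣ ∣ ℚ.≤ ℚ.∣ p ℚ.- q ∣
    ∣∣p∣-∣q∣∣≤∣p-q∣ p q with ℚ.∣p∣≡p∨∣p∣≡-p (ℚ.∣ p ∣ ℚ.- ℚ.∣ q ∣)
    ... | inj₁ eq = begin
      ℚ.∣ ℚ.∣ p ∣ ℚ.- ℚ.∣ q ∣ ∣                ≡⟨ eq ⟩
      ℚ.∣ p ∣ ℚ.- ℚ.∣ q ∣                      ≤⟨ ℚ.+-monoˡ-≤ (ℚ.- ℚ.∣ q ∣) (∣p∣≤∣p-q∣+∣q∣ p q) ⟩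
      ℚ.∣ p ℚ.- q ∣ ℚ.+ ℚ.∣ q ∣ ℚ.- ℚ.∣ q ∣    ≡⟨ add-sub ℚ.∣ p ℚ.- q ∣ ℚ.∣ q ∣ ⟩
      ℚ.∣ p ℚ.- q ∣                            ∎
      where open ℚ.≤-Reasoning
    ... | inj₂ eq = begin
      ℚ.∣ ℚ.∣ p ∣ ℚ.- ℚ.∣ q ∣ ∣                ≡⟨ eq ⟩
      ℚ.- (ℚ.∣ p ∣ ℚ.- ℚ.∣ q ∣)                ≡⟨ neg-sub ℚ.∣ p ∣ ℚ.∣ q ∣ ⟩
      ℚ.∣ q ∣ ℚ.- ℚ.∣ p ∣                      ≤⟨ ℚ.+-monoˡ-≤ (ℚ.- ℚ.∣ p ∣) (∣p∣≤∣p-q∣+∣q∣ q p) ⟩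
      ℚ.∣ q ℚ.- p ∣ ℚ.+ ℚ.∣ p ∣ ℚ.- ℚ.∣ p ∣    ≡⟨ add-sub ℚ.∣ q ℚ.- p ∣ ℚ.∣ p ∣ ⟩
      ℚ.∣ q ℚ.- p ∣                            ≡⟨ cong ℚ.∣_∣ (sym (neg-sub p q)) ⟩
      ℚ.∣ ℚ.- (p ℚ.- q) ∣                      ≡⟨ ℚ.∣-p∣≡∣p∣ (p ℚ.- q) ⟩
      ℚ.∣ p ℚ.- q ∣                            ∎
      where open ℚ.≤-Reasoning

    cauchy-abs : ∀ s → Cauchy s → Cauchy (λ n → ℚ.∣ s n ∣)
    cauchy-abs s cs ε 0<ε with cs ε 0<ε
    ... | N , h = N , λ m n p q → ℚ.≤-trans (∣∣p∣-∣q∣∣≤∣p-q∣ (s m) (s n)) (h m n p q)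

    cauchy⇒bounded : ∀ s → Cauchy s → EventuallyBounded s
    cauchy⇒bounded s cs with cs 1ℚ (ℚ.positive⁻¹ 1ℚ)
    ... | N , h = 1ℚ ℚ.+ ℚ.∣ s N ∣
                , ℚ.pos+nonNeg⇒pos 1ℚ ℚ.∣ s N ∣ {{ℚ.∣-∣-nonNeg (s N)}}
                , N
                , λ n p → ℚ.≤-trans (∣p∣≤∣p-q∣+∣q∣ (s n) (s N))
                                     (ℚ.+-monoˡ-≤ ℚ.∣ s N ∣ (h n N p ℕ.≤-refl))

    *-mono-≤ : ∀ {p q r s} → 0ℚ ℚ.≤ p → p ℚ.≤ q → 0ℚ ℚ.≤ r → r ℚ.≤ s → p ℚ.* r ℚ.≤ q ℚ.* s
    *-mono-≤ {p} {q} {r} {s} 0≤p p≤q 0≤r r≤s = ℚ.≤-trans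
      (ℚ.*-monoʳ-≤-nonNeg r {{ℚ.nonNegative 0≤r}} p≤q)
      (ℚ.*-monoˡ-≤-nonNeg q {{ℚ.nonNegative (ℚ.≤-trans 0≤p p≤q)}} r≤s)

    shrink : ∀ K → ℚ.Positive K → ∀ ε → 0ℚ ℚ.< ε → ∃[ δ ] 0ℚ ℚ.< δ × K ℚ.* δ ≡ ε
    shrink K K>0 ε 0<ε = 1/K ℚ.* ε
      , subst (ℚ._< 1/K ℚ.* ε) (ℚ.*-zeroʳ 1/K) (ℚ.*-monoʳ-<-pos 1/K {{ℚ.1/pos⇒pos K {{K>0}}}} 0<ε)
      , trans (sym (ℚ.*-assoc K 1/K ε))
          (trans (cong (ℚ._* ε) (ℚ.*-inverseʳ K {{K≢0}})) (ℚ.*-identityˡ ε))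
      where
      K≢0 : ℚ.NonZero K
      K≢0 = ℚ.pos⇒nonZero K {{K>0}}
      1/K : ℚ
      1/K = ℚ.1/_ K {{K≢0}}

    ∣*-sub-*∣ : ∀ a b c d {K L δ η} → ℚ.∣ a ∣ ℚ.≤ K → ℚ.∣ d ∣ ℚ.≤ L →
                ℚ.∣ b ℚ.- d ∣ ℚ.≤ δ → ℚ.∣ a ℚ.- c ∣ ℚ.≤ η →
                ℚ.∣ a ℚ.* b ℚ.- c ℚ.* d ∣ ℚ.≤ K ℚ.* δ ℚ.+ L ℚ.* η
    ∣*-sub-*∣ a b c d {K} {L} {δ} {η} a≤K d≤L b-d≤δ a-c≤η = begin
      ℚ.∣ a ℚ.* b ℚ.- c ℚ.* d ∣
        ≡⟨ cong ℚ.∣_∣ (*-sub-* a b c d) ⟩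
      ℚ.∣ a ℚ.* (b ℚ.- d) ℚ.+ d ℚ.* (a ℚ.- c) ∣
        ≤⟨ ℚ.∣p+q∣≤∣p∣+∣q∣ (a ℚ.* (b ℚ.- d)) (d ℚ.* (a ℚ.- c)) ⟩
      ℚ.∣ a ℚ.* (b ℚ.- d) ∣ ℚ.+ ℚ.∣ d ℚ.* (a ℚ.- c) ∣
        ≡⟨ cong₂ ℚ._+_ (ℚ.∣p*q∣≡∣p∣*∣q∣ a (b ℚ.- d)) (ℚ.∣p*q∣≡∣p∣*∣q∣ d (a ℚ.- c)) ⟩
      ℚ.∣ a ∣ ℚ.* ℚ.∣ b ℚ.- d ∣ ℚ.+ ℚ.∣ d ∣ ℚ.* ℚ.∣ a ℚ.- c ∣
        ≤⟨ ℚ.+-mono-≤ (*-mono-≤ (ℚ.0≤∣p∣ a) a≤K (ℚ.0≤∣p∣ (b ℚ.- d)) b-d≤δ)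
                      (*-mono-≤ (ℚ.0≤∣p∣ d) d≤L (ℚ.0≤∣p∣ (a ℚ.- c)) a-c≤η) ⟩
      K ℚ.* δ ℚ.+ L ℚ.* η ∎
      where open ℚ.≤-Reasoning

    cauchy-* : ∀ s t → Cauchy s → Cauchy t → Cauchy (λ n → s n ℚ.* t n)
    cauchy-* s t cs ct ε 0<ε = helper (cauchy⇒bounded s cs) (cauchy⇒bounded t ct)
      where
      combined : ∀ {K L δ η} N₁ N₂ N₃ N₄ →
        (∀ n → N₁ ℕ.≤ n → ℚ.∣ s n ∣ ℚ.≤ K) → (∀ n → N₂ ℕ.≤ n → ℚ.∣ t n ∣ ℚ.≤ L) →
        (∀ m n → N₃ ℕ.≤ m → N₃ ℕ.≤ n → ℚ.∣ t m ℚ.- t n ∣ ℚ.≤ δ) →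
        (∀ m n → N₄ ℕ.≤ m → N₄ ℕ.≤ n → ℚ.∣ s m ℚ.- s n ∣ ℚ.≤ η) →
        ∀ m n → (N₁ ℕ.⊔ N₂) ℕ.⊔ (N₃ ℕ.⊔ N₄) ℕ.≤ m → (N₁ ℕ.⊔ N₂) ℕ.⊔ (N₃ ℕ.⊔ N₄) ℕ.≤ n →
        ℚ.∣ s m ℚ.* t m ℚ.- s n ℚ.* t n ∣ ℚ.≤ K ℚ.* δ ℚ.+ L ℚ.* η
      combined N₁ N₂ N₃ N₄ hK hL ht hs m n p q = ∣*-sub-*∣ (s m) (t m) (s n) (t n)
        (hK m (ℕ.m⊔n≤o⇒m≤o N₁ N₂ (ℕ.m⊔n≤o⇒m≤o (N₁ ℕ.⊔ N₂) (N₃ ℕ.⊔ N₄) p)))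
        (hL n (ℕ.m⊔n≤o⇒n≤o N₁ N₂ (ℕ.m⊔n≤o⇒m≤o (N₁ ℕ.⊔ N₂) (N₃ ℕ.⊔ N₄) q)))
        (ht m n (ℕ.m⊔n≤o⇒m≤o N₃ N₄ N₃₄≤m) (ℕ.m⊔n≤o⇒m≤o N₃ N₄ N₃₄≤n))
        (hs m n (ℕ.m⊔n≤o⇒n≤o N₃ N₄ N₃₄≤m) (ℕ.m⊔n≤o⇒n≤o N₃ N₄ N₃₄≤n))
        where
        N₃₄≤m : N₃ ℕ.⊔ N₄ ℕ.≤ m
        N₃₄≤m = ℕ.m⊔n≤o⇒n≤o (N₁ ℕ.⊔ N₂) (N₃ ℕ.⊔ N₄) p
        N₃₄≤n : N₃ ℕ.⊔ N₄ ℕ.≤ n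
        N₃₄≤n = ℕ.m⊔n≤o⇒n≤o (N₁ ℕ.⊔ N₂) (N₃ ℕ.⊔ N₄) q

      helper : EventuallyBounded s → EventuallyBounded t →
        ∃[ N ] ∀ m n → N ℕ.≤ m → N ℕ.≤ n → ℚ.∣ s m ℚ.* t m ℚ.- s n ℚ.* t n ∣ ℚ.≤ ε
      helper (K , K>0 , N₁ , hK) (L , L>0 , N₂ , hL) =
        let δ , 0<δ , Kδ≡½ε = shrink K K>0 (½ ℚ.* ε) (halve ε 0<ε)
            η , 0<η , Lη≡½ε = shrink L L>0 (½ ℚ.* ε) (halve ε 0<ε)
            N₃ , ht = ct δ 0<δ
            N₄ , hs = cs η 0<η
        in (N₁ ℕ.⊔ N₂) ℕ.⊔ (N₃ ℕ.⊔ N₄) , λ m n p q →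
           ℚ.≤-trans (combined N₁ N₂ N₃ N₄ hK hL ht hs m n p q)
             (ℚ.≤-reflexive (trans (cong₂ ℚ._+_ Kδ≡½ε Lη≡½ε) (halves ε)))

infix  4 _≈_ _≤_
infixl 6 _+_ _-_
infixl 7 _*_
infix  8 -_

fromℚ : ℚ → ℝ
fromℚ q = mkℝ (λ _ → q) (cauchy-const q)

0ℝ 1ℝ : ℝ
0ℝ = fromℚ 0ℚ
1ℝ = fromℚ 1ℚ

_+_ _*_ : ℝ → ℝ → ℝ
x + y = mkℝ (λ n → seq x n ℚ.+ seq y n) (cauchy-+ (seq x) (seq y) (cauchy x) (cauchy y))
x * y = mkℝ (λ n → seq x n ℚ.* seq y n) (cauchy-* (seq x) (seq y) (cauchy x) (cauchy y))

-_ : ℝ → ℝ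
- x = mkℝ (λ n → ℚ.- seq x n) (cauchy-neg (seq x) (cauchy x))

_-_ : ℝ → ℝ → ℝ
x - y = x + (- y)

∣_∣ : ℝ → ℝ
∣ x ∣ = mkℝ (λ n → ℚ.∣ seq x n ∣) (cauchy-abs (seq x) (cauchy x))

record _≈_ (x y : ℝ) : Set where
  constructor mk≈
  field
    close : ∀ ε → 0ℚ ℚ.< ε → ∃[ N ] ∀ n → N ℕ.≤ n → ℚ.∣ seq x n ℚ.- seq y n ∣ ℚ.≤ ε

record _≤_ (x y : ℝ) : Set where
  constructor mk≤
  field
    below : ∀ ε → 0ℚ ℚ.< ε → ∃[ N ] ∀ n → N ℕ.≤ n → seq x n ℚ.≤ seq y n ℚ.+ ε

_⟶_ : (ℕ → ℝ) → ℝ → Set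
a ⟶ l = ∀ ε → 0ℚ ℚ.< ε → ∃[ N ] ∀ n → N ℕ.≤ n → ∣ a n - l ∣ ≤ fromℚ ε

partialSum : (ℕ → ℝ) → ℕ → ℝ
partialSum a zero    = 0ℝ
partialSum a (suc n) = partialSum a n + a n

_SumsTo_ : (ℕ → ℝ) → ℝ → Set
a SumsTo l = partialSum a ⟶ l

∑ ∏ : ∀ {d} → (Fin d → ℝ) → ℝ
∑ = Vector.foldr _+_ 0ℝ
∏ = Vector.foldr _*_ 1ℝ

∑[_] : ∀ {A : Set} → List A → (A → ℝ) → ℝ
∑[ as ] f = List.foldr _+_ 0ℝ (List.map f as)

ℝ^ : ℕ → Set
ℝ^ n = Fin n → ℝ

-- Codes for Borel sets: ⟦_⟧ sends them onto the σ-algebra generated by the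
-- half-spaces { x | xᵢ ≤ c }.
data Borel (n : ℕ) : Set where
  ∅         : Borel n
  halfSpace : Fin n → ℝ → Borel n
  ∁         : Borel n → Borel n
  ⋃ ⋂       : (ℕ → Borel n) → Borel n

⟦_⟧ : ∀ {n} → Borel n → ℝ^ n → Set
⟦ ∅ ⟧             x = ⊥
⟦ halfSpace i c ⟧ x = x i ≤ c
⟦ ∁ A ⟧           x = ¬ ⟦ A ⟧ x
⟦ ⋃ A ⟧           x = ∃[ k ] ⟦ A k ⟧ x
⟦ ⋂ A ⟧           x = ∀ k → ⟦ A k ⟧ x

PairwiseDisjoint : ∀ {n} → (ℕ → Borel n) → Set
PairwiseDisjoint A = ∀ j k → j ≢ k → ∀ x → ⟦ A j ⟧ x → ¬ ⟦ A k ⟧ x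

record ProbabilityMeasure (n : ℕ) : Set where
  field
    μ          : Borel n → ℝ
    μ-cong     : ∀ A B → (∀ x → ⟦ A ⟧ x ⇔ ⟦ B ⟧ x) → μ A ≈ μ B
    μ-nonNeg   : ∀ A → 0ℝ ≤ μ A
    μ-total    : μ (∁ ∅) ≈ 1ℝ
    μ-additive : ∀ A → PairwiseDisjoint A → (λ k → μ (A k)) SumsTo μ (⋃ A)

-- The Lebesgue integral for a finite measure in the form given by Kolmogorov
-- and Fomin: a simple function takes countably many values, each on a
-- measurable set; it is integrable when ∑ₖ yₖ μ(Aₖ) converges absolutely; and
-- f is integrable when it is a uniform limit of integrable simple functions,
-- its integral being the limit of theirs.
module _ {n : ℕ} (P : ProbabilityMeasure n) where
  open ProbabilityMeasure P

  record SimpleFunction : Set where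
    field
      piece    : ℕ → Borel n
      value    : ℕ → ℝ
      disjoint : PairwiseDisjoint piece
      cover    : ∀ x → ∃[ k ] ⟦ piece k ⟧ x

  open SimpleFunction

  record HasSimpleIntegral (s : SimpleFunction) (v : ℝ) : Set where
    field
      absolutely : ∃[ M ] (λ k → ∣ value s k * μ (piece s k) ∣) SumsTo M
      sums       : (λ k → value s k * μ (piece s k)) SumsTo v

  Within : ℚ → (ℝ^ n → ℝ) → SimpleFunction → Set
  Within ε f s = ∀ k x → ⟦ piece s k ⟧ x → ∣ f x - value s k ∣ ≤ fromℚ ε

  HasIntegral : (ℝ^ n → ℝ) → ℝ → Set
  HasIntegral f v = ∀ ε → 0ℚ ℚ.< ε →
    ∃[ s ] ∃[ w ] HasSimpleIntegral s w × Within ε f s × ∣ w - v ∣ ≤ fromℚ ε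

  Integrable : (ℝ^ n → ℝ) → Set
  Integrable f = ∃[ v ] HasIntegral f v

  -- ‖ f ‖² = 𝔼[ f · f ] has the value v
  HasSquaredNorm : (ℝ^ n → ℝ) → ℝ → Set
  HasSquaredNorm f = HasIntegral (λ x → f x * f x)

vectorsOver : ∀ {A : Set} → List A → ∀ d → List (Vec A d)
vectorsOver as zero    = List.[ [] ]
vectorsOver as (suc d) = List.cartesianProductWith _∷_ as (vectorsOver as d)

subsets : ∀ n → List (Subset n)
subsets = vectorsOver (inside List.∷ outside List.∷ List.[])

-- Squarefree monomials ∏_{i ∈ S} xᵢ correspond to subsets S, so a multilinear
-- polynomial is its family of coefficients indexed by subsets.
Multilinear : ℕ → Set
Multilinear n = Subset n → ℝ

monomial : ∀ {n} → Subset n → ℝ^ n → ℝ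
monomial S x = ∏ λ i → if does (i ∈ˢ? S) then x i else 1ℝ

eval : ∀ {n} → Multilinear n → ℝ^ n → ℝ
eval {n} P x = ∑[ subsets n ] λ S → P S * monomial S x

-- The coefficient of ∏_{j ∈ S} xⱼ in ∂P/∂xᵢ.
∂ : ∀ {n} → Fin n → Multilinear n → Multilinear n
∂ i P S = if does (i ∈ˢ? S) then 0ℝ else P (S ∪ ⁅ i ⁆)

Harmonic : ∀ {n} → Multilinear n → Set
Harmonic P = ∀ S → ∑ (λ i → ∂ i P S) ≈ 0ℝ

record ExchangeableMeasure (n : ℕ) : Set where
  field
    measure      : ProbabilityMeasure n
  open ProbabilityMeasure measure public
  field
    exchangeable : (π : Permutation′ n) (A B : Borel n) →
                   (∀ x → ⟦ A ⟧ x ⇔ ⟦ B ⟧ (x ∘ (π ⟨$⟩ʳ_))) → μ A ≈ μ B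
    -- 𝔼|fg| < ∞: Lebesgue integrability is absolute, so this is
    -- integrability of fg.
    integrable   : (f g : Multilinear n) → Harmonic f → Harmonic g →
                   Integrable measure (λ x → eval f x * eval g x)

-- The element k of [n] = {1,…,n} is the i : Fin n with toℕ i = k - 1.
_Below_ : ∀ {n d} → Vec (Fin n) d → Vec (Fin n) d → Set
A Below B = Unique A × All (λ a → _∉_ Fin._≟_ a B) A × Pointwise Fin._<_ A B

below? : ∀ {n d} (B : Vec (Fin n) d) → Decidable (_Below B)
below? B A = allPairs? (λ a b → ¬? (a Fin.≟ b)) A
       ×-dec all? (λ a → ¬? (_∈?_ Fin._≟_ a B)) A
       ×-dec pointwise? Fin._<?_ A B

IsTopSet : ∀ {n d} → Vec (Fin n) d → Set
IsTopSet B = AllPairs Fin._<_ B × ∃[ A ] A Below B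

χ₂ : ∀ {n d} → Vec (Fin n) d → Vec (Fin n) d → ℝ^ n → ℝ
χ₂ A B x = ∏ λ i → x (lookup A i) - x (lookup B i)

χ : ∀ {n d} → Vec (Fin n) d → ℝ^ n → ℝ
χ {n} {d} B x = ∑[ List.filter (below? B) (vectorsOver (List.allFin n) d) ] λ A → χ₂ A B x

-- ∏ᵢ (x_{2i-1} - x_{2i}); toℕ (combine i j) = 2 · toℕ i + toℕ j for j : Fin 2.
χ-canonical : ∀ {n} d → d ℕ.* 2 ℕ.≤ n → ℝ^ n → ℝ
χ-canonical d 2d≤n x = ∏ λ (i : Fin d) →
  x (inject≤ (combine {d} {2} i 0F) 2d≤n) - x (inject≤ (combine {d} {2} i 1F) 2d≤n)

-- With 0-based i : Fin d, the quantity b_{i+1} - 2i, which is m below, is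
-- computed in ℤ.
c : ∀ {n d} → Vec (Fin n) d → ℚ
c B = Vector.foldr ℚ._*_ 1ℚ λ i →
  let m = + suc (toℕ (lookup B i)) ℤ.- + (2 ℕ.* toℕ i)
  in (m ℤ.* (m ℤ.- + 1)) ℚ./ 2

{-# OPTIONS --safe #-}
-- Read the variables in increasing order and keep the list U of variables
-- outside B that have not been paired yet; χ_B is then a polynomial Φ defined
-- by recursion on this reading, and Φ is affine in every variable of U.  When
-- y ∈ B is read and the unpaired variables are u and a list U of length p, let
-- g be the polynomial obtained, f the one in which u is the element of B and y
-- is read after it as an unpaired variable, s the image of f under the
-- transposition of u and y, and D the polynomial in which the pair (u , y) is
-- split off.  Linear interpolation gives g = s + D and f = s - p D, hence
--   p g² = (p + 1) s² + p (p + 1) D² - f².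
-- By exchangeability f and s have the same norm, so ‖g‖² = ‖f‖² + (p + 1) ‖D‖²,
-- which is the recursion satisfied by (p + 1)(p + 2) / 2.  Induction on ∣ B ∣
-- and p ends at products of disjoint differences, which are images of χ_d under
-- permutations.
module Submission where

open import Algebra.Bundles using (CommutativeRing)
import Algebra.Solver.Ring as RingSolver
import Algebra.Solver.Ring.AlmostCommutativeRing as ACR
open import Data.Bool.Base using (Bool; true; false; T; _∧_; not; if_then_else_)
import Data.Bool.Properties as Bool
open import Data.Empty using (⊥-elim)
open import Data.Fin.Base as Fin using (Fin; zero; suc; toℕ)
open import Data.Fin.Patterns using (0F; 1F)
open import Data.Fin.Permutation as Perm using (Permutation′; _⟨$⟩ʳ_)
import Data.Fin.Permutation.Components as Components
import Data.Fin.Properties as Fin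
open import Data.Fin.Subset using (Subset; inside; outside; ⁅_⁆; _∪_) renaming (⊥ to ⊥ˢ)
open import Data.Fin.Subset.Properties using () renaming (_∈?_ to _∈ˢ?_)
open import Data.Integer.Base as ℤ using (+_)
import Data.Integer.Properties as ℤ
import Data.Integer.Solver as ℤSolver
open import Data.List.Base as List using (List; []; _∷_; _++_; map; length; allFin)
import Data.List.Properties as List
open import Data.List.Relation.Binary.Permutation.Propositional as ↭ using (_↭_; ↭-refl; ↭-sym; ↭-trans; ↭-prep; ↭-swap; ↭⇒↭ₛ)
import Data.List.Relation.Binary.Permutation.Propositional.Properties as ↭
open import Data.List.Relation.Binary.Permutation.Setoid.Properties using (Unique-resp-↭)
open import Data.List.Relation.Unary.All as All using (All; []; _∷_)
import Data.List.Relation.Unary.All.Properties as All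
open import Data.List.Relation.Unary.AllPairs using ([]; _∷_)
open import Data.List.Relation.Unary.Unique.Propositional using (Unique)
open import Data.List.Relation.Unary.Unique.Propositional.Properties using (allFin⁺)
open import Data.Maybe.Base using (Maybe; just; nothing)
open import Data.Nat.Base as ℕ using (ℕ; zero; suc; z≤n; s≤s)
import Data.Nat.Coprimality as Coprimality
import Data.Nat.Properties as ℕ
open import Data.Product.Base using (_×_; _,_; ∃-syntax; proj₁; proj₂)
open import Data.Rational.Base as ℚ using (ℚ; mkℚ; 0ℚ; 1ℚ; ½)
import Data.Rational.Properties as ℚ
open import Data.Rational.Solver using (module +-*-Solver)
import Data.Rational.Unnormalised.Base as ℚᵘ
import Data.Rational.Unnormalised.Properties as ℚᵘ
open import Data.Sum.Base using (_⊎_; inj₁; inj₂; [_,_]′)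
open import Data.Unit.Base using (⊤; tt)
open import Data.Vec.Base using (Vec; []; _∷_; lookup)
import Data.Vec.Functional as Vector
open import Data.Vec.Membership.DecPropositional using (_∈?_)
open import Data.Vec.Membership.Propositional using (_∈_)
open import Data.Vec.Relation.Binary.Pointwise.Inductive using (Pointwise; []; _∷_)
open import Data.Vec.Relation.Unary.All as VAll using ([]; _∷_)
open import Data.Vec.Relation.Unary.AllPairs using (AllPairs; []; _∷_)
open import Data.Vec.Relation.Unary.Any using (here; there)
open import Data.Vec.Relation.Unary.Unique.Propositional using () renaming (Unique to VUnique)
open import Function.Base using (_∘_; id)
open import Function.Bundles using (mk⇔)
open import Level using (0ℓ)
open import Relation.Binary.Bundles using (Preorder)
open import Relation.Binary.PropositionalEquality using (_≡_; _≢_; refl; sym; trans; cong; cong₂; subst)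
open import Relation.Binary.PropositionalEquality.Properties using (setoid)
open import Relation.Nullary using (¬_; Dec; yes; no; does; contradiction)
open import Relation.Nullary.Decidable using (T?; dec-true; dec-false; does-⇔)
open import Defs

-- The equality of the norms of `f` and `s` is not obtained by transposing two variables at that
-- stage. The norm formula is stated for every distribution of the `n` variables over the pairs
-- already split off, the unpaired list and the remaining word, while `weight` sees only the marks
-- and the number of unpaired variables. So `f` and `s` are two instances of the same induction
-- hypothesis with the same value, and exchangeability enters only for products of `d` disjoint
-- differences. The identity is read in the direction that produces integrals: `g²` is a rational
-- linear combination of squares whose integrals are known, so the integrability of the square of
-- χ_B comes together with its value. This requires dividing the identity by `p`, hence a separate
-- case `p = 0`, where `s` is an empty sum and `g = D`. An integral is a relation between a function
-- and a real. A claim about arbitrary values of the two norms therefore rests on linearity,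
-- invariance and uniqueness of the integral, and these have to be established constructively,
-- without deciding equality of reals or inhabitedness of sets.

private
  variable
    p q r : ℚ
    x y z x′ y′ l m : ℝ
    a b : ℕ → ℝ

-- Rationals

p≤p+ε : 0ℚ ℚ.< r → p ℚ.≤ p ℚ.+ r
p≤p+ε {r} {p} 0<r = ℚ.≤-trans (ℚ.≤-reflexive (sym (ℚ.+-identityʳ p))) (ℚ.+-monoʳ-≤ p (ℚ.<⇒≤ 0<r))

p≤∣p∣ : ∀ p → p ℚ.≤ ℚ.∣ p ∣
p≤∣p∣ p with ℚ.≤-total 0ℚ p
... | inj₁ 0≤p = ℚ.≤-reflexive (sym (ℚ.0≤p⇒∣p∣≡p 0≤p))
... | inj₂ p≤0 = ℚ.≤-trans p≤0 (ℚ.0≤∣p∣ p)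

-p≤∣p∣ : ∀ p → ℚ.- p ℚ.≤ ℚ.∣ p ∣
-p≤∣p∣ p = subst (ℚ.- p ℚ.≤_) (ℚ.∣-p∣≡∣p∣ p) (p≤∣p∣ (ℚ.- p))

∣p∣≤ : p ℚ.≤ r → ℚ.- p ℚ.≤ r → ℚ.∣ p ∣ ℚ.≤ r
∣p∣≤ {p} {r} p≤r -p≤r = [ (λ e → subst (ℚ._≤ r) (sym e) p≤r) , (λ e → subst (ℚ._≤ r) (sym e) -p≤r) ]′ (ℚ.∣p∣≡p∨∣p∣≡-p p)

halve : 0ℚ ℚ.< p → 0ℚ ℚ.< ½ ℚ.* p
halve {p} 0<p = subst (ℚ._< ½ ℚ.* p) (ℚ.*-zeroʳ ½) (ℚ.*-monoʳ-<-pos ½ 0<p)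

halves : ∀ p → ½ ℚ.* p ℚ.+ ½ ℚ.* p ≡ p
halves p = trans (sym (ℚ.*-distribʳ-+ p ½ ½)) (ℚ.*-identityˡ p)

p-q≤r⇒p≤q+r : p ℚ.- q ℚ.≤ r → p ℚ.≤ q ℚ.+ r
p-q≤r⇒p≤q+r {p} {q} {r} h = subst (ℚ._≤ q ℚ.+ r)
  (solve 2 (λ p q → q :+ (p :- q) := p) refl p q) (ℚ.+-monoʳ-≤ q h)
  where open +-*-Solver

p≤q+r⇒p-q≤r : p ℚ.≤ q ℚ.+ r → p ℚ.- q ℚ.≤ r
p≤q+r⇒p-q≤r {p} {q} {r} h = subst (p ℚ.- q ℚ.≤_)
  (solve 2 (λ q r → (q :+ r) :- q := r) refl q r) (ℚ.+-monoˡ-≤ (ℚ.- q) h)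
  where open +-*-Solver

-[p-q]≡q-p : ∀ p q → ℚ.- (p ℚ.- q) ≡ q ℚ.- p
-[p-q]≡q-p = solve 2 (λ p q → :- (p :- q) := q :- p) refl
  where open +-*-Solver

∣p-q∣≡∣q-p∣ : ∀ p q → ℚ.∣ p ℚ.- q ∣ ≡ ℚ.∣ q ℚ.- p ∣
∣p-q∣≡∣q-p∣ p q = trans (sym (ℚ.∣-p∣≡∣p∣ (p ℚ.- q))) (cong ℚ.∣_∣ (-[p-q]≡q-p p q))

abstract
  divide : ∀ K → 0ℚ ℚ.< K → 0ℚ ℚ.< p → ∃[ δ ] 0ℚ ℚ.< δ × K ℚ.* δ ≡ p
  divide {p} K 0<K 0<p = 1/K ℚ.* p
    , subst (ℚ._< 1/K ℚ.* p) (ℚ.*-zeroʳ 1/K) (ℚ.*-monoʳ-<-pos 1/K {{ℚ.1/pos⇒pos K {{ℚ.positive 0<K}}}} 0<p)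
    , trans (sym (ℚ.*-assoc K 1/K p)) (trans (cong (ℚ._* p) (ℚ.*-inverseʳ K {{K≢0}})) (ℚ.*-identityˡ p))
    where
    K≢0 : ℚ.NonZero K
    K≢0 = ℚ.pos⇒nonZero K {{ℚ.positive 0<K}}
    1/K : ℚ
    1/K = ℚ.1/_ K {{K≢0}}

-- Properties that hold from some index on

Eventually : (ℕ → Set) → Set
Eventually P = ∃[ N ] ∀ n → N ℕ.≤ n → P n

eventually : ∀ {P : ℕ → Set} → (∀ n → P n) → Eventually P
eventually h = 0 , λ n _ → h n

mapᵉ : ∀ {P Q : ℕ → Set} → (∀ n → P n → Q n) → Eventually P → Eventually Q
mapᵉ f (N , h) = N , λ n N≤n → f n (h n N≤n)

zipᵉ : ∀ {P Q R : ℕ → Set} → (∀ n → P n → Q n → R n) → Eventually P → Eventually Q → Eventually R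
zipᵉ f (M , g) (N , h) = M ℕ.⊔ N , λ n le → f n (g n (ℕ.m⊔n≤o⇒m≤o M N le)) (h n (ℕ.m⊔n≤o⇒n≤o M N le))

-- The ordered ring of reals

≤-pointwise : (∀ n → seq x n ℚ.≤ seq y n) → x ≤ y
≤-pointwise h = mk≤ λ ε 0<ε → eventually λ n → ℚ.≤-trans (h n) (p≤p+ε 0<ε)

≈⇒≤ : x ≈ y → x ≤ y
≈⇒≤ {x} {y} (mk≈ h) = mk≤ λ ε 0<ε →
  mapᵉ (λ n le → p-q≤r⇒p≤q+r (ℚ.≤-trans (p≤∣p∣ _) le)) (h ε 0<ε)

≈⇒≥ : x ≈ y → y ≤ x
≈⇒≥ {x} {y} (mk≈ h) = mk≤ λ ε 0<ε →
  mapᵉ (λ n le → p-q≤r⇒p≤q+r (ℚ.≤-trans (subst (seq y n ℚ.- seq x n ℚ.≤_) (∣p-q∣≡∣q-p∣ (seq y n) (seq x n)) (p≤∣p∣ _)) le)) (h ε 0<ε)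

≤-antisym : x ≤ y → y ≤ x → x ≈ y
≤-antisym {x} {y} (mk≤ g) (mk≤ h) = mk≈ λ ε 0<ε → zipᵉ
  (λ n le ge → ∣p∣≤ (p≤q+r⇒p-q≤r le) (subst (ℚ._≤ ε) (sym (-[p-q]≡q-p (seq x n) (seq y n))) (p≤q+r⇒p-q≤r ge)))
  (g ε 0<ε) (h ε 0<ε)

≤-refl : x ≤ x
≤-refl = ≤-pointwise λ _ → ℚ.≤-refl

≤-trans : x ≤ y → y ≤ z → x ≤ z
≤-trans {x} {y} {z} (mk≤ g) (mk≤ h) = mk≤ λ ε 0<ε → zipᵉ
  (λ n le le′ → ℚ.≤-trans le (ℚ.≤-trans (ℚ.+-monoˡ-≤ (½ ℚ.* ε) le′)
    (ℚ.≤-reflexive (trans (ℚ.+-assoc (seq z n) _ _) (cong (seq z n ℚ.+_) (halves ε))))))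
  (g (½ ℚ.* ε) (halve 0<ε)) (h (½ ℚ.* ε) (halve 0<ε))

≈-refl : x ≈ x
≈-refl = ≤-antisym ≤-refl ≤-refl

≈-sym : x ≈ y → y ≈ x
≈-sym e = ≤-antisym (≈⇒≥ e) (≈⇒≤ e)

≈-trans : x ≈ y → y ≈ z → x ≈ z
≈-trans d e = ≤-antisym (≤-trans (≈⇒≤ d) (≈⇒≤ e)) (≤-trans (≈⇒≥ e) (≈⇒≥ d))

≈-pointwise : (∀ n → seq x n ≡ seq y n) → x ≈ y
≈-pointwise h = ≤-antisym (≤-pointwise (ℚ.≤-reflexive ∘ h)) (≤-pointwise (ℚ.≤-reflexive ∘ sym ∘ h))

≈-reflexive : x ≡ y → x ≈ y
≈-reflexive refl = ≈-refl

+-mono-≤ : x ≤ x′ → y ≤ y′ → x + y ≤ x′ + y′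
+-mono-≤ {x} {x′} {y} {y′} (mk≤ g) (mk≤ h) = mk≤ λ ε 0<ε → zipᵉ
  (λ n le le′ → ℚ.≤-trans (ℚ.+-mono-≤ le le′)
    (ℚ.≤-reflexive (trans (solve 3 (λ a b e → (a :+ e) :+ (b :+ e) := a :+ b :+ (e :+ e)) refl (seq x′ n) (seq y′ n) (½ ℚ.* ε))
      (cong (seq x′ n ℚ.+ seq y′ n ℚ.+_) (halves ε)))))
  (g (½ ℚ.* ε) (halve 0<ε)) (h (½ ℚ.* ε) (halve 0<ε))
  where open +-*-Solver

neg-mono-≤ : x ≤ y → - y ≤ - x
neg-mono-≤ {x} {y} (mk≤ h) = mk≤ λ ε 0<ε → mapᵉ
  (λ n le → subst (ℚ._≤ ℚ.- seq x n ℚ.+ ε)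
    (solve 3 (λ x y e → (:- x) :+ (x :- y) := :- y) refl (seq x n) (seq y n) ε)
    (ℚ.+-monoʳ-≤ (ℚ.- seq x n) (p≤q+r⇒p-q≤r le)))
  (h ε 0<ε)
  where open +-*-Solver

+-cong : x ≈ x′ → y ≈ y′ → x + y ≈ x′ + y′
+-cong d e = ≤-antisym (+-mono-≤ (≈⇒≤ d) (≈⇒≤ e)) (+-mono-≤ (≈⇒≥ d) (≈⇒≥ e))

neg-cong : x ≈ y → - x ≈ - y
neg-cong e = ≤-antisym (neg-mono-≤ (≈⇒≥ e)) (neg-mono-≤ (≈⇒≤ e))

∣p∣≤∣p-q∣+∣q∣ : ∀ p q → ℚ.∣ p ∣ ℚ.≤ ℚ.∣ p ℚ.- q ∣ ℚ.+ ℚ.∣ q ∣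
∣p∣≤∣p-q∣+∣q∣ p q = subst (λ r → ℚ.∣ r ∣ ℚ.≤ ℚ.∣ p ℚ.- q ∣ ℚ.+ ℚ.∣ q ∣)
  (solve 2 (λ a b → (a :- b) :+ b := a) refl p q) (ℚ.∣p+q∣≤∣p∣+∣q∣ (p ℚ.- q) q)
  where open +-*-Solver

bounded : ∀ x → ∃[ K ] 0ℚ ℚ.< K × Eventually (λ n → ℚ.∣ seq x n ∣ ℚ.≤ K)
bounded x with cauchy x 1ℚ (ℚ.positive⁻¹ 1ℚ)
... | N , h = 1ℚ ℚ.+ ℚ.∣ seq x N ∣
  , ℚ.positive⁻¹ _ {{ℚ.pos+nonNeg⇒pos 1ℚ ℚ.∣ seq x N ∣ {{ℚ.∣-∣-nonNeg (seq x N)}}}}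
  , N , λ n N≤n → ℚ.≤-trans (∣p∣≤∣p-q∣+∣q∣ (seq x n) (seq x N))
                             (ℚ.+-monoˡ-≤ ℚ.∣ seq x N ∣ (h n N N≤n ℕ.≤-refl))

∣zp-zq∣≤ : ∀ z p q {K δ} → ℚ.∣ z ∣ ℚ.≤ K → ℚ.∣ p ℚ.- q ∣ ℚ.≤ δ → 0ℚ ℚ.< δ →
           ℚ.∣ z ℚ.* p ℚ.- z ℚ.* q ∣ ℚ.≤ K ℚ.* δ
∣zp-zq∣≤ z p q {K} {δ} z≤K p-q≤δ 0<δ = begin
  ℚ.∣ z ℚ.* p ℚ.- z ℚ.* q ∣    ≡⟨ cong ℚ.∣_∣ (solve 3 (λ z p q → z :* p :- z :* q := z :* (p :- q)) refl z p q) ⟩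
  ℚ.∣ z ℚ.* (p ℚ.- q) ∣        ≡⟨ ℚ.∣p*q∣≡∣p∣*∣q∣ z (p ℚ.- q) ⟩
  ℚ.∣ z ∣ ℚ.* ℚ.∣ p ℚ.- q ∣    ≤⟨ ℚ.*-monoˡ-≤-nonNeg ℚ.∣ z ∣ {{ℚ.∣-∣-nonNeg z}} p-q≤δ ⟩
  ℚ.∣ z ∣ ℚ.* δ                ≤⟨ ℚ.*-monoʳ-≤-nonNeg δ {{ℚ.nonNegative (ℚ.<⇒≤ 0<δ)}} z≤K ⟩
  K ℚ.* δ                      ∎
  where
  open +-*-Solver
  open ℚ.≤-Reasoning

-- Multiplication by `z` scales the error between `x` and `y`, so the tolerance is first divided by
-- a bound on the tail of `z`.
*-congˡ : ∀ z → x ≈ y → z * x ≈ z * y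
*-congˡ {x} {y} z (mk≈ h) = let K , 0<K , z≤K = bounded z in mk≈ λ ε 0<ε →
  let δ , 0<δ , Kδ≡ε = divide K 0<K 0<ε in
  subst (λ η → Eventually (λ n → ℚ.∣ seq z n ℚ.* seq x n ℚ.- seq z n ℚ.* seq y n ∣ ℚ.≤ η)) Kδ≡ε
    (zipᵉ (λ n z≤K le → ∣zp-zq∣≤ (seq z n) (seq x n) (seq y n) z≤K le 0<δ) z≤K (h δ 0<δ))

*-comm : ∀ x y → x * y ≈ y * x
*-comm x y = ≈-pointwise λ n → ℚ.*-comm (seq x n) (seq y n)

*-cong : x ≈ x′ → y ≈ y′ → x * y ≈ x′ * y′
*-cong {x} {x′} {y} {y′} d e = ≈-trans (*-congˡ x e) (≈-trans (*-comm x y′) (≈-trans (*-congˡ y′ d) (*-comm y′ x′)))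

ℝ-commutativeRing : CommutativeRing 0ℓ 0ℓ
ℝ-commutativeRing = record
  { Carrier = ℝ ; _≈_ = _≈_ ; _+_ = _+_ ; _*_ = _*_ ; -_ = -_ ; 0# = 0ℝ ; 1# = 1ℝ
  ; isCommutativeRing = record
    { isRing = record
      { +-isAbelianGroup = record
        { isGroup = record
          { isMonoid = record
            { isSemigroup = record
              { isMagma = record
                { isEquivalence = record { refl = ≈-refl ; sym = ≈-sym ; trans = ≈-trans }
                ; ∙-cong = +-cong }
              ; assoc = λ x y z → ≈-pointwise λ n → ℚ.+-assoc (seq x n) (seq y n) (seq z n) }
            ; identity = (λ x → ≈-pointwise λ n → ℚ.+-identityˡ (seq x n))
                       , (λ x → ≈-pointwise λ n → ℚ.+-identityʳ (seq x n)) }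
          ; inverse = (λ x → ≈-pointwise λ n → ℚ.+-inverseˡ (seq x n))
                    , (λ x → ≈-pointwise λ n → ℚ.+-inverseʳ (seq x n))
          ; ⁻¹-cong = neg-cong }
        ; comm = λ x y → ≈-pointwise λ n → ℚ.+-comm (seq x n) (seq y n) }
      ; *-cong = *-cong
      ; *-assoc = λ x y z → ≈-pointwise λ n → ℚ.*-assoc (seq x n) (seq y n) (seq z n)
      ; *-identity = (λ x → ≈-pointwise λ n → ℚ.*-identityˡ (seq x n))
                   , (λ x → ≈-pointwise λ n → ℚ.*-identityʳ (seq x n))
      ; distrib = (λ x y z → ≈-pointwise λ n → ℚ.*-distribˡ-+ (seq x n) (seq y n) (seq z n))
                , (λ x y z → ≈-pointwise λ n → ℚ.*-distribʳ-+ (seq x n) (seq y n) (seq z n)) }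
    ; *-comm = *-comm } }

private
  ℝ-ring : ACR.AlmostCommutativeRing 0ℓ 0ℓ
  ℝ-ring = ACR.fromCommutativeRing ℝ-commutativeRing

  -- Equality in ℝ is not decidable, so the ring solver normalises with rational coefficients, whose
  -- equality `coeff?` can test.
  fromℚ-homo : CommutativeRing.rawRing ℚ.+-*-commutativeRing ACR.-Raw-AlmostCommutative⟶ ℝ-ring
  fromℚ-homo = record
    { ⟦_⟧ = fromℚ
    ; +-homo = λ _ _ → ≈-pointwise λ _ → refl
    ; *-homo = λ _ _ → ≈-pointwise λ _ → refl
    ; -‿homo = λ _ → ≈-pointwise λ _ → refl
    ; 0-homo = ≈-refl
    ; 1-homo = ≈-refl }

  coeff? : ∀ p q → Maybe (fromℚ p ≈ fromℚ q)
  coeff? p q with p ℚ.≟ q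
  ... | yes refl = just ≈-refl
  ... | no _ = nothing

module ℝ-Solver where
  open RingSolver (CommutativeRing.rawRing ℚ.+-*-commutativeRing) ℝ-ring fromℚ-homo coeff? public
    using (solve; con; _:=_; _:+_; _:*_; _:-_; :-_)

≤-preorder : Preorder 0ℓ 0ℓ 0ℓ
≤-preorder = record
  { Carrier = ℝ ; _≈_ = _≈_ ; _≲_ = _≤_
  ; isPreorder = record { isEquivalence = CommutativeRing.isEquivalence ℝ-commutativeRing ; reflexive = ≈⇒≤ ; trans = ≤-trans } }

module ≤-Reasoning where
  open import Relation.Binary.Reasoning.Preorder ≤-preorder public

module ≈-Reasoning where
  open import Relation.Binary.Reasoning.Setoid (CommutativeRing.setoid ℝ-commutativeRing) public

*-congʳ : ∀ z → x ≈ y → x * z ≈ y * z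
*-congʳ z e = *-cong e ≈-refl

+-congˡ : ∀ z → x ≈ y → z + x ≈ z + y
+-congˡ z e = +-cong ≈-refl e

+-identityˡ : ∀ x → 0ℝ + x ≈ x
+-identityˡ x = ≈-pointwise λ n → ℚ.+-identityˡ (seq x n)

+-identityʳ : ∀ x → x + 0ℝ ≈ x
+-identityʳ x = ≈-pointwise λ n → ℚ.+-identityʳ (seq x n)

*-zeroʳ : ∀ x → x * 0ℝ ≈ 0ℝ
*-zeroʳ x = ≈-pointwise λ n → ℚ.*-zeroʳ (seq x n)

*-zeroˡ : ∀ x → 0ℝ * x ≈ 0ℝ
*-zeroˡ x = ≈-pointwise λ n → ℚ.*-zeroˡ (seq x n)

*-identityˡ : ∀ x → 1ℝ * x ≈ x
*-identityˡ x = ≈-pointwise λ n → ℚ.*-identityˡ (seq x n)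

fromℚ-mono-≤ : p ℚ.≤ q → fromℚ p ≤ fromℚ q
fromℚ-mono-≤ p≤q = ≤-pointwise λ _ → p≤q

-- If `p` exceeded `q`, half of the gap as tolerance would give `p ≤ q + (p - q) / 2 < p`.
fromℚ-cancel-≤ : fromℚ p ≤ fromℚ q → p ℚ.≤ q
fromℚ-cancel-≤ {p} {q} (mk≤ h) with p ℚ.≤? q
... | yes p≤q = p≤q
... | no p≰q = ⊥-elim (ℚ.<-irrefl refl (ℚ.<-≤-trans bound (proj₂ (h (½ ℚ.* (p ℚ.- q)) (halve 0<p-q)) _ ℕ.≤-refl)))
  where
  open +-*-Solver
  0<p-q : 0ℚ ℚ.< p ℚ.- q
  0<p-q = subst (ℚ._< p ℚ.- q) (ℚ.+-inverseʳ q) (ℚ.+-monoˡ-< (ℚ.- q) (ℚ.≰⇒> p≰q))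
  bound : q ℚ.+ ½ ℚ.* (p ℚ.- q) ℚ.< p
  bound = subst (q ℚ.+ ½ ℚ.* (p ℚ.- q) ℚ.<_)
    (trans (ℚ.+-assoc q (½ ℚ.* (p ℚ.- q)) (½ ℚ.* (p ℚ.- q)))
      (trans (cong (q ℚ.+_) (halves (p ℚ.- q))) (solve 2 (λ p q → q :+ (p :- q) := p) refl p q)))
    (subst (ℚ._< q ℚ.+ ½ ℚ.* (p ℚ.- q) ℚ.+ ½ ℚ.* (p ℚ.- q)) (ℚ.+-identityʳ (q ℚ.+ ½ ℚ.* (p ℚ.- q)))
      (ℚ.+-monoʳ-< (q ℚ.+ ½ ℚ.* (p ℚ.- q)) (halve 0<p-q)))

fromℚ-halves : ∀ p → fromℚ (½ ℚ.* p) + fromℚ (½ ℚ.* p) ≈ fromℚ p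
fromℚ-halves p = ≈-pointwise λ _ → halves p

≤-from-ε : (∀ ε → 0ℚ ℚ.< ε → x ≤ y + fromℚ ε) → x ≤ y
≤-from-ε {x} {y} h = mk≤ λ ε 0<ε → mapᵉ
  (λ n le → ℚ.≤-trans le (ℚ.≤-reflexive (trans (ℚ.+-assoc (seq y n) (½ ℚ.* ε) (½ ℚ.* ε)) (cong (seq y n ℚ.+_) (halves ε)))))
  (_≤_.below (h (½ ℚ.* ε) (halve 0<ε)) (½ ℚ.* ε) (halve 0<ε))

-- Both sides are Cauchy, so for each ε a single comparison of terms decides
-- between x ≤ y + ε and ¬ x ≤ y.
≤-stable : ¬ ¬ (x ≤ y) → x ≤ y
≤-stable {x} {y} ¬¬x≤y = mk≤ λ ε 0<ε → [ id , (λ ¬x≤y → contradiction ¬x≤y ¬¬x≤y) ]′ (decide ε 0<ε)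
  where
  decide : ∀ ε → 0ℚ ℚ.< ε → Eventually (λ n → seq x n ℚ.≤ seq y n ℚ.+ ε) ⊎ ¬ (x ≤ y)
  decide ε 0<ε = compare (seq x N ℚ.≤? seq y N ℚ.+ ½ ℚ.* ε)
    where
    -- These are ε/4 and ε/8, and the test is against ε/2. If it succeeds, moving from index `N` to
    -- `n` costs at most `ζ` on each side, in all ε/2 + 2ζ = ε. If it fails, a bound with slack `ζ`
    -- at a later index would come back to `N` with slack ζ + 2η = ε/2.
    ζ η : ℚ
    ζ = ½ ℚ.* (½ ℚ.* ε)
    η = ½ ℚ.* ζ
    0<η : 0ℚ ℚ.< η
    0<η = halve (halve (halve 0<ε))
    η≤ζ : η ℚ.≤ ζ
    η≤ζ = ℚ.≤-trans (p≤p+ε 0<η) (ℚ.≤-reflexive (halves ζ))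
    Mx My : ℕ
    Mx = proj₁ (cauchy x η 0<η)
    My = proj₁ (cauchy y η 0<η)
    N : ℕ
    N = Mx ℕ.⊔ My
    x≤x+η : ∀ m n → N ℕ.≤ m → N ℕ.≤ n → seq x m ℚ.≤ seq x n ℚ.+ η
    x≤x+η m n a b = p-q≤r⇒p≤q+r (ℚ.≤-trans (p≤∣p∣ (seq x m ℚ.- seq x n))
      (proj₂ (cauchy x η 0<η) m n (ℕ.m⊔n≤o⇒m≤o Mx My a) (ℕ.m⊔n≤o⇒m≤o Mx My b)))
    y≤y+η : ∀ m n → N ℕ.≤ m → N ℕ.≤ n → seq y m ℚ.≤ seq y n ℚ.+ η
    y≤y+η m n a b = p-q≤r⇒p≤q+r (ℚ.≤-trans (p≤∣p∣ (seq y m ℚ.- seq y n))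
      (proj₂ (cauchy y η 0<η) m n (ℕ.m⊔n≤o⇒n≤o Mx My a) (ℕ.m⊔n≤o⇒n≤o Mx My b)))
    open +-*-Solver
    open ℚ.≤-Reasoning
    compare : Dec (seq x N ℚ.≤ seq y N ℚ.+ ½ ℚ.* ε) →
              Eventually (λ n → seq x n ℚ.≤ seq y n ℚ.+ ε) ⊎ ¬ (x ≤ y)
    compare (yes le) = inj₁ (N , λ n N≤n → begin
      seq x n                                ≤⟨ x≤x+η n N N≤n ℕ.≤-refl ⟩
      seq x N ℚ.+ η                          ≤⟨ ℚ.+-mono-≤ le η≤ζ ⟩
      seq y N ℚ.+ ½ ℚ.* ε ℚ.+ ζ              ≤⟨ ℚ.+-monoˡ-≤ ζ (ℚ.+-monoˡ-≤ (½ ℚ.* ε) (ℚ.≤-trans (y≤y+η N n ℕ.≤-refl N≤n) (ℚ.+-monoʳ-≤ (seq y n) η≤ζ))) ⟩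
      seq y n ℚ.+ ζ ℚ.+ ½ ℚ.* ε ℚ.+ ζ        ≡⟨ solve 3 (λ y e f → y :+ e :+ f :+ e := y :+ ((e :+ e) :+ f)) refl (seq y n) ζ (½ ℚ.* ε) ⟩
      seq y n ℚ.+ (ζ ℚ.+ ζ ℚ.+ ½ ℚ.* ε)      ≡⟨ cong (λ z → seq y n ℚ.+ (z ℚ.+ ½ ℚ.* ε)) (halves (½ ℚ.* ε)) ⟩
      seq y n ℚ.+ (½ ℚ.* ε ℚ.+ ½ ℚ.* ε)      ≡⟨ cong (seq y n ℚ.+_) (halves ε) ⟩
      seq y n ℚ.+ ε                          ∎)
    compare (no ≰) = inj₂ λ (mk≤ h) → let M , h′ = h ζ (halve (halve 0<ε)) ; n = M ℕ.⊔ N in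
      ≰ (begin
        seq x N                        ≤⟨ x≤x+η N n ℕ.≤-refl (ℕ.m≤n⊔m M N) ⟩
        seq x n ℚ.+ η                  ≤⟨ ℚ.+-monoˡ-≤ η (h′ n (ℕ.m≤m⊔n M N)) ⟩
        seq y n ℚ.+ ζ ℚ.+ η            ≤⟨ ℚ.+-monoˡ-≤ η (ℚ.+-monoˡ-≤ ζ (y≤y+η n N (ℕ.m≤n⊔m M N) ℕ.≤-refl)) ⟩
        seq y N ℚ.+ η ℚ.+ ζ ℚ.+ η      ≡⟨ solve 3 (λ y e f → y :+ e :+ f :+ e := y :+ ((e :+ e) :+ f)) refl (seq y N) η ζ ⟩
        seq y N ℚ.+ (η ℚ.+ η ℚ.+ ζ)    ≡⟨ cong (λ z → seq y N ℚ.+ (z ℚ.+ ζ)) (halves ζ) ⟩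
        seq y N ℚ.+ (ζ ℚ.+ ζ)          ≡⟨ cong (seq y N ℚ.+_) (halves (½ ℚ.* ε)) ⟩
        seq y N ℚ.+ ½ ℚ.* ε            ∎)

∣x∣≤ : x ≤ y → - x ≤ y → ∣ x ∣ ≤ y
∣x∣≤ (mk≤ g) (mk≤ h) = mk≤ λ ε 0<ε → zipᵉ (λ _ → ∣p∣≤) (g ε 0<ε) (h ε 0<ε)

x≤∣x∣ : x ≤ ∣ x ∣
x≤∣x∣ {x} = ≤-pointwise λ n → p≤∣p∣ (seq x n)

-x≤∣x∣ : - x ≤ ∣ x ∣
-x≤∣x∣ {x} = ≤-pointwise λ n → -p≤∣p∣ (seq x n)

0≤∣x∣ : 0ℝ ≤ ∣ x ∣
0≤∣x∣ {x} = ≤-pointwise λ n → ℚ.0≤∣p∣ (seq x n)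

∣x∣-cong : x ≈ y → ∣ x ∣ ≈ ∣ y ∣
∣x∣-cong e = ≤-antisym
  (∣x∣≤ (≤-trans (≈⇒≤ e) x≤∣x∣) (≤-trans (≈⇒≤ (neg-cong e)) -x≤∣x∣))
  (∣x∣≤ (≤-trans (≈⇒≥ e) x≤∣x∣) (≤-trans (≈⇒≥ (neg-cong e)) -x≤∣x∣))

∣x+y∣≤∣x∣+∣y∣ : ∀ x y → ∣ x + y ∣ ≤ ∣ x ∣ + ∣ y ∣
∣x+y∣≤∣x∣+∣y∣ x y = ≤-pointwise λ n → ℚ.∣p+q∣≤∣p∣+∣q∣ (seq x n) (seq y n)

∣xy∣≈∣x∣∣y∣ : ∀ x y → ∣ x * y ∣ ≈ ∣ x ∣ * ∣ y ∣
∣xy∣≈∣x∣∣y∣ x y = ≈-pointwise λ n → ℚ.∣p*q∣≡∣p∣*∣q∣ (seq x n) (seq y n)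

∣-x∣≈∣x∣ : ∀ x → ∣ - x ∣ ≈ ∣ x ∣
∣-x∣≈∣x∣ x = ≈-pointwise λ n → ℚ.∣-p∣≡∣p∣ (seq x n)

∣x-y∣≈∣y-x∣ : ∀ x y → ∣ x - y ∣ ≈ ∣ y - x ∣
∣x-y∣≈∣y-x∣ x y = ≈-pointwise λ n → ∣p-q∣≡∣q-p∣ (seq x n) (seq y n)

0≤x⇒∣x∣≈x : 0ℝ ≤ x → ∣ x ∣ ≈ x
0≤x⇒∣x∣≈x {x} 0≤x = ≤-antisym (∣x∣≤ ≤-refl (≤-trans (≤-trans (neg-mono-≤ 0≤x) (≤-pointwise λ _ → ℚ.≤-refl)) 0≤x)) x≤∣x∣

-- The terms of a nonnegative real may be negative, so this is not termwise; `x * y` is instead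
-- identified with `∣ x * y ∣`, whose terms are nonnegative.
*-nonNeg : 0ℝ ≤ x → 0ℝ ≤ y → 0ℝ ≤ x * y
*-nonNeg {x} {y} 0≤x 0≤y = ≤-trans 0≤∣x∣ (≈⇒≤ (≈-trans (∣xy∣≈∣x∣∣y∣ x y) (*-cong (0≤x⇒∣x∣≈x 0≤x) (0≤x⇒∣x∣≈x 0≤y))))

x≤y⇒0≤y-x : x ≤ y → 0ℝ ≤ y - x
x≤y⇒0≤y-x {x} {y} x≤y = ≤-trans (≈⇒≥ (≈-pointwise λ n → ℚ.+-inverseʳ (seq x n))) (+-mono-≤ x≤y ≤-refl)

0≤y-x⇒x≤y : 0ℝ ≤ y - x → x ≤ y
0≤y-x⇒x≤y {y} {x} h = ≤-trans (≈⇒≥ (+-identityˡ x))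
  (≤-trans (+-mono-≤ h ≤-refl) (≈⇒≤ (solve 2 (λ y x → y :- x :+ x := y) ≈-refl y x)))
  where open ℝ-Solver

*-monoˡ-≤ : ∀ z → 0ℝ ≤ z → x ≤ y → z * x ≤ z * y
*-monoˡ-≤ {x} {y} z 0≤z x≤y = 0≤y-x⇒x≤y (≤-trans (*-nonNeg 0≤z (x≤y⇒0≤y-x x≤y))
  (≈⇒≤ (solve 3 (λ z x y → z :* (y :- x) := z :* y :- z :* x) ≈-refl z x y)))
  where open ℝ-Solver

*-monoʳ-≤ : ∀ z → 0ℝ ≤ z → x ≤ y → x * z ≤ y * z
*-monoʳ-≤ {x} {y} z 0≤z x≤y = ≤-trans (≈⇒≤ (*-comm x z)) (≤-trans (*-monoˡ-≤ z 0≤z x≤y) (≈⇒≤ (*-comm z y)))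

∣x∣≤fromℚ : ∀ x → ∃[ K ] 0ℚ ℚ.< K × ∣ x ∣ ≤ fromℚ K
∣x∣≤fromℚ x = let K , 0<K , h = bounded x in
  K , 0<K , mk≤ λ ε 0<ε → mapᵉ (λ _ le → ℚ.≤-trans le (p≤p+ε 0<ε)) h

≈-from-ε : (∀ ε → 0ℚ ℚ.< ε → ∣ x - y ∣ ≤ fromℚ ε) → x ≈ y
≈-from-ε {x} {y} h = ≤-antisym
  (≤-from-ε λ ε 0<ε → x-y≤⇒x≤y+ (≤-trans x≤∣x∣ (h ε 0<ε)))
  (≤-from-ε λ ε 0<ε → x-y≤⇒x≤y+ (≤-trans (≤-trans x≤∣x∣ (≈⇒≤ (∣x-y∣≈∣y-x∣ y x))) (h ε 0<ε)))
  where
  open ℝ-Solver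
  x-y≤⇒x≤y+ : ∀ {x y z} → x - y ≤ z → x ≤ y + z
  x-y≤⇒x≤y+ {x} {y} {z} h = ≤-trans (≈⇒≤ (solve 2 (λ x y → x := y :+ (x :- y)) ≈-refl x y)) (+-mono-≤ ≤-refl h)

∣x-z∣≤ : ∀ x y z → ∣ x - y ∣ ≤ x′ → ∣ y - z ∣ ≤ y′ → ∣ x - z ∣ ≤ x′ + y′
∣x-z∣≤ x y z g h = ≤-trans (≈⇒≤ (∣x∣-cong (solve 3 (λ x y z → x :- z := (x :- y) :+ (y :- z)) ≈-refl x y z)))
  (≤-trans (∣x+y∣≤∣x∣+∣y∣ (x - y) (y - z)) (+-mono-≤ g h))
  where open ℝ-Solver

-- Limits and series

⟶-cong : ∀ {a b l m} → (∀ n → a n ≈ b n) → l ≈ m → a ⟶ l → b ⟶ m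
⟶-cong a≈b l≈m h ε 0<ε = mapᵉ
  (λ n → ≤-trans (≈⇒≥ (∣x∣-cong (+-cong (a≈b n) (neg-cong l≈m))))) (h ε 0<ε)

⟶-+ : ∀ {a b l m} → a ⟶ l → b ⟶ m → (λ n → a n + b n) ⟶ (l + m)
⟶-+ {a} {b} {l} {m} g h ε 0<ε = zipᵉ
  (λ n le le′ → begin
    ∣ (a n + b n) - (l + m) ∣
      ≈⟨ ∣x∣-cong (solve 4 (λ a b l m → (a :+ b) :- (l :+ m) := (a :- l) :+ (b :- m)) ≈-refl (a n) (b n) l m) ⟩
    ∣ (a n - l) + (b n - m) ∣
      ≲⟨ ∣x+y∣≤∣x∣+∣y∣ (a n - l) (b n - m) ⟩
    ∣ a n - l ∣ + ∣ b n - m ∣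
      ≲⟨ +-mono-≤ le le′ ⟩
    fromℚ (½ ℚ.* ε) + fromℚ (½ ℚ.* ε)
      ≈⟨ fromℚ-halves ε ⟩
    fromℚ ε ∎)
  (g (½ ℚ.* ε) (halve 0<ε)) (h (½ ℚ.* ε) (halve 0<ε))
  where
  open ℝ-Solver
  open ≤-Reasoning

⟶-* : ∀ {a l} c → a ⟶ l → (λ n → c * a n) ⟶ (c * l)
⟶-* {a} {l} c h ε 0<ε = let K , 0<K , c≤K = ∣x∣≤fromℚ c ; δ , 0<δ , Kδ≡ε = divide K 0<K 0<ε in mapᵉ
  (λ n le → begin
    ∣ c * a n - c * l ∣    ≈⟨ ∣x∣-cong (solve 3 (λ c a l → c :* a :- c :* l := c :* (a :- l)) ≈-refl c (a n) l) ⟩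
    ∣ c * (a n - l) ∣      ≈⟨ ∣xy∣≈∣x∣∣y∣ c (a n - l) ⟩
    ∣ c ∣ * ∣ a n - l ∣    ≲⟨ *-monoˡ-≤ ∣ c ∣ 0≤∣x∣ le ⟩
    ∣ c ∣ * fromℚ δ        ≲⟨ *-monoʳ-≤ (fromℚ δ) (fromℚ-mono-≤ (ℚ.<⇒≤ 0<δ)) c≤K ⟩
    fromℚ K * fromℚ δ      ≈⟨ ≈-pointwise (λ _ → Kδ≡ε) ⟩
    fromℚ ε                ∎)
  (h δ 0<δ)
  where
  open ℝ-Solver
  open ≤-Reasoning

⟶-lower : ∀ {a l} → Eventually (λ n → y ≤ a n) → a ⟶ l → y ≤ l
⟶-lower {y} {a} {l} y≤a h = ≤-from-ε λ ε 0<ε →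
  let N , g = zipᵉ
        (λ n y≤an le → begin
          y              ≲⟨ y≤an ⟩
          a n            ≈⟨ solve 2 (λ a l → a := l :+ (a :- l)) ≈-refl (a n) l ⟩
          l + (a n - l)  ≲⟨ +-mono-≤ ≤-refl (≤-trans x≤∣x∣ le) ⟩
          l + fromℚ ε    ∎)
        y≤a (h ε 0<ε)
  in g N ℕ.≤-refl
  where
  open ℝ-Solver
  open ≤-Reasoning

⟶-neg : ∀ {a l} → a ⟶ l → (λ n → - a n) ⟶ (- l)
⟶-neg {a} {l} h = ⟶-cong (λ n → neg (a n)) (neg l) (⟶-* (- 1ℝ) h)
  where
  open ℝ-Solver
  neg : ∀ x → - 1ℝ * x ≈ - x
  neg = solve 1 (λ x → (:- con 1ℚ) :* x := :- x) ≈-refl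

⟶-upper : ∀ {a l} → Eventually (λ n → a n ≤ y) → a ⟶ l → l ≤ y
⟶-upper {y} {a} {l} a≤y h = ≤-trans (≈⇒≤ (neg-neg l)) (≤-trans
  (neg-mono-≤ (⟶-lower (mapᵉ (λ _ → neg-mono-≤) a≤y) (⟶-neg h))) (≈⇒≥ (neg-neg y)))
  where
  open ℝ-Solver
  neg-neg : ∀ x → x ≈ - - x
  neg-neg = solve 1 (λ x → x := :- :- x) ≈-refl

-- Completeness of the reals

1/suc : ℕ → ℚ
1/suc n = mkℚ (+ 1) n (Coprimality.1-coprimeTo (suc n))

archimedean : ∀ ε → 0ℚ ℚ.< ε → Eventually (λ n → 1/suc n ℚ.≤ ε)
archimedean (mkℚ (+ suc a) d _) _ = d , λ n d≤n →
  ℚ.*≤* (ℤ.+≤+ (ℕ.≤-trans (ℕ.≤-reflexive (ℕ.+-identityʳ (suc d))) (ℕ.≤-trans (s≤s d≤n) (ℕ.m≤m+n (suc n) (a ℕ.* suc n)))))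
archimedean (mkℚ (+ zero) d _) (ℚ.*<* (ℤ.+<+ ()))
archimedean (mkℚ ℤ.-[1+ _ ] d _) (ℚ.*<* ())

-- The limit is a diagonal sequence: from each `a n` one rational term within 1/(n + 1) of it is
-- taken, at an index given by its own Cauchy modulus.
complete : ∀ a → (∀ ε → 0ℚ ℚ.< ε → ∃[ N ] ∀ m n → N ℕ.≤ m → N ℕ.≤ n → ∣ a m - a n ∣ ≤ fromℚ ε) →
           ∃[ l ] a ⟶ l
complete a h = mkℝ s s-cauchy , λ ε 0<ε →
  let M , near  = archimedean (½ ℚ.* ε) (halve 0<ε)
      N , close = s-cauchy (½ ℚ.* ε) (halve 0<ε)
  in M ℕ.⊔ N , λ n le → ≤-trans
      (∣x-z∣≤ (a n) (fromℚ (s n)) (mkℝ s s-cauchy)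
        (≤-trans (a-near n) (fromℚ-mono-≤ (near n (ℕ.m⊔n≤o⇒m≤o M N le))))
        (mk≤ λ η 0<η → N , λ i N≤i → ℚ.≤-trans (close n i (ℕ.m⊔n≤o⇒n≤o M N le) N≤i) (p≤p+ε 0<η)))
      (≈⇒≤ (fromℚ-halves ε))
  where
  open ℝ-Solver
  0<1/suc : ∀ n → 0ℚ ℚ.< 1/suc n
  0<1/suc n = ℚ.positive⁻¹ (1/suc n)
  idx : ℕ → ℕ
  idx n = proj₁ (cauchy (a n) (1/suc n) (0<1/suc n))
  s : ℕ → ℚ
  s n = seq (a n) (idx n)
  a-near : ∀ n → ∣ a n - fromℚ (s n) ∣ ≤ fromℚ (1/suc n)
  a-near n = mk≤ λ ε 0<ε → idx n , λ i le →
    ℚ.≤-trans (proj₂ (cauchy (a n) (1/suc n) (0<1/suc n)) i (idx n) le ℕ.≤-refl) (p≤p+ε 0<ε)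
  s-cauchy : Cauchy s
  s-cauchy ε 0<ε =
    let δ = ½ ℚ.* ε ; η = ½ ℚ.* δ ; 0<η = halve (halve 0<ε)
        M , near  = archimedean η 0<η
        N , close = h δ (halve 0<ε)
        near′ = λ n (le : M ℕ.≤ n) → ≤-trans (a-near n) (fromℚ-mono-≤ (near n le))
    in M ℕ.⊔ N , λ m n m≥ n≥ → fromℚ-cancel-≤ (≤-trans
        (≤-trans (≤-pointwise λ _ → ℚ.≤-refl) (∣x-z∣≤ (fromℚ (s m)) (a m) (fromℚ (s n))
          (≤-trans (≈⇒≤ (∣x-y∣≈∣y-x∣ (fromℚ (s m)) (a m))) (near′ m (ℕ.m⊔n≤o⇒m≤o M N m≥)))
          (∣x-z∣≤ (a m) (a n) (fromℚ (s n)) (close m n (ℕ.m⊔n≤o⇒n≤o M N m≥) (ℕ.m⊔n≤o⇒n≤o M N n≥))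
            (near′ n (ℕ.m⊔n≤o⇒m≤o M N n≥)))))
        (≈⇒≤ (≈-trans (solve 2 (λ e d → e :+ (d :+ e) := (e :+ e) :+ d) ≈-refl (fromℚ η) (fromℚ δ))
          (≈-trans (+-cong (fromℚ-halves δ) ≈-refl) (fromℚ-halves ε)))))

-- Series of reals

partialSum-cong : ∀ n → (∀ k → k ℕ.< n → a k ≈ b k) → partialSum a n ≈ partialSum b n
partialSum-cong zero    h = ≈-refl
partialSum-cong (suc n) h = +-cong (partialSum-cong n (λ k k<n → h k (ℕ.m<n⇒m<1+n k<n))) (h n ℕ.≤-refl)

partialSum-mono : ∀ n → (∀ k → a k ≤ b k) → partialSum a n ≤ partialSum b n
partialSum-mono zero    h = ≤-refl
partialSum-mono (suc n) h = +-mono-≤ (partialSum-mono n h) (h n)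

partialSum-+ : ∀ n → partialSum (λ k → a k + b k) n ≈ partialSum a n + partialSum b n
partialSum-+ zero = ≈-sym (+-identityˡ 0ℝ)
partialSum-+ {a} {b} (suc n) = ≈-trans (+-cong (partialSum-+ n) ≈-refl)
  (solve 4 (λ s t a b → s :+ t :+ (a :+ b) := s :+ a :+ (t :+ b)) ≈-refl (partialSum a n) (partialSum b n) (a n) (b n))
  where open ℝ-Solver

partialSum-* : ∀ c n → partialSum (λ k → c * a k) n ≈ c * partialSum a n
partialSum-* c zero = ≈-sym (*-zeroʳ c)
partialSum-* {a} c (suc n) = ≈-trans (+-cong (partialSum-* c n) ≈-refl)
  (solve 3 (λ c s a → c :* s :+ c :* a := c :* (s :+ a)) ≈-refl c (partialSum a n) (a n))
  where open ℝ-Solver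

partialSum-∣∣ : ∀ n → ∣ partialSum a n ∣ ≤ partialSum (λ k → ∣ a k ∣) n
partialSum-∣∣ zero = ≤-pointwise λ _ → ℚ.≤-refl
partialSum-∣∣ {a} (suc n) = ≤-trans (∣x+y∣≤∣x∣+∣y∣ (partialSum a n) (a n)) (+-mono-≤ (partialSum-∣∣ n) ≤-refl)

partialSum-0 : ∀ n → (∀ k → k ℕ.< n → a k ≈ 0ℝ) → partialSum a n ≈ 0ℝ
partialSum-0 zero    h = ≈-refl
partialSum-0 (suc n) h = ≈-trans (+-cong (partialSum-0 n (λ k k<n → h k (ℕ.m<n⇒m<1+n k<n))) (h n ℕ.≤-refl)) (+-identityˡ 0ℝ)

partialSum-single : ∀ i n → (∀ k → k ≢ i → a k ≈ 0ℝ) → i ℕ.< n → partialSum a n ≈ a i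
partialSum-single {a} i (suc n) h i<1+n with ℕ.m≤n⇒m<n∨m≡n (ℕ.s≤s⁻¹ i<1+n)
... | inj₁ i<n  = ≈-trans (+-cong (partialSum-single i n h i<n) (h n (ℕ.>⇒≢ i<n))) (+-identityʳ (a i))
... | inj₂ refl = ≈-trans (+-cong (partialSum-0 n (λ k k<n → h k (ℕ.<⇒≢ k<n))) ≈-refl) (+-identityˡ (a i))

partialSum-swap : ∀ (t : ℕ → ℕ → ℝ) m n →
  partialSum (λ i → partialSum (t i) n) m ≈ partialSum (λ j → partialSum (λ i → t i j) m) n
partialSum-swap t zero n = ≈-sym (partialSum-0 n (λ _ _ → ≈-refl))
partialSum-swap t (suc m) n = ≈-trans (+-cong (partialSum-swap t m n) ≈-refl) (≈-sym (partialSum-+ n))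

partialSum-increasing : (∀ k → 0ℝ ≤ a k) → ∀ {m n} → m ℕ.≤ n → partialSum a m ≤ partialSum a n
partialSum-increasing {a} 0≤a m≤n = go (ℕ.≤⇒≤′ m≤n)
  where
  go : ∀ {m n} → m ℕ.≤′ n → partialSum a m ≤ partialSum a n
  go ℕ.≤′-refl = ≤-refl
  go (ℕ.≤′-step {n} m≤n) = ≤-trans (go m≤n) (≤-trans (≈⇒≥ (+-identityʳ _)) (+-mono-≤ ≤-refl (0≤a n)))

partialSum≤sum : (∀ k → 0ℝ ≤ a k) → a SumsTo l → ∀ n → partialSum a n ≤ l
partialSum≤sum 0≤a h n = ⟶-lower (n , λ _ → partialSum-increasing 0≤a) h

SumsTo-cong : (∀ n → a n ≈ b n) → l ≈ m → a SumsTo l → b SumsTo m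
SumsTo-cong a≈b l≈m = ⟶-cong (λ n → partialSum-cong n (λ k _ → a≈b k)) l≈m

SumsTo-+ : a SumsTo l → b SumsTo m → (λ n → a n + b n) SumsTo (l + m)
SumsTo-+ g h = ⟶-cong (λ n → ≈-sym (partialSum-+ n)) ≈-refl (⟶-+ g h)

SumsTo-* : ∀ c → a SumsTo l → (λ n → c * a n) SumsTo (c * l)
SumsTo-* c h = ⟶-cong (λ n → ≈-sym (partialSum-* c n)) ≈-refl (⟶-* c h)

-- Consecutive partial sums differ by `x` and both approach `y`. Applied to countably many copies of
-- an empty set, this makes empty sets null.
constantSeries : (λ _ → x) SumsTo y → x ≈ 0ℝ
constantSeries {x} {y} h = ≈-from-ε λ ε 0<ε →
  let N , g = h (½ ℚ.* ε) (halve 0<ε) ; P = partialSum (λ _ → x) in begin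
    ∣ x - 0ℝ ∣                           ≈⟨ ∣x∣-cong (solve 2 (λ p x → x :- con 0ℚ := (p :+ x) :- p) ≈-refl (P N) x) ⟩
    ∣ P (suc N) - P N ∣                  ≲⟨ ∣x-z∣≤ (P (suc N)) y (P N) (g (suc N) (ℕ.n≤1+n N)) (≤-trans (≈⇒≤ (∣x-y∣≈∣y-x∣ y (P N))) (g N ℕ.≤-refl)) ⟩
    fromℚ (½ ℚ.* ε) + fromℚ (½ ℚ.* ε)    ≈⟨ fromℚ-halves ε ⟩
    fromℚ ε                              ∎
  where
  open ℝ-Solver
  open ≤-Reasoning

partialSum-diff : (∀ k → a k ≤ b k) → ∀ {m n} → m ℕ.≤ n →
  partialSum a n - partialSum a m ≤ partialSum b n - partialSum b m
partialSum-diff {a} {b} a≤b {m} m≤n = go (ℕ.≤⇒≤′ m≤n)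
  where
  open ℝ-Solver
  open ≤-Reasoning
  shuffle : ∀ x y z → x + y - z ≈ (x - z) + y
  shuffle = solve 3 (λ x y z → x :+ y :- z := (x :- z) :+ y) ≈-refl
  go : ∀ {n} → m ℕ.≤′ n → partialSum a n - partialSum a m ≤ partialSum b n - partialSum b m
  go ℕ.≤′-refl = ≈⇒≤ (solve 2 (λ x y → x :- x := y :- y) ≈-refl (partialSum a m) (partialSum b m))
  go (ℕ.≤′-step {n} m≤n) = begin
    partialSum a n + a n - partialSum a m      ≈⟨ shuffle (partialSum a n) (a n) (partialSum a m) ⟩
    (partialSum a n - partialSum a m) + a n    ≲⟨ +-mono-≤ (go m≤n) (a≤b n) ⟩
    (partialSum b n - partialSum b m) + b n    ≈⟨ shuffle (partialSum b n) (b n) (partialSum b m) ⟨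
    partialSum b n + b n - partialSum b m      ∎

-- Constructively a bounded monotone sequence need not converge, so the Cauchy criterion is used:
-- each tail of `a` is dominated by the same tail of `b`, which supplies the modulus.
comparisonTest : (∀ k → 0ℝ ≤ a k) → (∀ k → a k ≤ b k) → b SumsTo m → ∃[ l ] a SumsTo l
comparisonTest {a} {b} {m} 0≤a a≤b h = complete (partialSum a) λ ε 0<ε →
  let N , g = h (½ ℚ.* ε) (halve 0<ε) in N , λ i j N≤i N≤j →
    [ (λ i≤j → ≤-trans (≈⇒≤ (∣x-y∣≈∣y-x∣ (partialSum a i) (partialSum a j))) (tail ε g i≤j N≤i N≤j))
    , (λ j≤i → tail ε g j≤i N≤j N≤i) ]′ (ℕ.≤-total i j)
  where
  tail : ∀ {N} ε → (∀ n → N ℕ.≤ n → ∣ partialSum b n - m ∣ ≤ fromℚ (½ ℚ.* ε)) →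
         ∀ {i j} → i ℕ.≤ j → N ℕ.≤ i → N ℕ.≤ j → ∣ partialSum a j - partialSum a i ∣ ≤ fromℚ ε
  tail ε g {i} {j} i≤j N≤i N≤j = begin
    ∣ partialSum a j - partialSum a i ∣    ≈⟨ 0≤x⇒∣x∣≈x (x≤y⇒0≤y-x (partialSum-increasing 0≤a i≤j)) ⟩
    partialSum a j - partialSum a i        ≲⟨ partialSum-diff a≤b i≤j ⟩
    partialSum b j - partialSum b i        ≲⟨ x≤∣x∣ ⟩
    ∣ partialSum b j - partialSum b i ∣    ≲⟨ ∣x-z∣≤ (partialSum b j) m (partialSum b i) (g j N≤j) (≤-trans (≈⇒≤ (∣x-y∣≈∣y-x∣ m (partialSum b i))) (g i N≤i)) ⟩
    fromℚ (½ ℚ.* ε) + fromℚ (½ ℚ.* ε)      ≈⟨ fromℚ-halves ε ⟩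
    fromℚ ε                                ∎
    where open ≤-Reasoning

⟶-partialSum : ∀ {s : ℕ → ℕ → ℝ} {T} → (∀ k → s k ⟶ T k) → ∀ K →
               (λ J → partialSum (λ k → s k J) K) ⟶ partialSum T K
⟶-partialSum h zero    ε 0<ε = eventually λ _ → ≤-trans (≈⇒≤ (≈-pointwise λ _ → refl)) (fromℚ-mono-≤ (ℚ.<⇒≤ 0<ε))
⟶-partialSum h (suc K) = ⟶-+ (⟶-partialSum h K) (h K)

module _ {t : ℕ → ℕ → ℝ} {T : ℕ → ℝ} {M : ℝ} (κ : ℕ → ℕ)
         (0≤t : ∀ k j → 0ℝ ≤ t k j) (off : ∀ k j → k ≢ κ j → t k j ≈ 0ℝ)
         (rows : ∀ k → t k SumsTo T k) (total : T SumsTo M) where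
  private
    diagonal : ℕ → ℝ
    diagonal j = t (κ j) j

    column≤ : ∀ K j → partialSum (λ k → t k j) K ≤ diagonal j
    column≤ K j with κ j ℕ.<? K
    ... | yes κj<K = ≈⇒≤ (partialSum-single (κ j) K (λ k → off k j) κj<K)
    ... | no κj≮K = ≤-trans (≈⇒≤ (partialSum-0 K λ k k<K → off k j λ k≡κj → κj≮K (subst (ℕ._< K) k≡κj k<K))) (0≤t (κ j) j)

    -- A row index beyond every `κ j` with `j < J`: the first `above J` rows contain all nonzero
    -- entries of the first `J` columns, so those columns form a finite double sum whose order can
    -- be exchanged.
    above : ℕ → ℕ
    above zero    = 0
    above (suc J) = above J ℕ.⊔ suc (κ J)

    κ<above : ∀ J j → j ℕ.< J → κ j ℕ.< above J
    κ<above (suc J) j j<1+J with ℕ.m≤n⇒m<n∨m≡n (ℕ.s≤s⁻¹ j<1+J)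
    ... | inj₁ j<J  = ℕ.≤-trans (κ<above J j j<J) (ℕ.m≤m⊔n (above J) (suc (κ J)))
    ... | inj₂ refl = ℕ.m≤n⊔m (above J) (suc (κ J))

    0≤T : ∀ k → 0ℝ ≤ T k
    0≤T k = partialSum≤sum (0≤t k) (rows k) 0

    upper : ∀ J → partialSum diagonal J ≤ M
    upper J = begin
      partialSum diagonal J                                    ≈⟨ partialSum-cong J (λ j j<J → ≈-sym (partialSum-single (κ j) (above J) (λ k → off k j) (κ<above J j j<J))) ⟩
      partialSum (λ j → partialSum (λ k → t k j) (above J)) J  ≈⟨ partialSum-swap t (above J) J ⟨
      partialSum (λ k → partialSum (t k) J) (above J)          ≲⟨ partialSum-mono (above J) (λ k → partialSum≤sum (0≤t k) (rows k) J) ⟩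
      partialSum T (above J)                                   ≲⟨ partialSum≤sum 0≤T total (above J) ⟩
      M                                                        ∎
      where open ≤-Reasoning

    lower : ∀ K J → partialSum (λ k → partialSum (t k) J) K ≤ partialSum diagonal J
    lower K J = ≤-trans (≈⇒≤ (partialSum-swap t K J)) (partialSum-mono J (column≤ K))

  -- Tannery's theorem, for a double series with one nonzero entry per column.
  diagonal-SumsTo : diagonal SumsTo M
  diagonal-SumsTo ε 0<ε =
    -- `K` rows bring the sum of the row totals within ε/2 of `M`, and cutting these finitely many
    -- rows at a late column costs another ε/2. The rectangle that remains lies below the diagonal
    -- sum.
    let K , close  = total (½ ℚ.* ε) (halve 0<ε)
        N , close′ = ⟶-partialSum rows K (½ ℚ.* ε) (halve 0<ε)
    in N , λ J N≤J → ∣x∣≤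
      (begin
        partialSum diagonal J - M    ≲⟨ +-mono-≤ (upper J) ≤-refl ⟩
        M - M                        ≈⟨ solve 1 (λ x → x :- x := con 0ℚ) ≈-refl M ⟩
        0ℝ                           ≲⟨ fromℚ-mono-≤ (ℚ.<⇒≤ 0<ε) ⟩
        fromℚ ε                      ∎)
      (begin
        - (partialSum diagonal J - M)                        ≈⟨ solve 2 (λ x y → :- (x :- y) := y :- x) ≈-refl (partialSum diagonal J) M ⟩
        M - partialSum diagonal J                            ≲⟨ +-mono-≤ ≤-refl (neg-mono-≤ (lower K J)) ⟩
        M - partialSum (λ k → partialSum (t k) J) K          ≲⟨ x≤∣x∣ ⟩
        ∣ M - partialSum (λ k → partialSum (t k) J) K ∣      ≲⟨ ∣x-z∣≤ M (partialSum T K) _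
                                                                  (≤-trans (≈⇒≤ (∣x-y∣≈∣y-x∣ M (partialSum T K))) (close K ℕ.≤-refl))
                                                                  (≤-trans (≈⇒≤ (∣x-y∣≈∣y-x∣ (partialSum T K) _)) (close′ J N≤J)) ⟩
        fromℚ (½ ℚ.* ε) + fromℚ (½ ℚ.* ε)                    ≈⟨ fromℚ-halves ε ⟩
        fromℚ ε                                              ∎)
    where
    open ℝ-Solver
    open ≤-Reasoning

-- A bijection ℕ → ℕ × ℕ walking the antidiagonals

next : ℕ × ℕ → ℕ × ℕ
next (suc i , j) = i , suc j
next (zero  , j) = suc j , 0

unpair : ℕ → ℕ × ℕ
unpair zero    = 0 , 0
unpair (suc n) = next (unpair n)

next≢0 : ∀ i → next i ≢ (0 , 0)
next≢0 (suc i , j) ()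
next≢0 (zero  , j) ()

next-injective : ∀ i j → next i ≡ next j → i ≡ j
next-injective (suc i , j) (suc .i , .j) refl = refl
next-injective (suc i , j) (zero , l) ()
next-injective (zero , j) (suc k , l) ()
next-injective (zero , j) (zero , .j) refl = refl

unpair-injective : ∀ m n → unpair m ≡ unpair n → m ≡ n
unpair-injective zero zero e = refl
unpair-injective zero (suc n) e = ⊥-elim (next≢0 (unpair n) (sym e))
unpair-injective (suc m) zero e = ⊥-elim (next≢0 (unpair m) e)
unpair-injective (suc m) (suc n) e = cong suc (unpair-injective m n (next-injective (unpair m) (unpair n) e))

unpair-surjective : ∀ i j → ∃[ n ] unpair n ≡ (i , j)
unpair-surjective i j = go (i ℕ.+ j) i j refl
  where
  -- The walk is traced backwards: along an antidiagonal `j` falls, and from (i + 1 , 0) it steps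
  -- back to (0 , i) on the antidiagonal `s - 1`.
  go : ∀ s i j → i ℕ.+ j ≡ s → ∃[ n ] unpair n ≡ (i , j)
  go s zero zero e = 0 , refl
  go (suc s) (suc i) zero e = let n , h = go s 0 i (trans (sym (ℕ.+-identityʳ i)) (ℕ.suc-injective e)) in suc n , cong next h
  go s i (suc j) e = let n , h = go s (suc i) j (trans (sym (ℕ.+-suc i j)) e) in suc n , cong next h

-- The integral

-- A proof `h` of membership is a function on ℕ: `h 0` gives membership in `A` and `h 1` in `B`.
_∩ᴮ_ : ∀ {n} → Borel n → Borel n → Borel n
A ∩ᴮ B = ⋂ λ { zero → A ; (suc _) → B }

∩ᴮ-intro : ∀ {n} (A B : Borel n) {x} → ⟦ A ⟧ x → ⟦ B ⟧ x → ⟦ A ∩ᴮ B ⟧ x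
∩ᴮ-intro A B a b zero    = a
∩ᴮ-intro A B a b (suc _) = b

Cover : ∀ {n} → (ℕ → Borel n) → Set
Cover C = ∀ x → ∃[ k ] ⟦ C k ⟧ x

module Integration {n : ℕ} (P : ProbabilityMeasure n) where
  open ProbabilityMeasure P
  open SimpleFunction
  open HasSimpleIntegral

  private
    variable
      f g : ℝ^ n → ℝ
      v w : ℝ

  μ-empty : ∀ A → (∀ x → ¬ ⟦ A ⟧ x) → μ A ≈ 0ℝ
  μ-empty A empty = constantSeries (μ-additive (λ _ → A) (λ _ _ _ x a _ → empty x a))

  μ-split : ∀ A C → PairwiseDisjoint C → Cover C → (λ j → μ (A ∩ᴮ C j)) SumsTo μ A
  μ-split A C disj cov = SumsTo-cong (λ _ → ≈-refl)
    (μ-cong (⋃ λ j → A ∩ᴮ C j) A λ x → mk⇔ (λ (j , h) → h 0) (λ a → let j , c = cov x in j , ∩ᴮ-intro A (C j) a c))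
    (μ-additive (λ j → A ∩ᴮ C j) λ j k j≢k x h h′ → disj j k j≢k x (h 1) (h′ 1))

  ∑μ≈1 : ∀ C → PairwiseDisjoint C → Cover C → (λ j → μ (C j)) SumsTo 1ℝ
  ∑μ≈1 C disj cov = SumsTo-cong (λ _ → ≈-refl)
    (≈-trans (μ-cong (⋃ C) (∁ ∅) λ x → mk⇔ (λ _ ()) (λ _ → cov x)) μ-total) (μ-additive C disj)

  absolute-sum : ∀ s → HasSimpleIntegral P s v → ∃[ M ] (λ k → ∣ value s k ∣ * μ (piece s k)) SumsTo M
  absolute-sum s I = let M , h = absolutely I in M , SumsTo-cong
    (λ k → ≈-trans (∣xy∣≈∣x∣∣y∣ (value s k) (μ (piece s k))) (*-congˡ (∣ value s k ∣) (0≤x⇒∣x∣≈x (μ-nonNeg (piece s k)))))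
    ≈-refl h

  module _ (s : SimpleFunction P) (C : ℕ → Borel n) (disj : PairwiseDisjoint C) (cov : Cover C)
           (κ : ℕ → ℕ) (refines : ∀ j x → ⟦ C j ⟧ x → ⟦ piece s (κ j) ⟧ x) where

    -- The cell `C j` meets no piece other than the one numbered `κ j`, so the masses of the
    -- intersections of pieces and cells form a double series with one nonzero entry per column.
    -- Additivity sums its rows, and its diagonal is the refined series.
    refine-nonNeg : ∀ {b : ℕ → ℝ} {M} → (∀ k → 0ℝ ≤ b k) → (λ k → b k * μ (piece s k)) SumsTo M →
                    (λ j → b (κ j) * μ (C j)) SumsTo M
    refine-nonNeg {b} 0≤b h = SumsTo-cong
      (λ j → *-congˡ (b (κ j)) (μ-cong (piece s (κ j) ∩ᴮ C j) (C j)
        λ x → mk⇔ (λ h → h 1) (λ c → ∩ᴮ-intro (piece s (κ j)) (C j) (refines j x c) c)))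
      ≈-refl
      (diagonal-SumsTo {t = λ k j → b k * μ (piece s k ∩ᴮ C j)} κ
        (λ k j → *-nonNeg (0≤b k) (μ-nonNeg _))
        (λ k j k≢κj → ≈-trans
          (*-congˡ (b k) (μ-empty _ λ x h → disjoint s k (κ j) k≢κj x (h 0) (refines j x (h 1))))
          (*-zeroʳ (b k)))
        (λ k → SumsTo-* (b k) (μ-split (piece s k) C disj cov))
        h)

    refine-abs : ∀ {v} → HasSimpleIntegral P s v →
                 ∃[ M ] (λ j → ∣ value s (κ j) ∣ * μ (C j)) SumsTo M
    refine-abs I = let M , h = absolute-sum s I in M , refine-nonNeg {b = λ k → ∣ value s k ∣} (λ k → 0≤∣x∣ {value s k}) h

    -- A signed sequence a is the difference of ∣ a ∣ and ∣ a ∣ - a, both nonnegative.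
    refine-sum : ∀ {v} → HasSimpleIntegral P s v → (λ j → value s (κ j) * μ (C j)) SumsTo v
    refine-sum {v} I = SumsTo-cong
      (λ j → recombine (∣ value s (κ j) ∣) (value s (κ j)) (μ (C j))) (cancel M v)
      (SumsTo-+ (refine-nonNeg {b = λ k → ∣ value s k ∣} 0≤∣a∣ h)
        (SumsTo-* (- 1ℝ) (refine-nonNeg {b = λ k → ∣ value s k ∣ - value s k} 0≤∣a∣-a negative)))
      where
      open ℝ-Solver
      expand : ∀ a b m → a * m + - 1ℝ * (b * m) ≈ (a - b) * m
      expand = solve 3 (λ a b m → a :* m :+ (:- con 1ℚ) :* (b :* m) := (a :- b) :* m) ≈-refl
      recombine : ∀ a b m → a * m + - 1ℝ * ((a - b) * m) ≈ b * m
      recombine = solve 3 (λ a b m → a :* m :+ (:- con 1ℚ) :* ((a :- b) :* m) := b :* m) ≈-refl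
      cancel : ∀ M v → M + - 1ℝ * (M + - 1ℝ * v) ≈ v
      cancel = solve 2 (λ M v → M :+ (:- con 1ℚ) :* (M :+ (:- con 1ℚ) :* v) := v) ≈-refl
      M : ℝ
      M = proj₁ (absolute-sum s I)
      h : (λ k → ∣ value s k ∣ * μ (piece s k)) SumsTo M
      h = proj₂ (absolute-sum s I)
      0≤∣a∣ : ∀ k → 0ℝ ≤ ∣ value s k ∣
      0≤∣a∣ k = 0≤∣x∣
      0≤∣a∣-a : ∀ k → 0ℝ ≤ ∣ value s k ∣ - value s k
      0≤∣a∣-a k = x≤y⇒0≤y-x {value s k} {∣ value s k ∣} x≤∣x∣
      negative : (λ k → (∣ value s k ∣ - value s k) * μ (piece s k)) SumsTo (M + - 1ℝ * v)
      negative = SumsTo-cong (λ k → expand (∣ value s k ∣) (value s k) (μ (piece s k))) ≈-refl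
        (SumsTo-+ h (SumsTo-* (- 1ℝ) (sums I)))

  module _ (s t : SimpleFunction P) (q r : ℚ) where
    private
      -- The common refinement of `s` and `t`, enumerated by `unpair`. Empty intersections stay in
      -- the list, since inhabitedness cannot be decided.
      C : ℕ → Borel n
      C j = piece s (proj₁ (unpair j)) ∩ᴮ piece t (proj₂ (unpair j))

      C-disjoint : PairwiseDisjoint C
      C-disjoint i j i≢j x h h′ with proj₁ (unpair i) ℕ.≟ proj₁ (unpair j) | proj₂ (unpair i) ℕ.≟ proj₂ (unpair j)
      ... | no k≢k′ | _ = disjoint s _ _ k≢k′ x (h 0) (h′ 0)
      ... | _ | no l≢l′ = disjoint t _ _ l≢l′ x (h 1) (h′ 1)
      ... | yes e | yes e′ = i≢j (unpair-injective i j (cong₂ _,_ e e′))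

      C-cover : Cover C
      C-cover x =
        let k , a = cover s x
            l , b = cover t x
            j , e = unpair-surjective k l
        in j , ∩ᴮ-intro (piece s (proj₁ (unpair j))) (piece t (proj₂ (unpair j)))
             (subst (λ i → ⟦ piece s (proj₁ i) ⟧ x) (sym e) a) (subst (λ i → ⟦ piece t (proj₂ i) ⟧ x) (sym e) b)

      left right : ℕ → ℝ
      left j = value s (proj₁ (unpair j))
      right j = value t (proj₂ (unpair j))

    combination : SimpleFunction P
    combination = record
      { piece = C ; value = λ j → fromℚ q * left j + fromℚ r * right j ; disjoint = C-disjoint ; cover = C-cover }

    combination-integral : HasSimpleIntegral P s v → HasSimpleIntegral P t w →
                           HasSimpleIntegral P combination (fromℚ q * v + fromℚ r * w)
    combination-integral I J = record
      { absolutely = comparisonTest (λ _ → 0≤∣x∣) bound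
          (SumsTo-+ (SumsTo-* (∣ fromℚ q ∣) (proj₂ (refine-abs s C C-disjoint C-cover (proj₁ ∘ unpair) (λ _ _ h → h 0) I)))
                    (SumsTo-* (∣ fromℚ r ∣) (proj₂ (refine-abs t C C-disjoint C-cover (proj₂ ∘ unpair) (λ _ _ h → h 1) J))))
      ; sums = SumsTo-cong
          (λ j → solve 5 (λ q r a b m → q :* (a :* m) :+ r :* (b :* m) := (q :* a :+ r :* b) :* m) ≈-refl
                   (fromℚ q) (fromℚ r) (left j) (right j) (μ (C j)))
          ≈-refl
          (SumsTo-+ (SumsTo-* (fromℚ q) (refine-sum s C C-disjoint C-cover (proj₁ ∘ unpair) (λ _ _ h → h 0) I))
                    (SumsTo-* (fromℚ r) (refine-sum t C C-disjoint C-cover (proj₂ ∘ unpair) (λ _ _ h → h 1) J)))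
      }
      where
      open ℝ-Solver
      open ≤-Reasoning
      bound : ∀ j → ∣ (fromℚ q * left j + fromℚ r * right j) * μ (C j) ∣ ≤
                    ∣ fromℚ q ∣ * (∣ left j ∣ * μ (C j)) + ∣ fromℚ r ∣ * (∣ right j ∣ * μ (C j))
      bound j = begin
        ∣ (fromℚ q * left j + fromℚ r * right j) * μ (C j) ∣
          ≈⟨ ∣xy∣≈∣x∣∣y∣ _ _ ⟩
        ∣ fromℚ q * left j + fromℚ r * right j ∣ * ∣ μ (C j) ∣
          ≈⟨ *-congˡ _ (0≤x⇒∣x∣≈x (μ-nonNeg _)) ⟩
        ∣ fromℚ q * left j + fromℚ r * right j ∣ * μ (C j)
          ≲⟨ *-monoʳ-≤ (μ (C j)) (μ-nonNeg _) (∣x+y∣≤∣x∣+∣y∣ _ _) ⟩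
        (∣ fromℚ q * left j ∣ + ∣ fromℚ r * right j ∣) * μ (C j)
          ≈⟨ *-congʳ (μ (C j)) (+-cong (∣xy∣≈∣x∣∣y∣ _ _) (∣xy∣≈∣x∣∣y∣ _ _)) ⟩
        (∣ fromℚ q ∣ * ∣ left j ∣ + ∣ fromℚ r ∣ * ∣ right j ∣) * μ (C j)
          ≈⟨ solve 5 (λ q r a b m → (q :* a :+ r :* b) :* m := q :* (a :* m) :+ r :* (b :* m)) ≈-refl
               (∣ fromℚ q ∣) (∣ fromℚ r ∣) (∣ left j ∣) (∣ right j ∣) (μ (C j)) ⟩
        ∣ fromℚ q ∣ * (∣ left j ∣ * μ (C j)) + ∣ fromℚ r ∣ * (∣ right j ∣ * μ (C j)) ∎

  integral-linear : ∀ q r → HasIntegral P f v → HasIntegral P g w →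
    HasIntegral P (λ x → fromℚ q * f x + fromℚ r * g x) (fromℚ q * v + fromℚ r * w)
  integral-linear {f} {v} {g} {w} q r F G ε 0<ε =
    -- The summand 1 keeps `K` positive when `q` and `r` both vanish. The same estimate `close`
    -- serves the uniform distance of the functions and the distance of the integrals.
    let K = 1ℚ ℚ.+ (ℚ.∣ q ∣ ℚ.+ ℚ.∣ r ∣)
        δ , 0<δ , Kδ≡ε = divide K (0<K q r) 0<ε
        s , v′ , I , within , near = F δ 0<δ
        t , w′ , J , within′ , near′ = G δ 0<δ
    in combination s t q r , fromℚ q * v′ + fromℚ r * w′ , combination-integral s t q r I J
     , (λ j x h → close 0<δ Kδ≡ε (within _ x (h 0)) (within′ _ x (h 1)))
     , close 0<δ Kδ≡ε near near′
    where
    open ℝ-Solver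
    open ≤-Reasoning
    0<K : ∀ q r → 0ℚ ℚ.< 1ℚ ℚ.+ (ℚ.∣ q ∣ ℚ.+ ℚ.∣ r ∣)
    0<K q r = ℚ.positive⁻¹ _ {{ℚ.pos+nonNeg⇒pos 1ℚ (ℚ.∣ q ∣ ℚ.+ ℚ.∣ r ∣) {{ℚ.nonNegative (ℚ.+-mono-≤ (ℚ.0≤∣p∣ q) (ℚ.0≤∣p∣ r))}}}}
    close : ∀ {a b c d δ} → 0ℚ ℚ.< δ → (1ℚ ℚ.+ (ℚ.∣ q ∣ ℚ.+ ℚ.∣ r ∣)) ℚ.* δ ≡ ε →
            ∣ a - c ∣ ≤ fromℚ δ → ∣ b - d ∣ ≤ fromℚ δ →
            ∣ (fromℚ q * a + fromℚ r * b) - (fromℚ q * c + fromℚ r * d) ∣ ≤ fromℚ ε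
    close {a} {b} {c} {d} {δ} 0<δ e h h′ = begin
      ∣ (fromℚ q * a + fromℚ r * b) - (fromℚ q * c + fromℚ r * d) ∣
        ≈⟨ ∣x∣-cong (solve 6 (λ q r a b c d → (q :* a :+ r :* b) :- (q :* c :+ r :* d) := q :* (a :- c) :+ r :* (b :- d)) ≈-refl
             (fromℚ q) (fromℚ r) a b c d) ⟩
      ∣ fromℚ q * (a - c) + fromℚ r * (b - d) ∣
        ≲⟨ ∣x+y∣≤∣x∣+∣y∣ _ _ ⟩
      ∣ fromℚ q * (a - c) ∣ + ∣ fromℚ r * (b - d) ∣
        ≈⟨ +-cong (∣xy∣≈∣x∣∣y∣ _ _) (∣xy∣≈∣x∣∣y∣ _ _) ⟩
      ∣ fromℚ q ∣ * ∣ a - c ∣ + ∣ fromℚ r ∣ * ∣ b - d ∣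
        ≲⟨ +-mono-≤ (*-monoˡ-≤ (∣ fromℚ q ∣) 0≤∣x∣ h) (*-monoˡ-≤ (∣ fromℚ r ∣) 0≤∣x∣ h′) ⟩
      ∣ fromℚ q ∣ * fromℚ δ + ∣ fromℚ r ∣ * fromℚ δ
        ≈⟨ solve 3 (λ q r d → q :* d :+ r :* d := con 0ℚ :+ (q :+ r) :* d) ≈-refl (∣ fromℚ q ∣) (∣ fromℚ r ∣) (fromℚ δ) ⟩
      0ℝ + (∣ fromℚ q ∣ + ∣ fromℚ r ∣) * fromℚ δ
        ≲⟨ +-mono-≤ (fromℚ-mono-≤ (ℚ.<⇒≤ 0<δ)) ≤-refl ⟩
      fromℚ δ + (∣ fromℚ q ∣ + ∣ fromℚ r ∣) * fromℚ δ
        ≈⟨ solve 3 (λ q r d → d :+ (q :+ r) :* d := (con 1ℚ :+ (q :+ r)) :* d) ≈-refl (∣ fromℚ q ∣) (∣ fromℚ r ∣) (fromℚ δ) ⟩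
      (1ℝ + (∣ fromℚ q ∣ + ∣ fromℚ r ∣)) * fromℚ δ
        ≈⟨ ≈-pointwise (λ _ → e) ⟩
      fromℚ ε ∎

  integral-cong : (∀ x → f x ≈ g x) → v ≈ w → HasIntegral P f v → HasIntegral P g w
  integral-cong {f} {g} {v} {w} f≈g v≈w F ε 0<ε =
    let s , u , I , within , near = F ε 0<ε
    in s , u , I
     , (λ k x h → ≤-trans (≈⇒≥ (∣x∣-cong (+-cong (f≈g x) ≈-refl))) (within k x h))
     , ≤-trans (≈⇒≥ (∣x∣-cong (+-congˡ u (neg-cong v≈w)))) near

  -- Whether a piece is inhabited is not decidable, but ≤ is ¬¬-stable and an
  -- empty piece is null.
  small-term : ∀ s δ → (∀ x → f x ≈ 0ℝ) → Within P δ f s → ∀ k →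
               ∣ value s k * μ (piece s k) ∣ ≤ fromℚ δ * μ (piece s k)
  small-term {f} s δ f≈0 within k = ≤-stable λ ¬bound →
    ¬bound (empty λ x h → ¬bound (inhabited x h))
    where
    open ≤-Reasoning
    mass : ℝ
    mass = μ (piece s k)
    inhabited : ∀ x → ⟦ piece s k ⟧ x → ∣ value s k * mass ∣ ≤ fromℚ δ * mass
    inhabited x h = begin
      ∣ value s k * mass ∣           ≈⟨ ∣xy∣≈∣x∣∣y∣ _ _ ⟩
      ∣ value s k ∣ * ∣ mass ∣       ≈⟨ *-congˡ _ (0≤x⇒∣x∣≈x (μ-nonNeg _)) ⟩
      ∣ value s k ∣ * mass           ≈⟨ *-congʳ mass (∣-x∣≈∣x∣ _) ⟨
      ∣ - value s k ∣ * mass         ≈⟨ *-congʳ mass (∣x∣-cong (+-identityˡ _)) ⟨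
      ∣ 0ℝ - value s k ∣ * mass      ≈⟨ *-congʳ mass (∣x∣-cong (+-cong (f≈0 x) ≈-refl)) ⟨
      ∣ f x - value s k ∣ * mass     ≲⟨ *-monoʳ-≤ mass (μ-nonNeg _) (within k x h) ⟩
      fromℚ δ * mass                 ∎
    empty : (∀ x → ¬ ⟦ piece s k ⟧ x) → ∣ value s k * mass ∣ ≤ fromℚ δ * mass
    empty h = ≈⇒≤ (begin-equality
      ∣ value s k * mass ∣     ≈⟨ ∣x∣-cong (*-congˡ _ (μ-empty _ h)) ⟩
      ∣ value s k * 0ℝ ∣    ≈⟨ ∣x∣-cong (*-zeroʳ _) ⟩
      ∣ 0ℝ ∣                ≈⟨ 0≤x⇒∣x∣≈x ≤-refl ⟩
      0ℝ                    ≈⟨ *-zeroʳ _ ⟨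
      fromℚ δ * 0ℝ          ≈⟨ *-congˡ _ (μ-empty _ h) ⟨
      fromℚ δ * mass           ∎)

  -- The total mass is 1, so a simple function uniformly within δ of zero has an integral of
  -- absolute value at most δ. Uniqueness follows because the difference of two values for the same
  -- function is an integral of zero.
  integral-0 : (∀ x → f x ≈ 0ℝ) → HasIntegral P f v → v ≈ 0ℝ
  integral-0 {f} {v} f≈0 F = ≈-from-ε λ ε 0<ε →
    let δ = ½ ℚ.* ε
        0<δ = halve 0<ε
        s , u , I , within , near = F δ 0<δ
        T = λ k → value s k * μ (piece s k)
        ∣partial∣≤δ : ∀ n → ∣ partialSum T n ∣ ≤ fromℚ δ
        ∣partial∣≤δ n = begin
          ∣ partialSum T n ∣                               ≲⟨ partialSum-∣∣ n ⟩
          partialSum (λ k → ∣ T k ∣) n                     ≲⟨ partialSum-mono n (small-term s δ f≈0 within) ⟩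
          partialSum (λ k → fromℚ δ * μ (piece s k)) n     ≈⟨ partialSum-* (fromℚ δ) n ⟩
          fromℚ δ * partialSum (λ k → μ (piece s k)) n     ≲⟨ *-monoˡ-≤ (fromℚ δ) (fromℚ-mono-≤ (ℚ.<⇒≤ 0<δ))
                                                                (partialSum≤sum (λ _ → μ-nonNeg _) (∑μ≈1 (piece s) (disjoint s) (cover s)) n) ⟩
          fromℚ δ * 1ℝ                                     ≈⟨ solve 1 (λ d → d :* con 1ℚ := d) ≈-refl (fromℚ δ) ⟩
          fromℚ δ                                          ∎
        ∣u∣≤δ = ∣x∣≤ (⟶-upper (eventually λ n → ≤-trans x≤∣x∣ (∣partial∣≤δ n)) (sums I))
                     (⟶-upper (eventually λ n → ≤-trans -x≤∣x∣ (∣partial∣≤δ n)) (⟶-neg (sums I)))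
    in begin
      ∣ v - 0ℝ ∣             ≲⟨ ∣x-z∣≤ v u 0ℝ (≤-trans (≈⇒≤ (∣x-y∣≈∣y-x∣ v u)) near)
                                  (≤-trans (≈⇒≤ (∣x∣-cong (solve 1 (λ u → u :- con 0ℚ := u) ≈-refl u))) ∣u∣≤δ) ⟩
      fromℚ δ + fromℚ δ      ≈⟨ fromℚ-halves ε ⟩
      fromℚ ε                ∎
    where
    open ℝ-Solver
    open ≤-Reasoning

  integral-unique : HasIntegral P f v → HasIntegral P f w → v ≈ w
  integral-unique {f} {v} {w} F G = ≈-trans
    (solve 2 (λ v w → v := (con 1ℚ :* v :+ con (ℚ.- 1ℚ) :* w) :+ w) ≈-refl v w)
    (≈-trans (+-cong (integral-0 (λ x → solve 1 (λ y → con 1ℚ :* y :+ con (ℚ.- 1ℚ) :* y := con 0ℚ) ≈-refl (f x))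
                                 (integral-linear 1ℚ (ℚ.- 1ℚ) F G)) ≈-refl)
             (+-identityˡ w))
    where open ℝ-Solver

-- Permutations of the variables

relabel : ∀ {n} → (Fin n → Fin n) → Borel n → Borel n
relabel π ∅               = ∅
relabel π (halfSpace i c) = halfSpace (π i) c
relabel π (∁ A)           = ∁ (relabel π A)
relabel π (⋃ A)           = ⋃ (λ k → relabel π (A k))
relabel π (⋂ A)           = ⋂ (λ k → relabel π (A k))

⟦relabel⟧ : ∀ {n} (π : Fin n → Fin n) A x → (⟦ relabel π A ⟧ x → ⟦ A ⟧ (x ∘ π)) × (⟦ A ⟧ (x ∘ π) → ⟦ relabel π A ⟧ x)
⟦relabel⟧ π ∅               x = id , id
⟦relabel⟧ π (halfSpace i c) x = id , id
⟦relabel⟧ π (∁ A)           x = (_∘ proj₂ (⟦relabel⟧ π A x)) , (_∘ proj₁ (⟦relabel⟧ π A x))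
⟦relabel⟧ π (⋃ A)           x = (λ (k , h) → k , proj₁ (⟦relabel⟧ π (A k) x) h) , (λ (k , h) → k , proj₂ (⟦relabel⟧ π (A k) x) h)
⟦relabel⟧ π (⋂ A)           x = (λ h k → proj₁ (⟦relabel⟧ π (A k) x) (h k)) , (λ h k → proj₂ (⟦relabel⟧ π (A k) x) (h k))

-- Each piece is replaced by its preimage under `x ↦ x ∘ π` and keeps its value; exchangeability
-- preserves the masses, so the approximating integrals do not change at all.
integral-permute : ∀ {n} (E : ExchangeableMeasure n) (π : Permutation′ n) →
  let open ExchangeableMeasure E in ∀ {f v} →
  HasIntegral measure f v → HasIntegral measure (λ x → f (x ∘ (π ⟨$⟩ʳ_))) v
integral-permute E π F ε 0<ε =
  let s , u , I , within , near = F ε 0<ε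
      σ = π ⟨$⟩ʳ_
      μ≈ = λ k → exchangeable π (relabel σ (piece s k)) (piece s k)
             λ x → mk⇔ (proj₁ (⟦relabel⟧ σ (piece s k) x)) (proj₂ (⟦relabel⟧ σ (piece s k) x))
      M , abs = absolutely I
  in record
       { piece    = λ k → relabel σ (piece s k)
       ; value    = value s
       ; disjoint = λ j k j≢k x h h′ → disjoint s j k j≢k (x ∘ σ) (proj₁ (⟦relabel⟧ σ (piece s j) x) h) (proj₁ (⟦relabel⟧ σ (piece s k) x) h′)
       ; cover    = λ x → let k , h = cover s (x ∘ σ) in k , proj₂ (⟦relabel⟧ σ (piece s k) x) h }
   , u
   , record
       { absolutely = M , SumsTo-cong (λ k → ∣x∣-cong (*-congˡ (value s k) (≈-sym (μ≈ k)))) ≈-refl abs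
       ; sums       = SumsTo-cong (λ k → *-congˡ (value s k) (≈-sym (μ≈ k))) ≈-refl (sums I) }
   , (λ k x h → within k (x ∘ σ) (proj₁ (⟦relabel⟧ σ (piece s k) x) h))
   , near
  where
  open ExchangeableMeasure E
  open SimpleFunction
  open HasSimpleIntegral

-- Finite sums

∑-cong : ∀ {A : Set} {f g : A → ℝ} as → (∀ a → f a ≈ g a) → ∑[ as ] f ≈ ∑[ as ] g
∑-cong []       h = ≈-refl
∑-cong (a ∷ as) h = +-cong (h a) (∑-cong as h)

∑-0 : ∀ {A : Set} {f : A → ℝ} as → (∀ a → f a ≈ 0ℝ) → ∑[ as ] f ≈ 0ℝ
∑-0 []       h = ≈-refl
∑-0 (a ∷ as) h = ≈-trans (+-cong (h a) (∑-0 as h)) (+-identityˡ 0ℝ)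

∑-++ : ∀ {A : Set} {f : A → ℝ} as bs → ∑[ as ++ bs ] f ≈ ∑[ as ] f + ∑[ bs ] f
∑-++ [] bs = ≈-sym (+-identityˡ _)
∑-++ {f = f} (a ∷ as) bs = ≈-trans (+-congˡ (f a) (∑-++ as bs))
  (solve 3 (λ a s t → a :+ (s :+ t) := a :+ s :+ t) ≈-refl (f a) (∑[ as ] f) (∑[ bs ] f))
  where open ℝ-Solver

∑-map : ∀ {A B : Set} {f : B → ℝ} (g : A → B) as → ∑[ map g as ] f ≈ ∑[ as ] (f ∘ g)
∑-map g []       = ≈-refl
∑-map g (a ∷ as) = +-congˡ _ (∑-map g as)

∑-*ˡ : ∀ {A : Set} {f : A → ℝ} c as → ∑[ as ] (λ a → c * f a) ≈ c * ∑[ as ] f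
∑-*ˡ c [] = ≈-sym (*-zeroʳ c)
∑-*ˡ {f = f} c (a ∷ as) = ≈-trans (+-congˡ (c * f a) (∑-*ˡ c as))
  (solve 3 (λ c a s → c :* a :+ c :* s := c :* (a :+ s)) ≈-refl c (f a) (∑[ as ] f))
  where open ℝ-Solver

∑-cartesianProductWith : ∀ {A B C : Set} {g : C → ℝ} (f : A → B → C) as bs →
  ∑[ List.cartesianProductWith f as bs ] g ≈ ∑[ as ] λ a → ∑[ bs ] λ b → g (f a b)
∑-cartesianProductWith f []       bs = ≈-refl
∑-cartesianProductWith f (a ∷ as) bs = ≈-trans (∑-++ (map (f a) bs) _)
  (+-cong (∑-map (f a) bs) (∑-cartesianProductWith f as bs))

∑ᶠ-cong : ∀ {n} {f g : Fin n → ℝ} → (∀ i → f i ≈ g i) → ∑ f ≈ ∑ g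
∑ᶠ-cong {zero}  h = ≈-refl
∑ᶠ-cong {suc n} h = +-cong (h zero) (∑ᶠ-cong (h ∘ suc))

∑ᶠ-0 : ∀ {n} {f : Fin n → ℝ} → (∀ i → f i ≈ 0ℝ) → ∑ f ≈ 0ℝ
∑ᶠ-0 {zero}  h = ≈-refl
∑ᶠ-0 {suc n} h = ≈-trans (+-cong (h zero) (∑ᶠ-0 (h ∘ suc))) (+-identityˡ 0ℝ)

∑ᶠ-neg : ∀ {n} (f : Fin n → ℝ) → ∑ (λ i → - f i) ≈ - ∑ f
∑ᶠ-neg {zero}  f = ≈-pointwise λ _ → refl
∑ᶠ-neg {suc n} f = ≈-trans (+-congˡ (- f zero) (∑ᶠ-neg (f ∘ suc)))
  (solve 2 (λ a b → (:- a) :+ (:- b) := :- (a :+ b)) ≈-refl (f zero) (∑ (f ∘ suc)))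
  where open ℝ-Solver

-- The canonical product is a harmonic multilinear polynomial

onePoly : ∀ {n} → Multilinear n
onePoly []            = 1ℝ
onePoly (inside  ∷ S) = 0ℝ
onePoly (outside ∷ S) = onePoly S

-- The expansion of the product: a monomial occurs when it contains exactly one variable of each of
-- the first `d` pairs and no variable beyond them, with one sign change for each second member
-- chosen.
canonicalPoly : ∀ {n} d → d ℕ.* 2 ℕ.≤ n → Multilinear n
canonicalPoly zero    _               S                       = onePoly S
canonicalPoly (suc d) (s≤s (s≤s le)) (inside  ∷ outside ∷ S) = canonicalPoly d le S
canonicalPoly (suc d) (s≤s (s≤s le)) (outside ∷ inside  ∷ S) = - canonicalPoly d le S
canonicalPoly (suc d) (s≤s (s≤s le)) (inside  ∷ inside  ∷ S) = 0ℝ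
canonicalPoly (suc d) (s≤s (s≤s le)) (outside ∷ outside ∷ S) = 0ℝ

if-0 : ∀ b → (if b then 0ℝ else 0ℝ) ≈ 0ℝ
if-0 true  = ≈-refl
if-0 false = ≈-refl

onePoly-∂ : ∀ {n} (i : Fin n) S → ∂ i onePoly S ≈ 0ℝ
onePoly-∂ zero    (inside  ∷ S) = ≈-refl
onePoly-∂ zero    (outside ∷ S) = ≈-refl
onePoly-∂ (suc i) (inside  ∷ S) = if-0 (does (i ∈ˢ? S))
onePoly-∂ (suc i) (outside ∷ S) = onePoly-∂ i S

-- The two derivatives of the leading factor `x₁ - x₂` are 1 and -1 and cancel; the derivatives in
-- the later variables sum to zero by induction.
canonicalPoly-harmonic : ∀ {n} d (le : d ℕ.* 2 ℕ.≤ n) → Harmonic (canonicalPoly d le)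
canonicalPoly-harmonic zero le S = ∑ᶠ-0 (λ i → onePoly-∂ i S)
canonicalPoly-harmonic {suc (suc n)} (suc d) (s≤s (s≤s le)) = harmonic
  where
  open ℝ-Solver
  P : Multilinear n
  P = canonicalPoly d le
  neg-if : ∀ b x → (if b then 0ℝ else (- x)) ≈ - (if b then 0ℝ else x)
  neg-if true  x = ≈-pointwise λ _ → refl
  neg-if false x = ≈-refl
  zero-plus : ∀ {x} → x ≈ 0ℝ → 0ℝ + (0ℝ + x) ≈ 0ℝ
  zero-plus {x} e = ≈-trans (solve 1 (λ x → con 0ℚ :+ (con 0ℚ :+ x) := x) ≈-refl x) e
  harmonic : Harmonic (canonicalPoly (suc d) (s≤s (s≤s le)))
  harmonic (inside ∷ inside ∷ S) = zero-plus (∑ᶠ-0 λ i → if-0 (does (i ∈ˢ? S)))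
  harmonic (inside ∷ outside ∷ S) = zero-plus (canonicalPoly-harmonic d le S)
  harmonic (outside ∷ inside ∷ S) = zero-plus (≈-trans (∑ᶠ-cong λ i → neg-if (does (i ∈ˢ? S)) (P (S ∪ ⁅ i ⁆)))
    (≈-trans (∑ᶠ-neg (λ i → ∂ i P S)) (≈-trans (neg-cong (canonicalPoly-harmonic d le S)) (≈-pointwise λ _ → refl))))
  harmonic (outside ∷ outside ∷ S) = ≈-trans
    (+-congˡ (P (S ∪ ⊥ˢ)) (+-congˡ (- P (S ∪ ⊥ˢ)) (∑ᶠ-0 λ i → if-0 (does (i ∈ˢ? S)))))
    (solve 1 (λ p → p :+ ((:- p) :+ con 0ℚ) := con 0ℚ) ≈-refl (P (S ∪ ⊥ˢ)))

∑-subsets : ∀ n (f : Subset (suc n) → ℝ) →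
  ∑[ subsets (suc n) ] f ≈ (∑[ subsets n ] λ S → f (inside ∷ S)) + (∑[ subsets n ] λ S → f (outside ∷ S))
∑-subsets n f = ≈-trans (∑-cartesianProductWith _∷_ (inside ∷ outside ∷ []) (subsets n))
  (+-congˡ (∑[ subsets n ] λ S → f (inside ∷ S)) (+-identityʳ _))

onePoly-eval : ∀ {n} (x : ℝ^ n) → eval onePoly x ≈ 1ℝ
onePoly-eval {zero} x = ≈-pointwise λ _ → refl
onePoly-eval {suc n} x = ≈-trans (∑-subsets n _) (≈-trans
  (+-cong (∑-0 (subsets n) λ S → *-zeroˡ _)
    (≈-trans (∑-cong (subsets n) λ S → *-congˡ (onePoly S) (*-identityˡ (monomial S (x ∘ suc)))) (onePoly-eval (x ∘ suc))))
  (+-identityˡ 1ℝ))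

canonicalPoly-eval : ∀ {n} d (le : d ℕ.* 2 ℕ.≤ n) x → eval (canonicalPoly d le) x ≈ χ-canonical d le x
canonicalPoly-eval zero le x = onePoly-eval x
canonicalPoly-eval {suc (suc n)} (suc d) (s≤s (s≤s le)) x = begin
  eval (canonicalPoly (suc d) (s≤s (s≤s le))) x
    ≈⟨ ∑-subsets (suc n) term ⟩
  ∑[ subsets (suc n) ] (λ S → term (inside ∷ S)) + ∑[ subsets (suc n) ] (λ S → term (outside ∷ S))
    ≈⟨ +-cong (∑-subsets n (λ S → term (inside ∷ S))) (∑-subsets n (λ S → term (outside ∷ S))) ⟩
  (∑[ subsets n ] (λ S → 0ℝ * (x 0F * (x 1F * mono S))) + ∑[ subsets n ] (λ S → P S * (x 0F * (1ℝ * mono S)))) +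
  (∑[ subsets n ] (λ S → - P S * (1ℝ * (x 1F * mono S))) + ∑[ subsets n ] (λ S → 0ℝ * (1ℝ * (1ℝ * mono S))))
    ≈⟨ +-cong
         (+-cong (∑-0 (subsets n) λ S → *-zeroˡ _)
           (≈-trans (∑-cong (subsets n) λ S → solve 3 (λ p a m → p :* (a :* (con 1ℚ :* m)) := a :* (p :* m)) ≈-refl (P S) (x 0F) (mono S))
             (∑-*ˡ (x 0F) (subsets n))))
         (+-cong
           (≈-trans (∑-cong (subsets n) λ S → solve 3 (λ p a m → (:- p) :* (con 1ℚ :* (a :* m)) := (:- a) :* (p :* m)) ≈-refl (P S) (x 1F) (mono S))
             (∑-*ˡ (- x 1F) (subsets n)))
           (∑-0 (subsets n) λ S → *-zeroˡ _)) ⟩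
  (0ℝ + x 0F * eval P x″) + (- x 1F * eval P x″ + 0ℝ)
    ≈⟨ solve 3 (λ a b e → (con 0ℚ :+ a :* e) :+ ((:- b) :* e :+ con 0ℚ) := (a :- b) :* e) ≈-refl (x 0F) (x 1F) (eval P x″) ⟩
  (x 0F - x 1F) * eval P x″
    ≈⟨ *-congˡ (x 0F - x 1F) (canonicalPoly-eval d le x″) ⟩
  χ-canonical (suc d) (s≤s (s≤s le)) x ∎
  where
  open ℝ-Solver
  open ≈-Reasoning
  P : Multilinear n
  P = canonicalPoly d le
  x″ : ℝ^ n
  x″ i = x (suc (suc i))
  mono : Subset n → ℝ
  mono S = monomial S x″
  term : Subset (suc (suc n)) → ℝ
  term S = canonicalPoly (suc d) (s≤s (s≤s le)) S * monomial S x

-- Integrability is given for harmonic multilinear polynomials in coefficient form, which is why χ_d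
-- was expanded. The integral of the square of χ_B is built from this one.
canonical-integrable : ∀ {n} (E : ExchangeableMeasure n) d (le : d ℕ.* 2 ℕ.≤ n) →
  Integrable (ExchangeableMeasure.measure E) (λ x → χ-canonical d le x * χ-canonical d le x)
canonical-integrable E d le =
  let v , I = integrable (canonicalPoly d le) (canonicalPoly d le) (canonicalPoly-harmonic d le) (canonicalPoly-harmonic d le)
  in v , Integration.integral-cong measure (λ x → *-cong (canonicalPoly-eval d le x) (canonicalPoly-eval d le x)) ≈-refl I
  where open ExchangeableMeasure E

-- The polynomial of a word

picks : ∀ {A : Set} → List A → List (A × List A)
picks []       = []
picks (a ∷ as) = (a , as) ∷ map (λ (b , bs) → b , a ∷ bs) (picks as)

∑-picks-∷ : ∀ {A : Set} {g : A × List A → ℝ} a as →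
  ∑[ picks (a ∷ as) ] g ≈ g (a , as) + ∑[ picks as ] λ (b , bs) → g (b , a ∷ bs)
∑-picks-∷ {g = g} a as = +-congˡ (g (a , as)) (∑-map (λ (b , bs) → b , a ∷ bs) (picks as))

∑-picks-↭ : ∀ {A : Set} {g : A × List A → ℝ} {as as′} →
  (∀ a {bs bs′} → bs ↭ bs′ → g (a , bs) ≈ g (a , bs′)) →
  as ↭ as′ → ∑[ picks as ] g ≈ ∑[ picks as′ ] g
∑-picks-↭ g-resp ↭.refl = ≈-refl
∑-picks-↭ g-resp (↭.trans ρ σ) = ≈-trans (∑-picks-↭ g-resp ρ) (∑-picks-↭ g-resp σ)
∑-picks-↭ {g = g} g-resp (↭.prep {as} {as′} a ρ) = begin
  ∑[ picks (a ∷ as) ] g                                        ≈⟨ ∑-picks-∷ a as ⟩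
  g (a , as) + ∑[ picks as ] (λ (b , bs) → g (b , a ∷ bs))     ≈⟨ +-cong (g-resp a ρ) (∑-picks-↭ (λ b σ → g-resp b (↭-prep a σ)) ρ) ⟩
  g (a , as′) + ∑[ picks as′ ] (λ (b , bs) → g (b , a ∷ bs))   ≈⟨ ∑-picks-∷ a as′ ⟨
  ∑[ picks (a ∷ as′) ] g                                       ∎
  where open ≈-Reasoning
∑-picks-↭ {g = g} g-resp (↭.swap {as} {as′} a b ρ) = begin
  ∑[ picks (a ∷ b ∷ as) ] g
    ≈⟨ ≈-trans (∑-picks-∷ a (b ∷ as)) (+-congˡ (g (a , b ∷ as)) (∑-picks-∷ b as)) ⟩
  g (a , b ∷ as) + (g (b , a ∷ as) + ∑[ picks as ] (λ (c , cs) → g (c , a ∷ b ∷ cs)))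
    ≈⟨ +-cong (g-resp a (↭-prep b ρ)) (+-cong (g-resp b (↭-prep a ρ))
         (≈-trans (∑-picks-↭ (λ c σ → g-resp c (↭-prep a (↭-prep b σ))) ρ) (∑-cong (picks as′) λ (c , cs) → g-resp c (↭-swap a b ↭-refl)))) ⟩
  g (a , b ∷ as′) + (g (b , a ∷ as′) + rest)
    ≈⟨ solve 3 (λ p q r → p :+ (q :+ r) := q :+ (p :+ r)) ≈-refl (g (a , b ∷ as′)) (g (b , a ∷ as′)) rest ⟩
  g (b , a ∷ as′) + (g (a , b ∷ as′) + rest)
    ≈⟨ ≈-trans (∑-picks-∷ b (a ∷ as′)) (+-congˡ (g (b , a ∷ as′)) (∑-picks-∷ a as′)) ⟨
  ∑[ picks (b ∷ a ∷ as′) ] g ∎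
  where
  open ℝ-Solver
  open ≈-Reasoning
  rest : ℝ
  rest = ∑[ picks as′ ] λ (c , cs) → g (c , b ∷ a ∷ cs)

picks-↭ : ∀ {A : Set} (as : List A) → All (λ (b , bs) → b ∷ bs ↭ as) (picks as)
picks-↭ []       = []
picks-↭ (a ∷ as) = ↭-refl ∷ All.map⁺ (All.map (λ {(b , bs)} ρ → ↭-trans (↭-swap b a ↭-refl) (↭-prep a ρ)) (picks-↭ as))

∑-congᴬ : ∀ {A : Set} {f g : A → ℝ} {as} → All (λ a → f a ≈ g a) as → ∑[ as ] f ≈ ∑[ as ] g
∑-congᴬ []       = ≈-refl
∑-congᴬ (h ∷ hs) = +-cong h (∑-congᴬ hs)

∑-+ : ∀ {A : Set} {f g : A → ℝ} as → ∑[ as ] (λ a → f a + g a) ≈ ∑[ as ] f + ∑[ as ] g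
∑-+ [] = ≈-sym (+-identityˡ 0ℝ)
∑-+ {f = f} {g} (a ∷ as) = ≈-trans (+-congˡ (f a + g a) (∑-+ as))
  (solve 4 (λ a b s t → a :+ b :+ (s :+ t) := a :+ s :+ (b :+ t)) ≈-refl (f a) (g a) (∑[ as ] f) (∑[ as ] g))
  where open ℝ-Solver

size : ∀ {A : Set} → List A → ℚ
size []       = 0ℚ
size (_ ∷ as) = 1ℚ ℚ.+ size as

∑-picks-const : ∀ {A : Set} c (as : List A) → ∑[ picks as ] (λ _ → c) ≈ fromℚ (size as) * c
∑-picks-const c [] = ≈-sym (*-zeroˡ c)
∑-picks-const c (a ∷ as) = ≈-trans (∑-picks-∷ a as) (≈-trans (+-congˡ c (∑-picks-const c as))
  (≈-trans (solve 2 (λ c s → c :+ s :* c := (con 1ℚ :+ s) :* c) ≈-refl c (fromℚ (size as)))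
    (*-congʳ c (≈-pointwise λ _ → refl))))
  where open ℝ-Solver

Word : Set → Set
Word I = List (Bool × I)

-- The word lists the variables in increasing order, marked true when they
-- belong to B; U holds the unmarked variables read but not yet used in A.
Φ : ∀ {I : Set} → (I → ℝ) → List I → Word I → ℝ
Φ x U []                = 1ℝ
Φ x U ((false , z) ∷ w) = Φ x (z ∷ U) w
Φ x U ((true  , y) ∷ w) = ∑[ picks U ] λ (u , us) → (x u - x y) * Φ x us w

module _ {I : Set} (x : I → ℝ) where

  Φ-↭ : ∀ w {U U′} → U ↭ U′ → Φ x U w ≈ Φ x U′ w
  Φ-↭ []                ρ = ≈-refl
  Φ-↭ ((false , z) ∷ w) ρ = Φ-↭ w (↭-prep z ρ)
  Φ-↭ ((true  , y) ∷ w) ρ = ∑-picks-↭ (λ u σ → *-congˡ (x u - x y) (Φ-↭ w σ)) ρ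

  -- Φ x (z ∷ U) w is affine in x z; this is linear interpolation at x u and x v.
  Φ-affine : ∀ w U u v y →
    (x v - x u) * Φ x (y ∷ U) w ≈ (x v - x y) * Φ x (u ∷ U) w + (x y - x u) * Φ x (v ∷ U) w
  Φ-affine [] U u v y = solve 3 (λ u v y → (v :- u) :* con 1ℚ := (v :- y) :* con 1ℚ :+ (y :- u) :* con 1ℚ) ≈-refl (x u) (x v) (x y)
    where open ℝ-Solver
  Φ-affine ((false , c) ∷ w) U u v y = begin
    (x v - x u) * Φ x (c ∷ y ∷ U) w
      ≈⟨ *-congˡ (x v - x u) (Φ-↭ w (↭-swap c y ↭-refl)) ⟩
    (x v - x u) * Φ x (y ∷ c ∷ U) w
      ≈⟨ Φ-affine w (c ∷ U) u v y ⟩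
    (x v - x y) * Φ x (u ∷ c ∷ U) w + (x y - x u) * Φ x (v ∷ c ∷ U) w
      ≈⟨ +-cong (*-congˡ (x v - x y) (Φ-↭ w (↭-swap u c ↭-refl))) (*-congˡ (x y - x u) (Φ-↭ w (↭-swap v c ↭-refl))) ⟩
    (x v - x y) * Φ x (c ∷ u ∷ U) w + (x y - x u) * Φ x (c ∷ v ∷ U) w ∎
    where open ≈-Reasoning
  -- Either the distinguished variable is paired with `c`, which gives a factor affine in it times
  -- `P`, where it does not occur in the list, or it stays unpaired and the induction hypothesis
  -- applies under the sum.
  Φ-affine ((true , c) ∷ w) U u v y = begin
    (x v - x u) * Φ x (y ∷ U) ((true , c) ∷ w)
      ≈⟨ *-congˡ (x v - x u) (∑-picks-∷ y U) ⟩
    (x v - x u) * ((x y - x c) * P + S y)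
      ≈⟨ solve 6 (λ u v y c p s → (v :- u) :* ((y :- c) :* p :+ s) := (v :- u) :* (y :- c) :* p :+ (v :- u) :* s) ≈-refl
           (x u) (x v) (x y) (x c) P (S y) ⟩
    (x v - x u) * (x y - x c) * P + (x v - x u) * S y
      ≈⟨ +-congˡ ((x v - x u) * (x y - x c) * P) sums ⟩
    (x v - x u) * (x y - x c) * P + ((x v - x y) * S u + (x y - x u) * S v)
      ≈⟨ solve 7 (λ u v y c p s t → (v :- u) :* (y :- c) :* p :+ ((v :- y) :* s :+ (y :- u) :* t)
                    := (v :- y) :* ((u :- c) :* p :+ s) :+ (y :- u) :* ((v :- c) :* p :+ t)) ≈-refl
           (x u) (x v) (x y) (x c) P (S u) (S v) ⟩
    (x v - x y) * ((x u - x c) * P + S u) + (x y - x u) * ((x v - x c) * P + S v)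
      ≈⟨ +-cong (*-congˡ (x v - x y) (∑-picks-∷ u U)) (*-congˡ (x y - x u) (∑-picks-∷ v U)) ⟨
    (x v - x y) * Φ x (u ∷ U) ((true , c) ∷ w) + (x y - x u) * Φ x (v ∷ U) ((true , c) ∷ w) ∎
    where
    open ℝ-Solver
    open ≈-Reasoning
    P : ℝ
    P = Φ x U w
    term : I → I × List I → ℝ
    term z (t , ts) = (x t - x c) * Φ x (z ∷ ts) w
    S : I → ℝ
    S z = ∑[ picks U ] (term z)
    sums : (x v - x u) * S y ≈ (x v - x y) * S u + (x y - x u) * S v
    sums = begin
      (x v - x u) * S y
        ≈⟨ ∑-*ˡ (x v - x u) (picks U) ⟨
      ∑[ picks U ] (λ a → (x v - x u) * term y a)
        ≈⟨ ∑-cong (picks U) (λ (t , ts) → ≈-trans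
             (solve 3 (λ d e f → d :* (e :* f) := e :* (d :* f)) ≈-refl (x v - x u) (x t - x c) (Φ x (y ∷ ts) w))
             (≈-trans (*-congˡ (x t - x c) (Φ-affine w ts u v y))
               (solve 5 (λ e d p f q → e :* (d :* p :+ f :* q) := d :* (e :* p) :+ f :* (e :* q)) ≈-refl
                 (x t - x c) (x v - x y) (Φ x (u ∷ ts) w) (x y - x u) (Φ x (v ∷ ts) w)))) ⟩
      ∑[ picks U ] (λ a → (x v - x y) * term u a + (x y - x u) * term v a)
        ≈⟨ ∑-+ (picks U) ⟩
      ∑[ picks U ] (λ a → (x v - x y) * term u a) + ∑[ picks U ] (λ a → (x y - x u) * term v a)
        ≈⟨ +-cong (∑-*ˡ (x v - x y) (picks U)) (∑-*ˡ (x y - x u) (picks U)) ⟩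
      (x v - x y) * S u + (x y - x u) * S v ∎

  -- If `y` is not paired with `u`, then `u` is still unpaired afterwards, exactly as if it had been
  -- read after `y`. This is `g = D + s`.
  Φ-pick : ∀ u U y w →
    Φ x (u ∷ U) ((true , y) ∷ w) ≈ (x u - x y) * Φ x U w + Φ x U ((true , y) ∷ (false , u) ∷ w)
  Φ-pick u U y w = ∑-picks-∷ u U

  -- When `u` is paired with `v`, the variable `y` joins the rest `vs`; interpolate in `y` at `u`
  -- and `v`. The value at `v` restores the full list `v ∷ vs`, a permutation of `U`, so its term
  -- does not depend on `v` and occurs `size U` times.
  Φ-exchange : ∀ u U y w →
    Φ x U ((true , u) ∷ (false , y) ∷ w) ≈
    Φ x U ((true , y) ∷ (false , u) ∷ w) + fromℚ (size U) * ((x y - x u) * Φ x U w)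
  Φ-exchange u U y w = begin
    ∑[ picks U ] (λ (v , vs) → (x v - x u) * Φ x (y ∷ vs) w)
      ≈⟨ ∑-congᴬ (All.map (λ {(v , vs)} ρ → ≈-trans (Φ-affine w vs u v y)
           (+-congˡ ((x v - x y) * Φ x (u ∷ vs) w) (*-congˡ (x y - x u) (Φ-↭ w ρ)))) (picks-↭ U)) ⟩
    ∑[ picks U ] (λ (v , vs) → (x v - x y) * Φ x (u ∷ vs) w + (x y - x u) * Φ x U w)
      ≈⟨ ∑-+ (picks U) ⟩
    ∑[ picks U ] (λ (v , vs) → (x v - x y) * Φ x (u ∷ vs) w) + ∑[ picks U ] (λ _ → (x y - x u) * Φ x U w)
      ≈⟨ +-congˡ (Φ x U ((true , y) ∷ (false , u) ∷ w)) (∑-picks-const ((x y - x u) * Φ x U w) U) ⟩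
    Φ x U ((true , y) ∷ (false , u) ∷ w) + fromℚ (size U) * ((x y - x u) * Φ x U w) ∎
    where open ≈-Reasoning

-- Pair products and the identity between squares

pairProduct : ∀ {I : Set} → (I → ℝ) → List (I × I) → ℝ
pairProduct x []            = 1ℝ
pairProduct x ((a , b) ∷ X) = (x a - x b) * pairProduct x X

private
  -- The solver treats `p` and `p⁻¹` as independent, so the two sides differ by an explicit multiple
  -- of `p⁻¹ p - 1`, which `e` then kills. The nesting and the factor 1 match two applications of
  -- the binary `integral-linear`.
  squares-identity : ∀ p p⁻¹ X u y φ s → p⁻¹ ℚ.* p ≡ 1ℚ →
    let g = X ℚ.* ((u ℚ.- y) ℚ.* φ ℚ.+ s)
        S = X ℚ.* s
        D = (u ℚ.- y) ℚ.* X ℚ.* φ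
        f = X ℚ.* (s ℚ.+ p ℚ.* ((y ℚ.- u) ℚ.* φ))
    in (1ℚ ℚ.+ p⁻¹) ℚ.* (S ℚ.* S) ℚ.+ 1ℚ ℚ.* ((1ℚ ℚ.+ p) ℚ.* (D ℚ.* D) ℚ.+ (ℚ.- p⁻¹) ℚ.* (f ℚ.* f)) ≡ g ℚ.* g
  squares-identity p p⁻¹ X u y φ s e = trans
    (solve 7 (λ p i X u y φ s →
      let d = u :- y ; g = X :* (d :* φ :+ s) ; S = X :* s ; D = d :* X :* φ ; f = X :* (s :+ p :* ((y :- u) :* φ)) in
      (con 1ℚ :+ i) :* (S :* S) :+ con 1ℚ :* ((con 1ℚ :+ p) :* (D :* D) :+ (:- i) :* (f :* f))
      := g :* g :+ (i :* p :- con 1ℚ) :* (X :* X :* (s :* (d :* φ) :+ s :* (d :* φ) :- p :* (d :* φ :* (d :* φ))))) refl p p⁻¹ X u y φ s)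
    (trans (cong (λ t → g ℚ.* g ℚ.+ (t ℚ.- 1ℚ) ℚ.* rest) e) (trans (cong (g ℚ.* g ℚ.+_) (ℚ.*-zeroˡ rest)) (ℚ.+-identityʳ (g ℚ.* g))))
    where
    open +-*-Solver
    d g rest : ℚ
    d = u ℚ.- y
    g = X ℚ.* (d ℚ.* φ ℚ.+ s)
    rest = X ℚ.* X ℚ.* (s ℚ.* (d ℚ.* φ) ℚ.+ s ℚ.* (d ℚ.* φ) ℚ.- p ℚ.* (d ℚ.* φ ℚ.* (d ℚ.* φ)))

square : ℝ → ℝ
square x = x * x

square-cong : x ≈ y → square x ≈ square y
square-cong e = *-cong e e

-- The products on the right are s, D and f in this order; the one on the left is g.
Φ-squares : ∀ {I : Set} (x : I → ℝ) X u U y w p⁻¹ → p⁻¹ ℚ.* size U ≡ 1ℚ →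
  square (pairProduct x X * Φ x (u ∷ U) ((true , y) ∷ w)) ≈
  fromℚ (1ℚ ℚ.+ p⁻¹) * square (pairProduct x X * Φ x U ((true , y) ∷ (false , u) ∷ w)) +
  fromℚ 1ℚ * (fromℚ (1ℚ ℚ.+ size U) * square (pairProduct x ((u , y) ∷ X) * Φ x U w) +
              fromℚ (ℚ.- p⁻¹) * square (pairProduct x X * Φ x U ((true , u) ∷ (false , y) ∷ w)))
Φ-squares x X u U y w p⁻¹ e = ≈-sym (begin
  fromℚ (1ℚ ℚ.+ p⁻¹) * square (Π * s) + fromℚ 1ℚ * (fromℚ (1ℚ ℚ.+ size U) * square ((x u - x y) * Π * φ) +
    fromℚ (ℚ.- p⁻¹) * square (Π * Φ x U ((true , u) ∷ (false , y) ∷ w)))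
    ≈⟨ +-congˡ (fromℚ (1ℚ ℚ.+ p⁻¹) * square (Π * s)) (*-congˡ (fromℚ 1ℚ) (+-congˡ (fromℚ (1ℚ ℚ.+ size U) * square ((x u - x y) * Π * φ))
         (*-congˡ (fromℚ (ℚ.- p⁻¹)) (square-cong (*-congˡ Π (Φ-exchange x u U y w)))))) ⟩
  fromℚ (1ℚ ℚ.+ p⁻¹) * square (Π * s) + fromℚ 1ℚ * (fromℚ (1ℚ ℚ.+ size U) * square ((x u - x y) * Π * φ) +
    fromℚ (ℚ.- p⁻¹) * square (Π * (s + fromℚ (size U) * ((x y - x u) * φ))))
    -- Termwise reasoning suffices: `p` and `p⁻¹` are rationals, constant along the sequences.
    ≈⟨ ≈-pointwise (λ n → squares-identity (size U) p⁻¹ (seq Π n) (seq (x u) n) (seq (x y) n) (seq φ n) (seq s n) e) ⟩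
  square (Π * ((x u - x y) * φ + s))
    ≈⟨ square-cong (*-congˡ Π (Φ-pick x u U y w)) ⟨
  square (Π * Φ x (u ∷ U) ((true , y) ∷ w)) ∎)
  where
  open ≈-Reasoning
  Π s φ : ℝ
  Π = pairProduct x X
  s = Φ x U ((true , y) ∷ (false , u) ∷ w)
  φ = Φ x U w

-- Exchangeability for functions of the list of all variables

transpose-i : ∀ {n} (i j : Fin n) → Components.transpose i j i ≡ j
transpose-i i j rewrite dec-true (i Fin.≟ i) refl = refl

transpose-j : ∀ {n} (i j : Fin n) → Components.transpose i j j ≡ i
transpose-j i j with j Fin.≟ i
... | yes j≡i = j≡i
... | no _ rewrite dec-true (j Fin.≟ j) refl = refl

transpose-k : ∀ {n} (i j k : Fin n) → k ≢ i → k ≢ j → Components.transpose i j k ≡ k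
transpose-k i j k k≢i k≢j rewrite dec-false (k Fin.≟ i) k≢i | dec-false (k Fin.≟ j) k≢j = refl

ʳ++-↭-++ : ∀ {A : Set} (as : List A) {bs} → as List.ʳ++ bs ↭ as ++ bs
ʳ++-↭-++ as {bs} = ↭-trans (↭.↭-reflexive (List.ʳ++-defn as)) (↭.++⁺ʳ bs (↭.↭-reverse as))

Unique-↭ : ∀ {n} {is js : List (Fin n)} → is ↭ js → Unique is → Unique js
Unique-↭ {n} ρ = Unique-resp-↭ (setoid (Fin n)) (↭⇒↭ₛ ρ)

module Shuffling {n} (E : ExchangeableMeasure n) (F : List ℝ → ℝ) {v : ℝ} where
  open ExchangeableMeasure E

  IntegralAt : List (Fin n) → Set
  IntegralAt is = HasIntegral measure (λ x → F (map x is)) v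

  map-fixed : ∀ (x : Fin n → ℝ) i j {ks} → All (i ≢_) ks → All (j ≢_) ks →
              map (x ∘ Components.transpose i j) ks ≡ map x ks
  map-fixed x i j [] [] = refl
  map-fixed x i j (i≢k ∷ hs) (j≢k ∷ hs′) =
    cong₂ _∷_ (cong x (transpose-k i j _ (i≢k ∘ sym) (j≢k ∘ sym))) (map-fixed x i j hs hs′)

  -- The list enumerates the variables without repetition, so the transposition of `i` and `j` moves
  -- just these two entries.
  swap-integral : ∀ is i j ks → is List.ʳ++ (i ∷ j ∷ ks) ↭ allFin n →
                  IntegralAt (is List.ʳ++ (i ∷ j ∷ ks)) → IntegralAt (is List.ʳ++ (j ∷ i ∷ ks))
  swap-integral is i j ks ρ I = integral-cong
    (λ x → ≈-reflexive (cong F (trans (List.map-ʳ++ (x ∘ Components.transpose i j) is)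
      (trans (cong₂ (λ as bs → as List.ʳ++ bs) (map-fixed x i j (All.++⁻ˡ is i≢) (All.++⁻ˡ is j≢))
        (cong₂ _∷_ (cong x (transpose-i i j)) (cong₂ _∷_ (cong x (transpose-j i j)) (map-fixed x i j (All.++⁻ʳ is i≢) (All.++⁻ʳ is j≢)))))
        (sym (List.map-ʳ++ x is))))))
    ≈-refl
    (integral-permute E (Perm.transpose i j) I)
    where
    open Integration measure
    front : is List.ʳ++ (i ∷ j ∷ ks) ↭ i ∷ j ∷ is ++ ks
    front = ↭-trans (ʳ++-↭-++ is) (↭-trans (↭.shift i is (j ∷ ks)) (↭-prep i (↭.shift j is ks)))
    unique : Unique (i ∷ j ∷ is ++ ks)
    unique = Unique-↭ (↭-trans (↭-sym ρ) front) (allFin⁺ n)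
    i≢ : All (i ≢_) (is ++ ks)
    i≢ with (_ ∷ h) ∷ _ ← unique = h
    j≢ : All (j ≢_) (is ++ ks)
    j≢ with _ ∷ h ∷ _ ← unique = h

  -- The entries already passed are kept reversed in `is`, so that the recursion on the permutation
  -- can go below `prep` and `swap` while the whole list stays in view; each `swap` is one
  -- transposition of variables.
  shuffle : ∀ is {js ks} → js ↭ ks → is List.ʳ++ js ↭ allFin n →
            IntegralAt (is List.ʳ++ js) → IntegralAt (is List.ʳ++ ks)
  shuffle is ↭.refl        ρ I = I
  shuffle is (↭.prep i σ)  ρ I = shuffle (i ∷ is) σ ρ I
  shuffle is (↭.swap i j σ) ρ I = shuffle (i ∷ j ∷ is) σ
    (↭-trans (↭-trans (ʳ++-↭-++ is) (↭-trans (↭.++⁺ˡ is (↭-swap j i ↭-refl)) (↭-sym (ʳ++-↭-++ is)))) ρ)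
    (swap-integral is i j _ ρ I)
  shuffle is (↭.trans σ τ) ρ I = shuffle is τ
    (↭-trans (↭-trans (ʳ++-↭-++ is) (↭-trans (↭.++⁺ˡ is (↭-sym σ)) (↭-sym (ʳ++-↭-++ is)))) ρ)
    (shuffle is σ ρ I)

-- Junk value 0 on lists too short to contain d pairs.
leadingPairs : ℕ → List ℝ → ℝ
leadingPairs zero    _           = 1ℝ
leadingPairs (suc d) []          = 0ℝ
leadingPairs (suc d) (a ∷ [])    = 0ℝ
leadingPairs (suc d) (a ∷ b ∷ l) = (a - b) * leadingPairs d l

leadingPairs-canonical : ∀ {n} d (le : d ℕ.* 2 ℕ.≤ n) x → leadingPairs d (List.tabulate x) ≡ χ-canonical d le x
leadingPairs-canonical zero le x = refl
leadingPairs-canonical (suc d) (s≤s (s≤s le)) x =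
  cong ((x zero - x (suc zero)) *_) (leadingPairs-canonical d le (λ i → x (suc (suc i))))

flatten : ∀ {A : Set} → List (A × A) → List A
flatten []            = []
flatten ((a , b) ∷ X) = a ∷ b ∷ flatten X

leadingPairs-flatten : ∀ {I : Set} (x : I → ℝ) X R → leadingPairs (length X) (map x (flatten X ++ R)) ≡ pairProduct x X
leadingPairs-flatten x []            R = refl
leadingPairs-flatten x ((a , b) ∷ X) R = cong ((x a - x b) *_) (leadingPairs-flatten x X R)

-- Norms of the polynomials of words

-- `u` counts the unpaired variables; a marked letter contributes the triangular number u(u + 1)/2
-- and consumes one of them. Over ℚ the step to `u - 1` is always defined, and at `u = 0` the factor
-- vanishes, like the empty sum in `Φ`.
weight : ∀ {I : Set} → ℚ → Word I → ℚ
weight u []                = 1ℚ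
weight u ((false , _) ∷ w) = weight (1ℚ ℚ.+ u) w
weight u ((true  , _) ∷ w) = ½ ℚ.* (u ℚ.* (1ℚ ℚ.+ u)) ℚ.* weight (u ℚ.- 1ℚ) w

marked : ∀ {I : Set} → Word I → ℕ
marked []                = 0
marked ((false , _) ∷ w) = marked w
marked ((true  , _) ∷ w) = suc (marked w)

letters : ∀ {I : Set} → Word I → List I
letters = map proj₂

size-nonNeg : ∀ {A : Set} (as : List A) → 0ℚ ℚ.≤ size as
size-nonNeg []       = ℚ.≤-refl
size-nonNeg (a ∷ as) = ℚ.≤-trans (ℚ.≤-trans (size-nonNeg as) (ℚ.≤-reflexive (sym (ℚ.+-identityˡ (size as)))))
  (ℚ.+-monoˡ-≤ (size as) (ℚ.<⇒≤ (ℚ.positive⁻¹ 1ℚ)))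

size-invertible : ∀ {A : Set} (a : A) as → ∃[ p⁻¹ ] p⁻¹ ℚ.* size (a ∷ as) ≡ 1ℚ
size-invertible a as = ℚ.1/_ (size (a ∷ as)) {{nonZero}} , ℚ.*-inverseˡ (size (a ∷ as)) {{nonZero}}
  where
  nonZero : ℚ.NonZero (size (a ∷ as))
  nonZero = ℚ.pos⇒nonZero (size (a ∷ as)) {{ℚ.pos+nonNeg⇒pos 1ℚ (size as) {{ℚ.nonNegative (size-nonNeg as)}}}}

module Norms {n} (E : ExchangeableMeasure n) d (le : d ℕ.* 2 ℕ.≤ n) {v : ℝ}
             (canonical : HasSquaredNorm (ExchangeableMeasure.measure E) (χ-canonical d le) v) where
  open ExchangeableMeasure E
  open Integration measure

  HasNorm : List (Fin n × Fin n) → List (Fin n) → Word (Fin n) → Set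
  HasNorm X U w = HasIntegral measure (λ x → square (pairProduct x X * Φ x U w)) (fromℚ (weight (size U) w) * v)

  Exhausts : List (Fin n × Fin n) → List (Fin n) → Word (Fin n) → Set
  Exhausts X U w = flatten X ++ (U ++ letters w) ↭ allFin n

  -- Both products are the leading `d` differences of a list of all variables, one in the natural
  -- order and one in the order `flatten X ++ U`; exchangeability moves the integral between the
  -- orders.
  pairs-norm : ∀ X U → length X ≡ d → Exhausts X U [] → HasNorm X U []
  pairs-norm X U refl ρ = integral-cong
    (λ x → square-cong (≈-trans (≈-reflexive (leadingPairs-flatten x X (U ++ []))) (≈-pointwise λ m → sym (ℚ.*-identityʳ _))))
    (≈-sym (*-identityˡ v))
    (shuffle [] (↭-sym ρ) ↭-refl (integral-cong
      (λ x → square-cong (≈-reflexive (sym (trans (cong (leadingPairs (length X)) (List.map-tabulate id x)) (leadingPairs-canonical (length X) le x)))))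
      ≈-refl canonical))
    where open Shuffling E (λ l → square (leadingPairs (length X) l))

  private
    -- The words of `s` and `f` carry equal weights, so the terms with `p⁻¹` cancel. What remains is
    -- that consecutive triangular numbers differ by `p + 1`.
    weights-identity : ∀ p p⁻¹ W v →
      (1ℚ ℚ.+ p⁻¹) ℚ.* (½ ℚ.* (p ℚ.* (1ℚ ℚ.+ p)) ℚ.* W ℚ.* v) ℚ.+
      1ℚ ℚ.* ((1ℚ ℚ.+ p) ℚ.* (W ℚ.* v) ℚ.+ (ℚ.- p⁻¹) ℚ.* (½ ℚ.* (p ℚ.* (1ℚ ℚ.+ p)) ℚ.* W ℚ.* v)) ≡
      ½ ℚ.* ((1ℚ ℚ.+ p) ℚ.* (1ℚ ℚ.+ (1ℚ ℚ.+ p))) ℚ.* W ℚ.* v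
    weights-identity = solve 4 (λ p i W v →
      (con 1ℚ :+ i) :* (con ½ :* (p :* (con 1ℚ :+ p)) :* W :* v) :+
      con 1ℚ :* ((con 1ℚ :+ p) :* (W :* v) :+ (:- i) :* (con ½ :* (p :* (con 1ℚ :+ p)) :* W :* v)) :=
      con ½ :* ((con 1ℚ :+ p) :* (con 1ℚ :+ (con 1ℚ :+ p))) :* W :* v) refl
      where open +-*-Solver

    1+[p-1] : ∀ p → 1ℚ ℚ.+ (p ℚ.- 1ℚ) ≡ p
    1+[p-1] = solve 1 (λ p → con 1ℚ :+ (p :- con 1ℚ) := p) refl
      where open +-*-Solver

    [1+p]-1 : ∀ p → (1ℚ ℚ.+ p) ℚ.- 1ℚ ≡ p
    [1+p]-1 = solve 1 (λ p → (con 1ℚ :+ p) :- con 1ℚ := p) refl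
      where open +-*-Solver

    exhausts-exchange : ∀ X u U y w → Exhausts X (u ∷ U) ((true , y) ∷ w) →
                        Exhausts X U ((true , y) ∷ (false , u) ∷ w) × Exhausts X U ((true , u) ∷ (false , y) ∷ w)
    exhausts-exchange X u U y w ρ =
        ↭-trans (↭.++⁺ˡ (flatten X) (↭-trans (↭.++⁺ˡ U (↭-swap y u ↭-refl)) (↭.shift u U (y ∷ letters w)))) ρ
      , ↭-trans (↭.++⁺ˡ (flatten X) (↭.shift u U (y ∷ letters w))) ρ

    exhausts-pair : ∀ X u U y w → Exhausts X (u ∷ U) ((true , y) ∷ w) → Exhausts ((u , y) ∷ X) U w
    exhausts-pair X u U y w ρ = ↭-trans (↭-sym
      (↭-trans (↭.++⁺ˡ (flatten X) (↭-prep u (↭.shift y U (letters w))))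
        (↭-trans (↭.shift u (flatten X) (y ∷ U ++ letters w)) (↭-prep u (↭.shift y (flatten X) (U ++ letters w)))))) ρ

  NormFormula : ℕ → Set
  NormFormula k = ∀ w → marked w ≡ k → ∀ X U → length X ℕ.+ k ≡ d → Exhausts X U w → HasNorm X U w

  -- Recursion on `U` inside the induction on the number of marked letters: the words of `s` and `f`
  -- keep that number but have one unpaired variable fewer, whereas `D` has one marked letter fewer
  -- and is covered by `ih`.
  marked-norm : ∀ {k} → NormFormula k → ∀ U w → marked w ≡ k → ∀ X y → length X ℕ.+ suc k ≡ d →
                Exhausts X U ((true , y) ∷ w) → HasNorm X U ((true , y) ∷ w)
  -- With no variable to pair, the polynomial and the weight both vanish. The integral of zero is
  -- obtained as the combination of known integrals with coefficients 0.
  marked-norm ih [] w _ X y _ _ = integral-cong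
    (λ x → ≈-pointwise λ m → solve 2 (λ c p → con 0ℚ :* c :+ con 0ℚ :* c := (p :* con 0ℚ) :* (p :* con 0ℚ)) refl
      (seq (square (χ-canonical d le x)) m) (seq (pairProduct x X) m))
    (≈-pointwise λ m → solve 2 (λ W v → con 0ℚ :* v :+ con 0ℚ :* v := con ½ :* (con 0ℚ :* (con 1ℚ :+ con 0ℚ)) :* W :* v) refl
      (weight (0ℚ ℚ.- 1ℚ) w) (seq v m))
    (integral-linear 0ℚ 0ℚ canonical canonical)
    where open +-*-Solver
  -- The case `p = 0`: the only partner of `y` is `u`, and the factor of the weight is ½ · 1 · 2 =
  -- 1.
  marked-norm {k} ih (u ∷ []) w eq X y len ρ = integral-cong
    (λ x → square-cong (≈-trans
      (solve 4 (λ u y p φ → (u :- y) :* p :* φ := p :* ((u :- y) :* φ :+ con 0ℚ)) ≈-refl (x u) (x y) (pairProduct x X) (Φ x [] w))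
      (*-congˡ (pairProduct x X) (≈-sym (Φ-pick x u [] y w)))))
    (*-congʳ v (≈-pointwise λ _ → sym (ℚ.*-identityˡ (weight 0ℚ w))))
    (ih w eq ((u , y) ∷ X) [] (trans (sym (ℕ.+-suc (length X) k)) len) (exhausts-pair X u [] y w ρ))
    where open ℝ-Solver
  marked-norm {k} ih (u ∷ U@(t ∷ ts)) w eq X y len ρ = integral-cong
    (λ x → ≈-sym (Φ-squares x X u U y w N⁻¹ inverse))
    -- In the words of `s` and `f` the list loses one variable and regains one, giving
    -- `1 + (N - 1)`; in the goal it has `1 + N` variables and loses one. Both counts are `N`.
    (≈-pointwise λ m → trans
      (cong (λ W → (1ℚ ℚ.+ N⁻¹) ℚ.* (½ ℚ.* (N ℚ.* (1ℚ ℚ.+ N)) ℚ.* W ℚ.* seq v m) ℚ.+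
        1ℚ ℚ.* ((1ℚ ℚ.+ N) ℚ.* (weight N w ℚ.* seq v m) ℚ.+ (ℚ.- N⁻¹) ℚ.* (½ ℚ.* (N ℚ.* (1ℚ ℚ.+ N)) ℚ.* W ℚ.* seq v m)))
        (cong (λ q → weight q w) (1+[p-1] N)))
      (trans (weights-identity N N⁻¹ (weight N w) (seq v m))
        (cong (λ q → ½ ℚ.* ((1ℚ ℚ.+ N) ℚ.* (1ℚ ℚ.+ (1ℚ ℚ.+ N))) ℚ.* weight q w ℚ.* seq v m) (sym ([1+p]-1 N)))))
    (integral-linear (1ℚ ℚ.+ N⁻¹) 1ℚ
      (marked-norm ih U ((false , u) ∷ w) eq X y len (proj₁ (exhausts-exchange X u U y w ρ)))
      (integral-linear (1ℚ ℚ.+ N) (ℚ.- N⁻¹)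
        (ih w eq ((u , y) ∷ X) U (trans (sym (ℕ.+-suc (length X) k)) len) (exhausts-pair X u U y w ρ))
        (marked-norm ih U ((false , y) ∷ w) eq X u len (proj₂ (exhausts-exchange X u U y w ρ)))))
    where
    N N⁻¹ : ℚ
    N = size U
    N⁻¹ = proj₁ (size-invertible t ts)
    inverse : N⁻¹ ℚ.* N ≡ 1ℚ
    inverse = proj₂ (size-invertible t ts)

  norm-formula : ∀ k → NormFormula k
  norm-formula zero [] _ X U len ρ = pairs-norm X U (trans (sym (ℕ.+-identityʳ (length X))) len) ρ
  norm-formula k ((false , z) ∷ w) eq X U len ρ = norm-formula k w eq X (z ∷ U) len
    (↭-trans (↭.++⁺ˡ (flatten X) (↭-sym (↭.shift z U (letters w)))) ρ)
  norm-formula (suc k) ((true , y) ∷ w) eq X U len ρ =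
    marked-norm (norm-formula k) U w (ℕ.suc-injective eq) X y len ρ

-- The word of a top set

data Spells {n : ℕ} : ∀ {d} → Vec (Fin n) d → Word (Fin n) → Set where
  done : Spells [] []
  skip : ∀ {d} {B : Vec (Fin n) d} {w} c → Spells B w → Spells B ((false , c) ∷ w)
  take : ∀ {d} {B : Vec (Fin n) d} {w} c → Spells B w → Spells (c ∷ B) ((true , c) ∷ w)

Consecutive : ∀ {n} → ℕ → List (Fin n) → Set
Consecutive k []       = ⊤
Consecutive k (c ∷ cs) = toℕ c ≡ k × Consecutive (suc k) cs

tabulate-consecutive : ∀ {m n} k (f : Fin m → Fin n) → (∀ i → toℕ (f i) ≡ k ℕ.+ toℕ i) → Consecutive k (List.tabulate f)
tabulate-consecutive {zero}  k f h = tt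
tabulate-consecutive {suc m} k f h = trans (h zero) (ℕ.+-identityʳ k)
  , tabulate-consecutive (suc k) (f ∘ suc) (λ i → trans (h (suc i)) (ℕ.+-suc k (toℕ i)))

consecutive-≥ : ∀ {n} k (cs : List (Fin n)) → Consecutive k cs → All (λ c → k ℕ.≤ toℕ c) cs
consecutive-≥ k []       _       = []
consecutive-≥ k (c ∷ cs) (e , h) = ℕ.≤-reflexive (sym e) ∷ All.map ℕ.<⇒≤ (consecutive-≥ (suc k) cs h)

-- Both lists increase and no element of `B` is below `k`, so the current letter is either the head
-- of `B` or absent from it. The letters run out only at `n`, when nothing of `B` can be left.
spell : ∀ {n d} k (cs : List (Fin n)) → Consecutive k cs → k ℕ.+ length cs ≡ n →
        (B : Vec (Fin n) d) → AllPairs Fin._<_ B → VAll.All (λ b → k ℕ.≤ toℕ b) B →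
        ∃[ w ] letters w ≡ cs × Spells B w
spell k [] _ e [] _ _ = [] , refl , done
spell k [] _ e (b ∷ B) _ (k≤b ∷ _) =
  ⊥-elim (ℕ.<-irrefl refl (ℕ.<-≤-trans (Fin.toℕ<n b) (ℕ.≤-trans (ℕ.≤-reflexive (trans (sym e) (ℕ.+-identityʳ k))) k≤b)))
spell k (c ∷ cs) (_ , h) e [] _ _ =
  let w , lw , s = spell (suc k) cs h (trans (sym (ℕ.+-suc k (length cs))) e) [] [] []
  in (false , c) ∷ w , cong (c ∷_) lw , skip c s
spell k (c ∷ cs) (c≡k , h) e (b ∷ B) (b< ∷ inc) (k≤b ∷ _) with c Fin.≟ b
... | yes refl =
  let w , lw , s = spell (suc k) cs h (trans (sym (ℕ.+-suc k (length cs))) e) B inc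
                     (VAll.map (λ {i} b<i → subst (ℕ._< toℕ i) c≡k b<i) b<)
  in (true , c) ∷ w , cong (c ∷_) lw , take c s
... | no c≢b =
  let k<b = ℕ.≤∧≢⇒< k≤b (λ k≡b → c≢b (Fin.toℕ-injective (trans c≡k k≡b)))
      w , lw , s = spell (suc k) cs h (trans (sym (ℕ.+-suc k (length cs))) e) (b ∷ B) (b< ∷ inc)
                     (k<b ∷ VAll.map (λ b<i → ℕ.<-trans k<b b<i) b<)
  in (false , c) ∷ w , cong (c ∷_) lw , skip c s

spells-marked : ∀ {n d} {B : Vec (Fin n) d} {w} → Spells B w → marked w ≡ d
spells-marked done       = refl
spells-marked (skip c s) = spells-marked s
spells-marked (take c s) = cong suc (spells-marked s)

-- The coefficient

fromℤ : ℤ.ℤ → ℚ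
fromℤ i = i ℚ./ 1

-- Rationals are normalised by a gcd that blocks computation, so arithmetic of fractions is compared
-- in unnormalised form.
toℚᵘ-fromℤ : ∀ i → ℚ.toℚᵘ (fromℤ i) ℚᵘ.≃ ℚᵘ.mkℚᵘ i 0
toℚᵘ-fromℤ i = ℚ.toℚᵘ-fromℚᵘ (ℚᵘ.mkℚᵘ i 0)

fromℤ-+ : ∀ i j → fromℤ (i ℤ.+ j) ≡ fromℤ i ℚ.+ fromℤ j
fromℤ-+ i j = ℚ.toℚᵘ-injective (begin-equality
  ℚ.toℚᵘ (fromℤ (i ℤ.+ j))                       ≃⟨ toℚᵘ-fromℤ (i ℤ.+ j) ⟩
  ℚᵘ.mkℚᵘ (i ℤ.+ j) 0                            ≡⟨ cong (λ k → ℚᵘ.mkℚᵘ k 0) (cong₂ ℤ._+_ (ℤ.*-identityʳ i) (ℤ.*-identityʳ j)) ⟨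
  ℚᵘ.mkℚᵘ i 0 ℚᵘ.+ ℚᵘ.mkℚᵘ j 0                   ≃⟨ ℚᵘ.+-cong (toℚᵘ-fromℤ i) (toℚᵘ-fromℤ j) ⟨
  ℚ.toℚᵘ (fromℤ i) ℚᵘ.+ ℚ.toℚᵘ (fromℤ j)         ≃⟨ ℚ.toℚᵘ-homo-+ (fromℤ i) (fromℤ j) ⟨
  ℚ.toℚᵘ (fromℤ i ℚ.+ fromℤ j)                   ∎)
  where open ℚᵘ.≤-Reasoning

fromℤ-* : ∀ i j → fromℤ (i ℤ.* j) ≡ fromℤ i ℚ.* fromℤ j
fromℤ-* i j = ℚ.toℚᵘ-injective (begin-equality
  ℚ.toℚᵘ (fromℤ (i ℤ.* j))                       ≃⟨ toℚᵘ-fromℤ (i ℤ.* j) ⟩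
  ℚᵘ.mkℚᵘ i 0 ℚᵘ.* ℚᵘ.mkℚᵘ j 0                   ≃⟨ ℚᵘ.*-cong (toℚᵘ-fromℤ i) (toℚᵘ-fromℤ j) ⟨
  ℚ.toℚᵘ (fromℤ i) ℚᵘ.* ℚ.toℚᵘ (fromℤ j)         ≃⟨ ℚ.toℚᵘ-homo-* (fromℤ i) (fromℤ j) ⟨
  ℚ.toℚᵘ (fromℤ i ℚ.* fromℤ j)                   ∎)
  where open ℚᵘ.≤-Reasoning

/2≡½* : ∀ i → i ℚ./ 2 ≡ ½ ℚ.* fromℤ i
/2≡½* i = ℚ.toℚᵘ-injective (begin-equality
  ℚ.toℚᵘ (i ℚ./ 2)                               ≃⟨ ℚ.toℚᵘ-fromℚᵘ (ℚᵘ.mkℚᵘ i 1) ⟩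
  ℚᵘ.mkℚᵘ i 1                                    ≡⟨ cong (λ k → ℚᵘ.mkℚᵘ k 1) (ℤ.*-identityˡ i) ⟨
  ℚ.toℚᵘ ½ ℚᵘ.* ℚᵘ.mkℚᵘ i 0                      ≃⟨ ℚᵘ.*-cong (ℚᵘ.≃-refl {ℚ.toℚᵘ ½}) (toℚᵘ-fromℤ i) ⟨
  ℚ.toℚᵘ ½ ℚᵘ.* ℚ.toℚᵘ (fromℤ i)                 ≃⟨ ℚ.toℚᵘ-homo-* ½ (fromℤ i) ⟨
  ℚ.toℚᵘ (½ ℚ.* fromℤ i)                         ∎)
  where open ℚᵘ.≤-Reasoning

factor : ℕ → ℕ → ℚ
factor b j = let m = + suc b ℤ.- + (2 ℕ.* j) in (m ℤ.* (m ℤ.- + 1)) ℚ./ 2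

-- The product in `c` with its index started at `j`, which makes it recursive along `B` and
-- comparable with `weight`.
coefficientFrom : ∀ {n d} → ℕ → Vec (Fin n) d → ℚ
coefficientFrom j []      = 1ℚ
coefficientFrom j (b ∷ B) = factor (toℕ b) j ℚ.* coefficientFrom (suc j) B

foldr-cong : ∀ {d} {f g : Fin d → ℚ} → (∀ i → f i ≡ g i) → Vector.foldr ℚ._*_ 1ℚ f ≡ Vector.foldr ℚ._*_ 1ℚ g
foldr-cong {zero}  h = refl
foldr-cong {suc d} h = cong₂ ℚ._*_ (h zero) (foldr-cong (h ∘ suc))

coefficientFrom-foldr : ∀ {n d} j (B : Vec (Fin n) d) →
  coefficientFrom j B ≡ Vector.foldr ℚ._*_ 1ℚ (λ i → factor (toℕ (lookup B i)) (j ℕ.+ toℕ i))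
coefficientFrom-foldr j []      = refl
coefficientFrom-foldr j (b ∷ B) = cong₂ ℚ._*_ (cong (factor (toℕ b)) (sym (ℕ.+-identityʳ j)))
  (trans (coefficientFrom-foldr (suc j) B) (foldr-cong λ i → cong (factor (toℕ (lookup B i))) (sym (ℕ.+-suc j (toℕ i)))))

-- Of the k variables read, j are marked and j others are paired with these.
unused : ℕ → ℕ → ℤ.ℤ
unused k j = + k ℤ.- + (2 ℕ.* j)

unused-skip : ∀ k j → 1ℚ ℚ.+ fromℤ (unused k j) ≡ fromℤ (unused (suc k) j)
unused-skip k j = trans (sym (fromℤ-+ (+ 1) (unused k j))) (cong fromℤ (sym (ℤ.+-assoc (+ 1) (+ k) (ℤ.- + (2 ℕ.* j)))))

unused-take : ∀ k j → fromℤ (unused k j) ℚ.- 1ℚ ≡ fromℤ (unused (suc k) (suc j))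
unused-take k j = trans (sym (fromℤ-+ (unused k j) (ℤ.- + 1))) (cong fromℤ
  (trans (cong (λ i → + k ℤ.- i ℤ.- + 1) (ℤ.pos-* 2 j))
    (trans (solve 2 (λ k j → k :- con (+ 2) :* j :- con (+ 1) := con (+ 1) :+ k :- con (+ 2) :* (con (+ 1) :+ j)) refl (+ k) (+ j))
      (cong (λ i → + suc k ℤ.- i) (sym (ℤ.pos-* 2 (suc j)))))))
  where open ℤSolver.+-*-Solver

-- The element with 0-based value `k` is numbered `k + 1`, so the quantity `m` in the coefficient is
-- one more than the number of unpaired variables, and m(m - 1)/2 is the triangular number of the
-- weight.
factor-unused : ∀ k j → ½ ℚ.* (fromℤ (unused k j) ℚ.* (1ℚ ℚ.+ fromℤ (unused k j))) ≡ factor k j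
factor-unused k j = sym (trans (/2≡½* (M ℤ.* (M ℤ.- + 1))) (cong (½ ℚ.*_) (trans (fromℤ-* M (M ℤ.- + 1))
  (trans (cong₂ ℚ._*_ (sym (unused-skip k j)) (cong fromℤ M-1)) (ℚ.*-comm (1ℚ ℚ.+ fromℤ (unused k j)) (fromℤ (unused k j)))))))
  where
  open ℤSolver.+-*-Solver
  M : ℤ.ℤ
  M = + suc k ℤ.- + (2 ℕ.* j)
  M-1 : M ℤ.- + 1 ≡ unused k j
  M-1 = solve 2 (λ k j → (con (+ 1) :+ k) :- j :- con (+ 1) := k :- j) refl (+ k) (+ (2 ℕ.* j))

weight-spells : ∀ {n d} {B : Vec (Fin n) d} {w} → Spells B w → ∀ k j → Consecutive k (letters w) →
                weight (fromℤ (unused k j)) w ≡ coefficientFrom j B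
weight-spells done k j _ = refl
weight-spells (skip {w = w} c s) k j (_ , h) =
  trans (cong (λ u → weight u w) (unused-skip k j)) (weight-spells s (suc k) j h)
weight-spells (take {w = w} c s) k j (refl , h) = cong₂ ℚ._*_ (factor-unused k j)
  (trans (cong (λ u → weight u w) (unused-take k j)) (weight-spells s (suc k) (suc j) h))

weight≡c : ∀ {n d} {B : Vec (Fin n) d} {w} → Spells B w → Consecutive 0 (letters w) → weight 0ℚ w ≡ c B
weight≡c {B = B} s h = trans (weight-spells s 0 0 h) (coefficientFrom-foldr 0 B)

-- χ as the polynomial of a word

_∖_ : ∀ {n} → (Fin n → Bool) → Fin n → Fin n → Bool
(allowed ∖ a) b = allowed b ∧ not (does (b Fin.≟ a))

∖-other : ∀ {n} (allowed : Fin n → Bool) {a b} → b ≢ a → (allowed ∖ a) b ≡ allowed b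
∖-other allowed {a} {b} b≢a rewrite dec-false (b Fin.≟ a) b≢a = Bool.∧-identityʳ (allowed b)

∖-self : ∀ {n} (allowed : Fin n → Bool) a → (allowed ∖ a) a ≡ false
∖-self allowed a rewrite dec-true (a Fin.≟ a) refl = Bool.∧-zeroʳ (allowed a)

-- Distinctness and disjointness become one test per entry: a chosen `a` is struck from the allowed
-- set. In this form the sum over `A` splits off its first entry.
admissible : ∀ {n d} → (Fin n → Bool) → Vec (Fin n) d → Vec (Fin n) d → Bool
admissible allowed []      []      = true
admissible allowed (a ∷ A) (b ∷ B) = (allowed a ∧ does (a Fin.<? b)) ∧ admissible (allowed ∖ a) A B

Admissible : ∀ {n d} → (Fin n → Bool) → Vec (Fin n) d → Vec (Fin n) d → Set
Admissible allowed A B = VUnique A × VAll.All (T ∘ allowed) A × Pointwise Fin._<_ A B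

T-∧ : ∀ b c → T b → T c → T (b ∧ c)
T-∧ true c _ t = t

T-∧⁻ : ∀ b c → T (b ∧ c) → T b × T c
T-∧⁻ true c t = tt , t

T-∖ : ∀ {n} (allowed : Fin n → Bool) {a b} → a ≢ b → T (allowed b) → T ((allowed ∖ a) b)
T-∖ allowed a≢b t = subst T (sym (∖-other allowed (a≢b ∘ sym))) t

T-∖⁻ : ∀ {n} (allowed : Fin n → Bool) {a b} → T ((allowed ∖ a) b) → a ≢ b × T (allowed b)
T-∖⁻ allowed {a} t = (λ { refl → subst T (∖-self allowed a) t }) , proj₁ (T-∧⁻ _ _ t)

admissible⇒ : ∀ {n d} allowed (A B : Vec (Fin n) d) → T (admissible allowed A B) → Admissible allowed A B
admissible⇒ allowed []      []      _ = [] , [] , []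
admissible⇒ allowed (a ∷ A) (b ∷ B) t =
  let t₁ , t₂ = T-∧⁻ (allowed a ∧ does (a Fin.<? b)) _ t
      ta , a<b = T-∧⁻ (allowed a) _ t₁
      unique , all , lt = admissible⇒ (allowed ∖ a) A B t₂
  in VAll.map (proj₁ ∘ T-∖⁻ allowed) all ∷ unique
   , ta ∷ VAll.map (proj₂ ∘ T-∖⁻ allowed) all
   , toWitness′ (a Fin.<? b) a<b ∷ lt
  where
  toWitness′ : ∀ {P : Set} (P? : Dec P) → T (does P?) → P
  toWitness′ (yes p) _ = p

admissible⇐ : ∀ {n d} allowed (A B : Vec (Fin n) d) → Admissible allowed A B → T (admissible allowed A B)
admissible⇐ allowed []      []      _ = tt
admissible⇐ allowed (a ∷ A) (b ∷ B) (a≢ ∷ unique , ta ∷ all , a<b ∷ lt) =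
  T-∧ (allowed a ∧ does (a Fin.<? b)) _ (T-∧ (allowed a) _ ta (subst T (sym (dec-true (a Fin.<? b) a<b)) tt))
    (admissible⇐ (allowed ∖ a) A B (unique , VAll.map (λ (a≢b , t) → T-∖ allowed a≢b t) (VAll.zip (a≢ , all)) , lt))

outsideOf : ∀ {n d} → Vec (Fin n) d → Fin n → Bool
outsideOf B a = not (does (_∈?_ Fin._≟_ a B))

below?-admissible : ∀ {n d} (B A : Vec (Fin n) d) → does (below? B A) ≡ admissible (outsideOf B) A B
below?-admissible B A = does-⇔ (mk⇔
    (λ (unique , disjoint , lt) → admissible⇐ _ A B (unique , VAll.map (λ {a} → T-not {P? = _∈?_ Fin._≟_ a B}) disjoint , lt))
    (λ t → let unique , all , lt = admissible⇒ (outsideOf B) A B t in unique , VAll.map (λ {a} → T-not⁻ (_∈?_ Fin._≟_ a B)) all , lt))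
  (below? B A) (T? (admissible (outsideOf B) A B))
  where
  T-not : ∀ {P : Set} {P? : Dec P} → ¬ P → T (not (does P?))
  T-not {P? = yes p} ¬p = ¬p p
  T-not {P? = no _}  _  = tt
  T-not⁻ : ∀ {P : Set} (P? : Dec P) → T (not (does P?)) → ¬ P
  T-not⁻ (no ¬p) _ = ¬p

∑-filter : ∀ {A : Set} {P : A → Set} (P? : ∀ a → Dec (P a)) (f : A → ℝ) as →
  ∑[ List.filter P? as ] f ≈ ∑[ as ] λ a → if does (P? a) then f a else 0ℝ
∑-filter P? f [] = ≈-refl
∑-filter P? f (a ∷ as) with does (P? a)
... | true  = +-congˡ (f a) (∑-filter P? f as)
... | false = ≈-trans (∑-filter P? f as) (≈-sym (+-identityˡ _))

if-cong : ∀ b → x ≈ y → (if b then x else 0ℝ) ≈ (if b then y else 0ℝ)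
if-cong true  e = e
if-cong false e = ≈-refl

-- Halfway between χ and `Φ`: the sum over `A` is already nested, but each entry still ranges over
-- all indices, subject to a test.
Ψ : ∀ {n d} → ℝ^ n → (Fin n → Bool) → Vec (Fin n) d → ℝ
Ψ x allowed []      = 1ℝ
Ψ {n} x allowed (b ∷ B) = ∑[ allFin n ] λ a →
  if allowed a ∧ does (a Fin.<? b) then (x a - x b) * Ψ x (allowed ∖ a) B else 0ℝ

∑-admissible : ∀ {n d} (x : ℝ^ n) allowed (B : Vec (Fin n) d) →
  ∑[ vectorsOver (allFin n) d ] (λ A → if admissible allowed A B then χ₂ A B x else 0ℝ) ≈ Ψ x allowed B
∑-admissible x allowed [] = +-identityʳ 1ℝ
∑-admissible {n} {suc d} x allowed (b ∷ B) = ≈-trans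
  (∑-cartesianProductWith _∷_ (allFin n) (vectorsOver (allFin n) d))
  (∑-cong (allFin n) λ a → inner a (allowed a ∧ does (a Fin.<? b)))
  where
  scale : ∀ b c t → (if b then c * t else 0ℝ) ≈ c * (if b then t else 0ℝ)
  scale true  c t = ≈-refl
  scale false c t = ≈-sym (*-zeroʳ c)
  inner : ∀ a head →
    ∑[ vectorsOver (allFin n) d ] (λ A → if head ∧ admissible (allowed ∖ a) A B then (x a - x b) * χ₂ A B x else 0ℝ) ≈
    (if head then (x a - x b) * Ψ x (allowed ∖ a) B else 0ℝ)
  inner a true = ≈-trans
    (∑-cong (vectorsOver (allFin n) d) λ A → scale (admissible (allowed ∖ a) A B) (x a - x b) (χ₂ A B x))
    (≈-trans (∑-*ˡ (x a - x b) (vectorsOver (allFin n) d)) (*-congˡ (x a - x b) (∑-admissible x (allowed ∖ a) B)))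
  inner a false = ∑-0 (vectorsOver (allFin n) d) λ _ → ≈-refl

χ≈Ψ : ∀ {n d} (x : ℝ^ n) (B : Vec (Fin n) d) → χ B x ≈ Ψ x (outsideOf B) B
χ≈Ψ {n} {d} x B = ≈-trans (∑-filter (below? B) (λ A → χ₂ A B x) (vectorsOver (allFin n) d))
  (≈-trans (∑-cong (vectorsOver (allFin n) d) λ A → ≈-reflexive (cong (λ b → if b then χ₂ A B x else 0ℝ) (below?-admissible B A)))
    (∑-admissible x (outsideOf B) B))

filterᵇ-true : ∀ {A : Set} (f : A → Bool) {a} as → f a ≡ true → List.filterᵇ f (a ∷ as) ≡ a ∷ List.filterᵇ f as
filterᵇ-true f as e rewrite e = refl

filterᵇ-false : ∀ {A : Set} (f : A → Bool) {a} as → f a ≡ false → List.filterᵇ f (a ∷ as) ≡ List.filterᵇ f as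
filterᵇ-false f as e rewrite e = refl

filterᵇ-∖ : ∀ {n} (allowed : Fin n → Bool) {a as} → All (a ≢_) as → List.filterᵇ (allowed ∖ a) as ≡ List.filterᵇ allowed as
filterᵇ-∖ allowed [] = refl
filterᵇ-∖ allowed {a} {b ∷ as} (a≢b ∷ hs) = by-cases (allowed b) refl
  where
  by-cases : ∀ t → allowed b ≡ t → List.filterᵇ (allowed ∖ a) (b ∷ as) ≡ List.filterᵇ allowed (b ∷ as)
  by-cases true e = trans (filterᵇ-true (allowed ∖ a) as (trans (∖-other allowed (a≢b ∘ sym)) e))
    (trans (cong (b ∷_) (filterᵇ-∖ allowed hs)) (sym (filterᵇ-true allowed as e)))
  by-cases false e = trans (filterᵇ-false (allowed ∖ a) as (trans (∖-other allowed (a≢b ∘ sym)) e))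
    (trans (filterᵇ-∖ allowed hs) (sym (filterᵇ-false allowed as e)))

-- `picks` removes an entry by position, the allowed set removes it by value; without repetitions
-- these agree.
∑-picks-filterᵇ : ∀ {n} (allowed : Fin n → Bool) (g : Fin n × List (Fin n) → ℝ) {as} → Unique as →
  ∑[ picks (List.filterᵇ allowed as) ] g ≈ ∑[ as ] λ a → if allowed a then g (a , List.filterᵇ (allowed ∖ a) as) else 0ℝ
∑-picks-filterᵇ allowed g [] = ≈-refl
∑-picks-filterᵇ {n} allowed g {c ∷ as} (c≢ ∷ unique) = by-cases (allowed c) refl
  where
  open ≈-Reasoning
  term : List (Fin n) → Fin n → ℝ
  term as a = if allowed a then g (a , List.filterᵇ (allowed ∖ a) as) else 0ℝ
  by-cases : ∀ t → allowed c ≡ t → ∑[ picks (List.filterᵇ allowed (c ∷ as)) ] g ≈ ∑[ c ∷ as ] (term (c ∷ as))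
  by-cases true e = begin
    ∑[ picks (List.filterᵇ allowed (c ∷ as)) ] g
      ≈⟨ ≈-reflexive (cong (λ l → ∑[ picks l ] g) (filterᵇ-true allowed as e)) ⟩
    ∑[ picks (c ∷ List.filterᵇ allowed as) ] g
      ≈⟨ ∑-picks-∷ c (List.filterᵇ allowed as) ⟩
    g (c , List.filterᵇ allowed as) + ∑[ picks (List.filterᵇ allowed as) ] (λ (b , bs) → g (b , c ∷ bs))
      ≈⟨ +-cong
           (≈-reflexive (trans
             (cong (λ l → g (c , l)) (sym (trans (filterᵇ-false (allowed ∖ c) as (∖-self allowed c)) (filterᵇ-∖ allowed c≢))))
             (cong (λ t → if t then g (c , List.filterᵇ (allowed ∖ c) (c ∷ as)) else 0ℝ) (sym e))))
           (≈-trans (∑-picks-filterᵇ allowed (λ (b , bs) → g (b , c ∷ bs)) unique)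
             (∑-congᴬ (All.map (λ {a} c≢a → if-cong (allowed a) (≈-reflexive (cong (λ l → g (a , l))
               (sym (filterᵇ-true (allowed ∖ a) as (trans (∖-other allowed c≢a) e)))))) c≢))) ⟩
    ∑[ c ∷ as ] (term (c ∷ as)) ∎
  by-cases false e = begin
    ∑[ picks (List.filterᵇ allowed (c ∷ as)) ] g
      ≈⟨ ≈-reflexive (cong (λ l → ∑[ picks l ] g) (filterᵇ-false allowed as e)) ⟩
    ∑[ picks (List.filterᵇ allowed as) ] g
      ≈⟨ ∑-picks-filterᵇ allowed g unique ⟩
    ∑[ as ] (term as)
      ≈⟨ ∑-cong as (λ a → if-cong (allowed a) (≈-reflexive (cong (λ l → g (a , l))
           (sym (filterᵇ-false (allowed ∖ a) as (cong (_∧ not (does (c Fin.≟ a))) e)))))) ⟩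
    ∑[ as ] (term (c ∷ as))
      ≈⟨ +-identityˡ _ ⟨
    0ℝ + ∑[ as ] (term (c ∷ as))
      ≈⟨ +-cong (≈-reflexive (cong (λ t → if t then g (c , List.filterᵇ (allowed ∖ c) (c ∷ as)) else 0ℝ) (sym e))) ≈-refl ⟩
    ∑[ c ∷ as ] (term (c ∷ as)) ∎

∑-↭ : ∀ {A : Set} {f : A → ℝ} {as bs} → as ↭ bs → ∑[ as ] f ≈ ∑[ bs ] f
∑-↭ ↭.refl = ≈-refl
∑-↭ {f = f} (↭.prep a ρ) = +-congˡ (f a) (∑-↭ ρ)
∑-↭ {f = f} (↭.swap {as} {bs} a b ρ) = ≈-trans (+-congˡ (f a) (+-congˡ (f b) (∑-↭ ρ)))
  (solve 3 (λ p q r → p :+ (q :+ r) := q :+ (p :+ r)) ≈-refl (f a) (f b) (∑[ bs ] f))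
  where open ℝ-Solver
∑-↭ (↭.trans ρ σ) = ≈-trans (∑-↭ ρ) (∑-↭ σ)

-- `pre` holds all letters read so far, and the allowed ones among them form the unpaired list of
-- `Φ`; on unread letters the allowed set agrees with the marks. The test `a < c` removes the unread
-- letters from the sum, since these are at least `k`.
Ψ≈Φ : ∀ {n d} (x : ℝ^ n) {B : Vec (Fin n) d} {w} → Spells B w → ∀ allowed k pre →
  Consecutive k (letters w) → All (λ a → toℕ a ℕ.< k) pre → Unique pre → pre ++ letters w ↭ allFin n →
  All (λ (mark , c) → allowed c ≡ not mark) w →
  Ψ x allowed B ≈ Φ x (List.filterᵇ allowed pre) w
Ψ≈Φ x done allowed k pre _ _ _ _ _ = ≈-refl
Ψ≈Φ x (skip {w = w} c s) allowed k pre (c≡k , h) pre<k unique ρ (e ∷ es) = ≈-trans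
  (Ψ≈Φ x s allowed (suc k) (c ∷ pre) h (s≤s (ℕ.≤-reflexive c≡k) ∷ All.map ℕ.m<n⇒m<1+n pre<k)
    (All.map (λ {a} a<k c≡a → ℕ.<-irrefl (trans (cong toℕ (sym c≡a)) c≡k) a<k) pre<k ∷ unique)
    (↭-trans (↭-sym (↭.shift c pre (letters w))) ρ) es)
  (≈-reflexive (cong (λ U → Φ x U w) (filterᵇ-true allowed pre e)))
Ψ≈Φ {n} x (take {B = B} {w} c s) allowed k pre (c≡k , h) pre<k unique ρ (e ∷ es) = begin
  ∑[ allFin n ] term
    ≈⟨ ∑-↭ ρ ⟨
  ∑[ pre ++ c ∷ letters w ] term
    ≈⟨ ∑-++ pre (c ∷ letters w) ⟩
  ∑[ pre ] term + ∑[ c ∷ letters w ] term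
    ≈⟨ +-cong (∑-congᴬ (All.map term-before pre<k))
         (≈-trans (∑-congᴬ (All.map term-after (consecutive-≥ k (c ∷ letters w) (c≡k , h)))) (∑-0 (c ∷ letters w) λ _ → ≈-refl)) ⟩
  ∑[ pre ] (λ a → if allowed a then (x a - x c) * Φ x (List.filterᵇ (allowed ∖ a) pre) w else 0ℝ) + 0ℝ
    ≈⟨ +-identityʳ _ ⟩
  ∑[ pre ] (λ a → if allowed a then (x a - x c) * Φ x (List.filterᵇ (allowed ∖ a) pre) w else 0ℝ)
    ≈⟨ ∑-picks-filterᵇ allowed (λ (u , us) → (x u - x c) * Φ x us w) unique ⟨
  Φ x (List.filterᵇ allowed pre) ((true , c) ∷ w) ∎
  where
  open ≈-Reasoning
  term : Fin n → ℝ
  term a = if allowed a ∧ does (a Fin.<? c) then (x a - x c) * Ψ x (allowed ∖ a) B else 0ℝ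
  term-after : ∀ {a} → k ℕ.≤ toℕ a → term a ≈ 0ℝ
  term-after {a} k≤a = ≈-reflexive (cong (λ t → if t then (x a - x c) * Ψ x (allowed ∖ a) B else 0ℝ)
    (trans (cong (allowed a ∧_) (dec-false (a Fin.<? c) (ℕ.≤⇒≯ (subst (ℕ._≤ toℕ a) (sym c≡k) k≤a)))) (Bool.∧-zeroʳ (allowed a))))
  marks : ∀ {a} → toℕ a ℕ.< k → ∀ v → All (λ i → suc k ℕ.≤ toℕ i) (letters v) →
          All (λ (mark , i) → allowed i ≡ not mark) v → All (λ (mark , i) → (allowed ∖ a) i ≡ not mark) v
  marks a<k []            _          _        = []
  marks a<k ((_ , i) ∷ v) (k<i ∷ gt) (f ∷ fs) =
    trans (∖-other allowed (λ i≡a → ℕ.<-irrefl (cong toℕ (sym i≡a)) (ℕ.<-trans a<k k<i))) f ∷ marks a<k v gt fs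
  term-before : ∀ {a} → toℕ a ℕ.< k → term a ≈ (if allowed a then (x a - x c) * Φ x (List.filterᵇ (allowed ∖ a) pre) w else 0ℝ)
  term-before {a} a<k = ≈-trans
    (≈-reflexive (cong (λ t → if t then (x a - x c) * Ψ x (allowed ∖ a) B else 0ℝ)
      (trans (cong (allowed a ∧_) (dec-true (a Fin.<? c) (subst (toℕ a ℕ.<_) (sym c≡k) a<k))) (Bool.∧-identityʳ (allowed a)))))
    (if-cong (allowed a) (*-congˡ (x a - x c) (≈-trans
      (Ψ≈Φ x s (allowed ∖ a) (suc k) (c ∷ pre) h (s≤s (ℕ.≤-reflexive c≡k) ∷ All.map ℕ.m<n⇒m<1+n pre<k)
        (All.map (λ {b} b<k c≡b → ℕ.<-irrefl (trans (cong toℕ (sym c≡b)) c≡k) b<k) pre<k ∷ unique)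
        (↭-trans (↭-sym (↭.shift c pre (letters w))) ρ)
        (marks a<k w (consecutive-≥ (suc k) (letters w) h) es))
      (≈-reflexive (cong (λ U → Φ x U w) (filterᵇ-false (allowed ∖ a) pre (cong (_∧ not (does (c Fin.≟ a))) e)))))))

outsideOf-∈ : ∀ {n d} {B : Vec (Fin n) d} {a} → a ∈ B → outsideOf B a ≡ false
outsideOf-∈ {B = B} {a} a∈B = cong not (dec-true (_∈?_ Fin._≟_ a B) a∈B)

outsideOf-∉ : ∀ {n d} {B : Vec (Fin n) d} {a} → ¬ (a ∈ B) → outsideOf B a ≡ true
outsideOf-∉ {B = B} {a} a∉B = cong not (dec-false (_∈?_ Fin._≟_ a B) a∉B)

spells-> : ∀ {n d} {B : Vec (Fin n) d} {w} → Spells B w → ∀ k → Consecutive k (letters w) → ∀ {a} → a ∈ B → k ℕ.≤ toℕ a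
spells-> (skip c s) k (_ , h)    a∈B         = ℕ.<⇒≤ (spells-> s (suc k) h a∈B)
spells-> (take c s) k (refl , _) (here refl) = ℕ.≤-refl
spells-> (take c s) k (_ , h)    (there a∈B) = ℕ.<⇒≤ (spells-> s (suc k) h a∈B)

spells-marks : ∀ {n d} {B : Vec (Fin n) d} {w} → Spells B w → ∀ k → Consecutive k (letters w) →
               All (λ (mark , c) → outsideOf B c ≡ not mark) w
spells-marks done k _ = []
spells-marks (skip c s) k (refl , h) =
  outsideOf-∉ (λ c∈B → ℕ.<-irrefl refl (spells-> s (suc k) h c∈B)) ∷ spells-marks s (suc k) h
spells-marks {B = c ∷ B} {(_ , _) ∷ w} (take c s) k (refl , h) = outsideOf-∈ {B = c ∷ B} (here refl)
  ∷ later w (consecutive-≥ (suc k) (letters w) h) (spells-marks s (suc k) h)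
  where
  not-head : ∀ {i} → toℕ c ℕ.< toℕ i → outsideOf (c ∷ B) i ≡ outsideOf B i
  not-head {i} c<i = cong not (does-⇔ (mk⇔ (λ { (here refl) → ⊥-elim (ℕ.<-irrefl refl c<i) ; (there i∈B) → i∈B }) there)
    (_∈?_ Fin._≟_ i (c ∷ B)) (_∈?_ Fin._≟_ i B))
  later : ∀ v → All (λ i → toℕ c ℕ.< toℕ i) (letters v) →
          All (λ (mark , i) → outsideOf B i ≡ not mark) v → All (λ (mark , i) → outsideOf (c ∷ B) i ≡ not mark) v
  later []            _          _        = []
  later ((_ , i) ∷ v) (c<i ∷ gt) (f ∷ fs) = trans (not-head c<i) f ∷ later v gt fs

topSet-word : ∀ {n d} (B : Vec (Fin n) d) → AllPairs Fin._<_ B → ∃[ w ] letters w ≡ allFin n × Spells B w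
topSet-word {n} B inc = spell 0 (allFin n) (tabulate-consecutive 0 id (λ _ → refl)) (List.length-tabulate id) B inc (VAll.universal (λ _ → z≤n) B)

χ≈Φ : ∀ {n d} (x : ℝ^ n) {B : Vec (Fin n) d} {w} → letters w ≡ allFin n → Spells B w → χ B x ≈ Φ x [] w
χ≈Φ {n} x {B} {w} lw s = ≈-trans (χ≈Ψ x B) (Ψ≈Φ x s (outsideOf B) 0 [] consecutive [] [] (↭.↭-reflexive lw) (spells-marks s 0 consecutive))
  where
  consecutive : Consecutive 0 (letters w)
  consecutive = subst (Consecutive 0) (sym lw) (tabulate-consecutive 0 id (λ _ → refl))

-- The norm of χ_B

χ-norm : ∀ {n d} (le : d ℕ.* 2 ℕ.≤ n) (B : Vec (Fin n) d) → AllPairs Fin._<_ B → (E : ExchangeableMeasure n) →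
  let open ExchangeableMeasure E in ∀ {v} →
  HasSquaredNorm measure (χ-canonical d le) v → HasSquaredNorm measure (χ B) (fromℚ (c B) * v)
χ-norm {n} {d} le B inc E {v} canonical =
  let w , lw , s = topSet-word B inc
      consecutive = subst (Consecutive 0) (sym lw) (tabulate-consecutive 0 id (λ _ → refl))
  in integral-cong
       (λ x → square-cong (≈-trans (*-identityˡ (Φ x [] w)) (≈-sym (χ≈Φ x lw s))))
       (≈-reflexive (cong (λ q → fromℚ q * v) (weight≡c s consecutive)))
       (norm-formula d w (spells-marked s) [] [] refl (↭.↭-reflexive lw))
  where
  open Integration (ExchangeableMeasure.measure E)
  open Norms E d le canonical

theorem3p2 : (n d : ℕ) → 1 ℕ.≤ n → (2d≤n : d ℕ.* 2 ℕ.≤ n) →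
    (B : Vec (Fin n) d) → IsTopSet B →
    (E : ExchangeableMeasure n) → let open ExchangeableMeasure E in
    Integrable measure (λ x → χ B x * χ B x) ×
    Integrable measure (λ x → χ-canonical d 2d≤n x * χ-canonical d 2d≤n x) ×
    (∀ v w → HasSquaredNorm measure (χ B) v → HasSquaredNorm measure (χ-canonical d 2d≤n) w →
    v ≈ fromℚ (c B) * w)
theorem3p2 n d _ 2d≤n B (inc , _) E =
  let v , canonical = canonical-integrable E d 2d≤n
  in (fromℚ (c B) * v , χ-norm 2d≤n B inc E canonical)
   , (v , canonical)
   -- Both values are arbitrary: `J` turns the given `w` into a value for χ_B, and uniqueness
   -- identifies it with `v`.
   , λ v w I J → Integration.integral-unique (ExchangeableMeasure.measure E) I (χ-norm 2d≤n B inc E J)
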